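{- Let $\mathcal{M}=(E,\rho)$ be a $q$-matroid, $l=\dim\mathrm{cl}(0)$ and $f=\dim E-\dim\mathrm{cyc}(E)$. (a) There exists a full $q$-matroid $\mathcal{M}'$ such that $\mathcal{M}\approx\mathcal{U}_{0,l}\oplus\mathcal{U}_{f,f}\oplus\mathcal{M}'$. (b) If $\mathcal{M}\approx\mathcal{U}_{0,a}\oplus\mathcal{U}_{b,b}\oplus\mathcal{N}$ with $\mathcal{N}$ full, then $a=l$, $b=f$ and $\mathcal{N}\approx\mathcal{M}'$.
   Context: Let $\mathbb{F}=\mathbb{F}_q$. A $q$-matroid is $\mathcal{M}=(E,\rho)$, $E$ a finite-dimensional $\mathbb{F}$-vector space, $\rho$ from subspaces to $\mathbb{Z}_{\ge0}$ with $0\le\rho(V)\le\dim V$, monotone and submodular. Closure: $\mathrm{cl}(V)=\sum\{\langle x\rangle: \rho(V+\langle x\rangle)=\rho(V)\}$. Cyclic core: $\mathrm{cyc}(V)=\{x\in V\mid\rho(W)=\rho(V)\text{ for all }W\le V\text{ with }W+\langle x\rangle=V\}$. $\mathcal{M}$ is full if $\mathrm{cl}(0)=0$ and $\mathrm{cyc}(E)=E$. The uniform $q$-matroid $\mathcal{U}_k(E)$ has $\rho(V)=\min\{k,\dim V\}$; $\mathcal{U}_{0,n}$ and $\mathcal{U}_{n,n}$ denote $\mathcal{U}_0(E)$ and $\mathcal{U}_n(E)$ on some $n$-dimensional space $E$ (defined up to equivalence). Equivalence $\approx$: an $\mathbb{F}$-isomorphism of ground spaces preserving rank. Direct sum: for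 $E=E_1\oplus E_2$ with projections $\pi_i$, $\mathcal{M}_1\oplus\mathcal{M}_2=(E,\rho)$ with $\rho(V)=\dim V+\min_{X\le V}(\rho_1(\pi_1(X))+\rho_2(\pi_2(X))-\dim X)$; this is associative. -}

module Defs where

open import Algebra.Bundles using (CommutativeRing)
open import Algebra.Module.Bundles using (LeftModule)
open import Algebra.Module.Morphism.Structures using (module LeftModuleMorphisms)
import Algebra.Module.Construct.DirectProduct as DirectProduct
import Algebra.Module.Construct.TensorUnit as TensorUnit
import Algebra.Module.Construct.Zero as Zero
import Algebra.Properties.Monoid.Sum as MonoidSum
open import Data.Bool.Base using (Bool; T)
open import Data.Bool.Properties using (T?)
open import Data.Empty using (⊥-elim)
open import Data.Fin.Base using (Fin; zero; suc; _↑ˡ_; _↑ʳ_; splitAt)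
open import Data.Fin.Properties using (all?; splitAt⁻¹-↑ˡ; splitAt⁻¹-↑ʳ)
open import Data.List.Base as List using (List; []; _∷_; filter; foldr; cartesianProductWith)
open import Data.List.Extrema.Nat using (min)
open import Data.List.Membership.Setoid.Properties using (∈-cartesianProductWith⁺)
import Data.List.Membership.Setoid as SetoidMembership
open import Data.List.Relation.Unary.All using (lookupₛ)
import Data.List.Relation.Unary.All as All
open import Data.List.Relation.Unary.Any using (Any; here; there; any?; satisfied)
import Data.List.Relation.Unary.Any as Any
open import Data.List.Relation.Unary.Any.Properties using (++⁺ˡ; ++⁺ʳ; map⁺)
import Data.List.Relation.Unary.Enumerates.Setoid as Enumerates
open import Data.Nat.Base as ℕ using (ℕ; _⊓_; _∸_; _≤_)
import Data.Nat.Properties as ℕ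
open import Data.Product.Base using (∃; _×_; _,_; proj₁; proj₂)
open import Data.Sum.Base using (inj₁; inj₂)
open import Data.Unit.Base using (⊤; tt)
import Data.Vec.Functional as Vector
open import Data.Vec.Functional using (Vector)
import Data.Vec.Functional.Relation.Binary.Equality.Setoid as VectorEquality
open import Data.Vec.Functional.Properties using (lookup-++ˡ; lookup-++ʳ)
open import Function.Base using (_∘_)
open import Level using (Level; _⊔_) renaming (suc to lsuc)
open import Relation.Binary.Bundles using (Setoid)
open import Relation.Binary.Definitions using (_Respects_)
import Relation.Binary.Definitions as Binary
open import Relation.Binary.PropositionalEquality.Core as ≡ using (_≡_)
import Relation.Binary.Reasoning.Setoid as SetoidReasoning
open import Relation.Nullary.Decidable.Core
  using (Dec; yes; no; map′; _×-dec_; _→-dec_; ⌊_⌋; toWitness; fromWitness)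
open import Relation.Nullary.Negation.Core using (¬_; contradiction)
open import Relation.Unary using (Pred; Decidable)

private
  variable
    a p c ℓ m ℓm n ℓn : Level

module _ (S : Setoid a ℓ) {xs : List (Setoid.Carrier S)}
         (enum : Enumerates.IsEnumeration S xs) where
  open Setoid S

  ∃-dec : {P : Pred Carrier p} → P Respects _≈_ → Decidable P → Dec (∃ P)
  ∃-dec resp P? = map′ satisfied
    (λ (x , px) → SetoidMembership.lose S resp (enum x) px) (any? P? xs)

  ∀-dec : {P : Pred Carrier p} → P Respects _≈_ → Decidable P → Dec (∀ x → P x)
  ∀-dec resp P? = map′ (λ ps x → lookupₛ S resp ps (enum x))
    (λ f → All.universal f xs) (All.all? P? xs)

record FiniteField c ℓ : Set (lsuc (c ⊔ ℓ)) where
  field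
    commutativeRing : CommutativeRing c ℓ
  open CommutativeRing commutativeRing public
  open Enumerates setoid using (IsEnumeration)
  infix 4 _≟_
  field
    1≉0         : ¬ (1# ≈ 0#)
    inverse     : ∀ x → ¬ (x ≈ 0#) → ∃ λ y → y * x ≈ 1#
    _≟_         : Binary.Decidable _≈_
    elements    : List Carrier
    enumeration : IsEnumeration elements

module _ (F : FiniteField c ℓ) where
  private module F = FiniteField F
  open VectorEquality F.setoid using (_≋_; ≋-setoid)

  vectors : ∀ n → List (Vector F.Carrier n)
  vectors ℕ.zero    = Vector.[] ∷ []
  vectors (ℕ.suc n) = cartesianProductWith Vector._∷_ F.elements (vectors n)

  vectors-enumeration : ∀ n → Enumerates.IsEnumeration (≋-setoid n) (vectors n)
  vectors-enumeration ℕ.zero    v = here λ ()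
  vectors-enumeration (ℕ.suc n) v =
    Any.map (λ { e zero → e zero ; e (suc i) → e (suc i) })
      (∈-cartesianProductWith⁺ F.setoid (≋-setoid n) (≋-setoid (ℕ.suc n))
        (λ { x≈y _ zero → x≈y ; _ u≋v (suc i) → u≋v i })
        (F.enumeration (v zero)) (vectors-enumeration n (v ∘ suc)))

  module LinearCombination (E : LeftModule F.ring m ℓm) where
    open LeftModule E
    open MonoidSum +ᴹ-monoid using (sum; sum-cong-≋; sum-replicate-zero)

    lincomb : ∀ {n} → Vector F.Carrier n → Vector Carrierᴹ n → Carrierᴹ
    lincomb α v = sum (λ i → α i *ₗ v i)

    LinearlyIndependent : ∀ {n} → Vector Carrierᴹ n → Set _
    LinearlyIndependent v = ∀ α → lincomb α v ≈ᴹ 0ᴹ → ∀ i → α i F.≈ F.0#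

    InSpan : ∀ {n} → Vector Carrierᴹ n → Pred Carrierᴹ _
    InSpan v x = ∃ λ α → lincomb α v ≈ᴹ x

    lincomb-cong : ∀ {n} {α β : Vector F.Carrier n} v → α ≋ β → lincomb α v ≈ᴹ lincomb β v
    lincomb-cong v α≋β = sum-cong-≋ λ i → *ₗ-cong (α≋β i) ≈ᴹ-refl

    lincomb-zero : ∀ {n} {α : Vector F.Carrier n} v → (∀ i → α i F.≈ F.0#) → lincomb α v ≈ᴹ 0ᴹ
    lincomb-zero {n} v α≈0 = ≈ᴹ-trans
      (sum-cong-≋ λ i → ≈ᴹ-trans (*ₗ-cong (α≈0 i) ≈ᴹ-refl) (*ₗ-zeroˡ (v i)))
      (sum-replicate-zero n)

  record VectorSpace m ℓm : Set (c ⊔ ℓ ⊔ lsuc (m ⊔ ℓm)) where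
    field
      leftModule : LeftModule F.ring m ℓm
    open LeftModule leftModule public
    open LinearCombination leftModule public
    field
      {dimension} : ℕ
      basis       : Vector Carrierᴹ dimension
      independent : LinearlyIndependent basis
      spanning    : ∀ x → InSpan basis x

    infix 4 _≟ᴹ_
    opaque
      _≟ᴹ_ : Binary.Decidable _≈ᴹ_
      x ≟ᴹ y with spanning (x +ᴹ -ᴹ y)
      ... | α , eq = map′
        (λ α≈0 → let open SetoidReasoning ≈ᴹ-setoid in begin
          x                  ≈⟨ +ᴹ-identityʳ x ⟨
          x +ᴹ 0ᴹ            ≈⟨ +ᴹ-congˡ (-ᴹ‿inverseˡ y) ⟨
          x +ᴹ (-ᴹ y +ᴹ y)   ≈⟨ +ᴹ-assoc x (-ᴹ y) y ⟨
          (x +ᴹ -ᴹ y) +ᴹ y   ≈⟨ +ᴹ-congʳ eq ⟨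
          lincomb α basis +ᴹ y ≈⟨ +ᴹ-congʳ (lincomb-zero basis α≈0) ⟩
          0ᴹ +ᴹ y            ≈⟨ +ᴹ-identityˡ y ⟩
          y                  ∎)
        (λ x≈y → independent α (≈ᴹ-trans eq
          (≈ᴹ-trans (+ᴹ-congʳ x≈y) (-ᴹ‿inverseʳ y))))
        (all? λ i → α i F.≟ F.0#)

    opaque
      vectorList : List Carrierᴹ
      vectorList = List.map (λ α → lincomb α basis) (vectors dimension)

      vectorList-enumeration : Enumerates.IsEnumeration ≈ᴹ-setoid vectorList
      vectorList-enumeration x with spanning x
      ... | α , eq = map⁺ (Any.map
        (λ α≋β → ≈ᴹ-trans (≈ᴹ-sym eq) (lincomb-cong basis α≋β))
        (vectors-enumeration dimension α))

module Subspaces {F : FiniteField c ℓ} (E : VectorSpace F m ℓm) where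
  private module F = FiniteField F
  open VectorSpace E
  open VectorEquality F.setoid using (_≋_; ≋-setoid)

  record IsSubspace (P : Pred Carrierᴹ p) : Set (c ⊔ m ⊔ ℓm ⊔ p) where
    field
      resp     : P Respects _≈ᴹ_
      0-mem    : P 0ᴹ
      +-closed : ∀ {x y} → P x → P y → P (x +ᴹ y)
      *-closed : ∀ α {x} → P x → P (α *ₗ x)

  -- E has finitely many vectors, so every subspace is decidable and is
  -- represented by its characteristic function.
  record Subspace : Set (c ⊔ m ⊔ ℓm) where
    field
      member     : Carrierᴹ → Bool
      isSubspace : IsSubspace (T ∘ member)
    open IsSubspace isSubspace public

  infix 4 _∈_ _∈?_ _⊆_ _≐_ _⊆?_ _≐?_

  _∈_ : Carrierᴹ → Subspace → Set
  x ∈ V = T (Subspace.member V x)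

  _∈?_ : ∀ x V → Dec (x ∈ V)
  x ∈? V = T? (Subspace.member V x)

  _⊆_ _≐_ : Subspace → Subspace → Set m
  V ⊆ W = ∀ x → x ∈ V → x ∈ W
  V ≐ W = V ⊆ W × W ⊆ V

  _⊆?_ : ∀ V W → Dec (V ⊆ W)
  V ⊆? W = ∀-dec ≈ᴹ-setoid vectorList-enumeration
    (λ x≈y f y∈V → Subspace.resp W x≈y (f (Subspace.resp V (≈ᴹ-sym x≈y) y∈V)))
    (λ x → (x ∈? V) →-dec (x ∈? W))

  _≐?_ : ∀ V W → Dec (V ≐ W)
  V ≐? W = (V ⊆? W) ×-dec (W ⊆? V)

  ≐-setoid : Setoid (c ⊔ m ⊔ ℓm) m
  ≐-setoid = record
    { Carrier = Subspace
    ; _≈_ = _≐_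
    ; isEquivalence = record
      { refl  = (λ _ v → v) , (λ _ v → v)
      ; sym   = λ (f , g) → g , f
      ; trans = λ (f , g) (h , k) → (λ x → h x ∘ f x) , (λ x → g x ∘ k x)
      }
    }

  -- The subspace carved out by a decidable predicate.  This and the subspaces
  -- built from it are opaque so that type checking never unfolds the decision
  -- procedures; their membership lemmas determine them up to _≐_.
  module _ {P : Pred Carrierᴹ p} (P? : Decidable P) (isSub : IsSubspace P) where
    private module P = IsSubspace isSub

    opaque
      comprehension : Subspace
      comprehension = record
        { member = λ x → ⌊ P? x ⌋
        ; isSubspace = record
          { resp     = λ {x} {y} x≈y u → fromWitness {a? = P? y} (P.resp x≈y (toWitness {a? = P? x} u))
          ; 0-mem    = fromWitness {a? = P? 0ᴹ} P.0-mem
          ; +-closed = λ {x} {y} u v → fromWitness {a? = P? (x +ᴹ y)}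
                         (P.+-closed (toWitness {a? = P? x} u) (toWitness {a? = P? y} v))
          ; *-closed = λ α {x} u → fromWitness {a? = P? (α *ₗ x)}
                         (P.*-closed α (toWitness {a? = P? x} u))
          }
        }

      ∈-comprehension⁺ : ∀ {x} → P x → x ∈ comprehension
      ∈-comprehension⁺ {x} = fromWitness {a? = P? x}

      ∈-comprehension⁻ : ∀ {x} → x ∈ comprehension → P x
      ∈-comprehension⁻ {x} = toWitness {a? = P? x}

  ≈0-isSubspace : IsSubspace (_≈ᴹ 0ᴹ)
  ≈0-isSubspace = record
    { resp     = λ x≈y x≈0 → ≈ᴹ-trans (≈ᴹ-sym x≈y) x≈0
    ; 0-mem    = ≈ᴹ-refl
    ; +-closed = λ x≈0 y≈0 → ≈ᴹ-trans (+ᴹ-cong x≈0 y≈0) (+ᴹ-identityˡ 0ᴹ)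
    ; *-closed = λ α x≈0 → ≈ᴹ-trans (*ₗ-cong F.refl x≈0) (*ₗ-zeroʳ α)
    }

  infixr 7 _∩_
  infixr 6 _+ˢ_

  opaque
    0ˢ : Subspace
    0ˢ = comprehension (_≟ᴹ 0ᴹ) ≈0-isSubspace

    ∈-0⁺ : ∀ {x} → x ≈ᴹ 0ᴹ → x ∈ 0ˢ
    ∈-0⁺ = ∈-comprehension⁺ (_≟ᴹ 0ᴹ) ≈0-isSubspace

    ∈-0⁻ : ∀ {x} → x ∈ 0ˢ → x ≈ᴹ 0ᴹ
    ∈-0⁻ = ∈-comprehension⁻ (_≟ᴹ 0ᴹ) ≈0-isSubspace

  opaque
    whole : Subspace
    whole = comprehension {P = λ _ → ⊤} (λ _ → yes tt) _

    ∈-whole : ∀ {x} → x ∈ whole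
    ∈-whole = ∈-comprehension⁺ {P = λ _ → ⊤} (λ _ → yes tt) _ tt

  ∩-isSubspace : ∀ V W → IsSubspace (λ x → x ∈ V × x ∈ W)
  ∩-isSubspace V W = record
    { resp     = λ x≈y (u , v) → V.resp x≈y u , W.resp x≈y v
    ; 0-mem    = V.0-mem , W.0-mem
    ; +-closed = λ (u , v) (u′ , v′) → V.+-closed u u′ , W.+-closed v v′
    ; *-closed = λ α (u , v) → V.*-closed α u , W.*-closed α v
    }
    where module V = Subspace V
          module W = Subspace W

  opaque
    _∩_ : Subspace → Subspace → Subspace
    V ∩ W = comprehension (λ x → (x ∈? V) ×-dec (x ∈? W)) (∩-isSubspace V W)

    ∈-∩⁺ : ∀ {V W x} → x ∈ V × x ∈ W → x ∈ V ∩ W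
    ∈-∩⁺ {V} {W} = ∈-comprehension⁺ (λ x → (x ∈? V) ×-dec (x ∈? W)) (∩-isSubspace V W)

    ∈-∩⁻ : ∀ {V W x} → x ∈ V ∩ W → x ∈ V × x ∈ W
    ∈-∩⁻ {V} {W} = ∈-comprehension⁻ (λ x → (x ∈? V) ×-dec (x ∈? W)) (∩-isSubspace V W)

  InLine : Carrierᴹ → Pred Carrierᴹ _
  InLine x y = ∃ λ α → y ≈ᴹ α *ₗ x

  InLine? : ∀ x → Decidable (InLine x)
  InLine? x y = ∃-dec F.setoid F.enumeration
    (λ α≈β y≈αx → ≈ᴹ-trans y≈αx (*ₗ-cong α≈β ≈ᴹ-refl)) (λ α → y ≟ᴹ α *ₗ x)

  InLine-isSubspace : ∀ x → IsSubspace (InLine x)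
  InLine-isSubspace x = record
    { resp     = λ y≈z (α , e) → α , ≈ᴹ-trans (≈ᴹ-sym y≈z) e
    ; 0-mem    = F.0# , ≈ᴹ-sym (*ₗ-zeroˡ x)
    ; +-closed = λ (α , e) (β , e′) →
        α F.+ β , ≈ᴹ-trans (+ᴹ-cong e e′) (≈ᴹ-sym (*ₗ-distribʳ x α β))
    ; *-closed = λ β (α , e) →
        β F.* α , ≈ᴹ-trans (*ₗ-cong F.refl e) (≈ᴹ-sym (*ₗ-assoc β α x))
    }

  opaque
    ⟨_⟩ : Carrierᴹ → Subspace
    ⟨ x ⟩ = comprehension (InLine? x) (InLine-isSubspace x)

    ∈-⟨⟩⁺ : ∀ {x y} → InLine x y → y ∈ ⟨ x ⟩
    ∈-⟨⟩⁺ {x} = ∈-comprehension⁺ (InLine? x) (InLine-isSubspace x)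

    ∈-⟨⟩⁻ : ∀ {x y} → y ∈ ⟨ x ⟩ → InLine x y
    ∈-⟨⟩⁻ {x} = ∈-comprehension⁻ (InLine? x) (InLine-isSubspace x)

  InSum : Subspace → Subspace → Pred Carrierᴹ _
  InSum V W x = ∃ λ v → v ∈ V × ∃ λ w → w ∈ W × x ≈ᴹ v +ᴹ w

  InSum? : ∀ V W → Decidable (InSum V W)
  InSum? V W x = ∃-dec ≈ᴹ-setoid vectorList-enumeration
    (λ v≈v′ (v∈V , w , w∈W , e) →
      Subspace.resp V v≈v′ v∈V , w , w∈W , ≈ᴹ-trans e (+ᴹ-congʳ v≈v′))
    λ v → (v ∈? V) ×-dec ∃-dec ≈ᴹ-setoid vectorList-enumeration
      (λ w≈w′ (w∈W , e) → Subspace.resp W w≈w′ w∈W , ≈ᴹ-trans e (+ᴹ-congˡ w≈w′))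
      λ w → (w ∈? W) ×-dec (x ≟ᴹ v +ᴹ w)

  InSum-isSubspace : ∀ V W → IsSubspace (InSum V W)
  InSum-isSubspace V W = record
    { resp     = λ x≈y (v , v∈V , w , w∈W , e) →
        v , v∈V , w , w∈W , ≈ᴹ-trans (≈ᴹ-sym x≈y) e
    ; 0-mem    = 0ᴹ , V.0-mem , 0ᴹ , W.0-mem , ≈ᴹ-sym (+ᴹ-identityˡ 0ᴹ)
    ; +-closed = λ {x} {y} (v , v∈V , w , w∈W , e) (v′ , v′∈V , w′ , w′∈W , e′) →
        v +ᴹ v′ , V.+-closed v∈V v′∈V , w +ᴹ w′ , W.+-closed w∈W w′∈W ,
        (let open SetoidReasoning ≈ᴹ-setoid in begin
          x +ᴹ y                     ≈⟨ +ᴹ-cong e e′ ⟩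
          (v +ᴹ w) +ᴹ (v′ +ᴹ w′)     ≈⟨ +ᴹ-assoc v w _ ⟩
          v +ᴹ (w +ᴹ (v′ +ᴹ w′))     ≈⟨ +ᴹ-congˡ (+ᴹ-assoc w v′ w′) ⟨
          v +ᴹ ((w +ᴹ v′) +ᴹ w′)     ≈⟨ +ᴹ-congˡ (+ᴹ-congʳ (+ᴹ-comm w v′)) ⟩
          v +ᴹ ((v′ +ᴹ w) +ᴹ w′)     ≈⟨ +ᴹ-congˡ (+ᴹ-assoc v′ w w′) ⟩
          v +ᴹ (v′ +ᴹ (w +ᴹ w′))     ≈⟨ +ᴹ-assoc v v′ _ ⟨
          (v +ᴹ v′) +ᴹ (w +ᴹ w′)     ∎)
    ; *-closed = λ α (v , v∈V , w , w∈W , e) →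
        α *ₗ v , V.*-closed α v∈V , α *ₗ w , W.*-closed α w∈W ,
        ≈ᴹ-trans (*ₗ-cong F.refl e) (*ₗ-distribˡ α v w)
    }
    where module V = Subspace V
          module W = Subspace W

  opaque
    _+ˢ_ : Subspace → Subspace → Subspace
    V +ˢ W = comprehension (InSum? V W) (InSum-isSubspace V W)

    ∈-+⁺ : ∀ {V W x} → InSum V W x → x ∈ V +ˢ W
    ∈-+⁺ {V} {W} = ∈-comprehension⁺ (InSum? V W) (InSum-isSubspace V W)

    ∈-+⁻ : ∀ {V W x} → x ∈ V +ˢ W → InSum V W x
    ∈-+⁻ {V} {W} = ∈-comprehension⁻ (InSum? V W) (InSum-isSubspace V W)

  ∑ˢ : List Subspace → Subspace
  ∑ˢ = foldr _+ˢ_ 0ˢ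

  record Basis (V : Subspace) : Set (c ⊔ ℓ ⊔ m ⊔ ℓm) where
    field
      {size}      : ℕ
      vector      : Vector Carrierᴹ size
      vector∈     : ∀ i → vector i ∈ V
      independent : LinearlyIndependent vector
      spanning    : ∀ x → x ∈ V → InSpan vector x

  InSpan? : ∀ {n} (v : Vector Carrierᴹ n) → Decidable (InSpan v)
  InSpan? {n} v x = ∃-dec (≋-setoid n) (vectors-enumeration F n)
    (λ α≋β e → ≈ᴹ-trans (≈ᴹ-sym (lincomb-cong v α≋β)) e) (λ α → lincomb α v ≟ᴹ x)

  -- If αx + ∑ⱼ βⱼvⱼ = 0 with α ≠ 0, then x is a combination of the vⱼ.
  ∷-independent : ∀ {n x} {v : Vector Carrierᴹ n} → ¬ InSpan v x →
                  LinearlyIndependent v → LinearlyIndependent (x Vector.∷ v)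
  ∷-independent {n} {x} {v} x∉ ind α e = go (α zero F.≟ F.0#)
    where
    open SetoidReasoning ≈ᴹ-setoid
    β : Vector F.Carrier n
    β = α ∘ suc

    lincomb-* : ∀ {k} γ (δ : Vector F.Carrier k) (w : Vector Carrierᴹ k) →
                lincomb (λ i → γ F.* δ i) w ≈ᴹ γ *ₗ lincomb δ w
    lincomb-* {ℕ.zero}  γ δ w = ≈ᴹ-sym (*ₗ-zeroʳ γ)
    lincomb-* {ℕ.suc k} γ δ w = ≈ᴹ-trans
      (+ᴹ-cong (*ₗ-assoc γ (δ zero) (w zero)) (lincomb-* γ (δ ∘ suc) (w ∘ suc)))
      (≈ᴹ-sym (*ₗ-distribˡ γ _ _))

    go : Dec (α zero F.≈ F.0#) → ∀ i → α i F.≈ F.0#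
    go (yes α₀≈0) zero    = α₀≈0
    go (yes α₀≈0) (suc i) = ind β (begin
      lincomb β v                    ≈⟨ +ᴹ-identityˡ _ ⟨
      0ᴹ +ᴹ lincomb β v              ≈⟨ +ᴹ-congʳ (*ₗ-zeroˡ x) ⟨
      F.0# *ₗ x +ᴹ lincomb β v       ≈⟨ +ᴹ-congʳ (*ₗ-cong α₀≈0 ≈ᴹ-refl) ⟨
      α zero *ₗ x +ᴹ lincomb β v     ≈⟨ e ⟩
      0ᴹ                             ∎) i
    go (no α₀≉0) i with F.inverse (α zero) α₀≉0
    ... | γ , γα₀≈1 = ⊥-elim (x∉ ((λ j → δ F.* β j) , (begin
      lincomb (λ j → δ F.* β j) v         ≈⟨ lincomb-* δ β v ⟩
      δ *ₗ L                              ≈⟨ +ᴹ-identityʳ _ ⟨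
      δ *ₗ L +ᴹ 0ᴹ                        ≈⟨ +ᴹ-congˡ γe ⟨
      δ *ₗ L +ᴹ (x +ᴹ γ *ₗ L)             ≈⟨ +ᴹ-congˡ (+ᴹ-comm x _) ⟩
      δ *ₗ L +ᴹ (γ *ₗ L +ᴹ x)             ≈⟨ +ᴹ-assoc _ _ x ⟨
      (δ *ₗ L +ᴹ γ *ₗ L) +ᴹ x             ≈⟨ +ᴹ-congʳ (*ₗ-distribʳ L δ γ) ⟨
      (δ F.+ γ) *ₗ L +ᴹ x                 ≈⟨ +ᴹ-congʳ (*ₗ-cong (F.-‿inverseˡ γ) ≈ᴹ-refl) ⟩
      F.0# *ₗ L +ᴹ x                      ≈⟨ +ᴹ-congʳ (*ₗ-zeroˡ L) ⟩
      0ᴹ +ᴹ x                             ≈⟨ +ᴹ-identityˡ x ⟩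
      x                                   ∎)))
      where
      δ = F.- γ
      L = lincomb β v
      γe : x +ᴹ γ *ₗ L ≈ᴹ 0ᴹ
      γe = begin
        x +ᴹ γ *ₗ L                       ≈⟨ +ᴹ-congʳ (*ₗ-identityˡ x) ⟨
        F.1# *ₗ x +ᴹ γ *ₗ L               ≈⟨ +ᴹ-congʳ (*ₗ-cong γα₀≈1 ≈ᴹ-refl) ⟨
        (γ F.* α zero) *ₗ x +ᴹ γ *ₗ L     ≈⟨ +ᴹ-congʳ (*ₗ-assoc γ (α zero) x) ⟩
        γ *ₗ (α zero *ₗ x) +ᴹ γ *ₗ L      ≈⟨ *ₗ-distribˡ γ _ L ⟨
        γ *ₗ (α zero *ₗ x +ᴹ L)           ≈⟨ *ₗ-cong F.refl e ⟩
        γ *ₗ 0ᴹ                           ≈⟨ *ₗ-zeroʳ γ ⟩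
        0ᴹ                                ∎

  -- Greedy choice: run through a list, keeping each element of V that is not
  -- in the span of those already kept.
  private
    record PartialBasis (V : Subspace) (xs : List Carrierᴹ) : Set (c ⊔ ℓ ⊔ m ⊔ ℓm) where
      field
        {size}      : ℕ
        vector      : Vector Carrierᴹ size
        vector∈     : ∀ i → vector i ∈ V
        independent : LinearlyIndependent vector
        covers      : All.All (λ x → x ∈ V → InSpan vector x) xs

  partialBasis : ∀ V xs → PartialBasis V xs
  partialBasis V [] = record
    { vector = Vector.[] ; vector∈ = λ () ; independent = λ _ _ () ; covers = All.[] }
  partialBasis V (x ∷ xs) = go (x ∈? V) (InSpan? B.vector x)
    where
    module B = PartialBasis (partialBasis V xs)

    weaken : ∀ {y} → InSpan B.vector y → InSpan (x Vector.∷ B.vector) y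
    weaken (α , e) = F.0# Vector.∷ α ,
      ≈ᴹ-trans (+ᴹ-cong (*ₗ-zeroˡ x) e) (+ᴹ-identityˡ _)

    go : Dec (x ∈ V) → Dec (InSpan B.vector x) → PartialBasis V (x ∷ xs)
    go (no x∉V) _ = record
      { vector = B.vector ; vector∈ = B.vector∈ ; independent = B.independent
      ; covers = (λ x∈V → contradiction x∈V x∉V) All.∷ B.covers }
    go (yes x∈V) (yes x∈span) = record
      { vector = B.vector ; vector∈ = B.vector∈ ; independent = B.independent
      ; covers = (λ _ → x∈span) All.∷ B.covers }
    go (yes x∈V) (no x∉span) = record
      { vector = x Vector.∷ B.vector
      ; vector∈ = λ { zero → x∈V ; (suc i) → B.vector∈ i }
      ; independent = ∷-independent x∉span B.independent
      ; covers = (λ _ → (F.1# Vector.∷ λ _ → F.0#) ,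
                   ≈ᴹ-trans (+ᴹ-cong (*ₗ-identityˡ x) (lincomb-zero B.vector λ _ → F.refl))
                            (+ᴹ-identityʳ x))
                 All.∷ All.map (weaken ∘_) B.covers
      }

  opaque
    basisOf : ∀ V → Basis V
    basisOf V = record
      { vector = B.vector ; vector∈ = B.vector∈ ; independent = B.independent
      ; spanning = λ x → lookupₛ ≈ᴹ-setoid covers-resp B.covers (vectorList-enumeration x)
      }
      where
      module B = PartialBasis (partialBasis V vectorList)

      covers-resp : (λ x → x ∈ V → InSpan B.vector x) Respects _≈ᴹ_
      covers-resp y≈z f z∈V with f (Subspace.resp V (≈ᴹ-sym y≈z) z∈V)
      ... | α , e = α , ≈ᴹ-trans e y≈z

  dim : Subspace → ℕ
  dim V = Basis.size (basisOf V)

  x∈⟨x⟩ : ∀ x → x ∈ ⟨ x ⟩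
  x∈⟨x⟩ x = ∈-⟨⟩⁺ {x} (F.1# , ≈ᴹ-sym (*ₗ-identityˡ x))

  ⟨x⟩⊆ : ∀ {x} V → x ∈ V → ⟨ x ⟩ ⊆ V
  ⟨x⟩⊆ {x} V x∈V y y∈ with ∈-⟨⟩⁻ {x} y∈
  ... | α , e = Subspace.resp V (≈ᴹ-sym e) (Subspace.*-closed V α x∈V)

  ⊆-+ˡ : ∀ V W → V ⊆ V +ˢ W
  ⊆-+ˡ V W v v∈V = ∈-+⁺ {V} {W}
    (v , v∈V , 0ᴹ , Subspace.0-mem W , ≈ᴹ-sym (+ᴹ-identityʳ v))

  ⊆-+ʳ : ∀ V W → W ⊆ V +ˢ W
  ⊆-+ʳ V W w w∈W = ∈-+⁺ {V} {W}
    (0ᴹ , Subspace.0-mem V , w , w∈W , ≈ᴹ-sym (+ᴹ-identityˡ w))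

  +-⊆ : ∀ V W {U} → V ⊆ U → W ⊆ U → V +ˢ W ⊆ U
  +-⊆ V W {U} V⊆U W⊆U x x∈ with ∈-+⁻ {V} {W} x∈
  ... | v , v∈V , w , w∈W , e =
    Subspace.resp U (≈ᴹ-sym e) (Subspace.+-closed U (V⊆U v v∈V) (W⊆U w w∈W))

  -- Every subspace is the sum of the lines spanned by some sublist of
  -- vectorList, so there are finitely many up to _≐_.

  sublistSums : List Carrierᴹ → List Subspace
  sublistSums []       = 0ˢ ∷ []
  sublistSums (x ∷ xs) = sublistSums xs List.++ List.map (⟨ x ⟩ +ˢ_) (sublistSums xs)

  sublistSums-complete : ∀ V xs →
    Any (λ S → S ⊆ V × All.All (λ x → x ∈ V → x ∈ S) xs) (sublistSums xs)
  sublistSums-complete V [] = here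
    ((λ x x∈0 → Subspace.resp V (≈ᴹ-sym (∈-0⁻ x∈0)) (Subspace.0-mem V)) , All.[])
  sublistSums-complete V (x ∷ xs) with x ∈? V
  ... | no x∉V = ++⁺ˡ (Any.map (λ (S⊆V , all) → S⊆V , (λ x∈V → contradiction x∈V x∉V) All.∷ all)
                        (sublistSums-complete V xs))
  ... | yes x∈V = ++⁺ʳ (sublistSums xs) (map⁺ (Any.map
      (λ {S} (S⊆V , all) → +-⊆ ⟨ x ⟩ S {V} (⟨x⟩⊆ V x∈V) S⊆V
        , (λ _ → ⊆-+ˡ ⟨ x ⟩ S x (x∈⟨x⟩ x)) All.∷ All.map (λ {y} f y∈V → ⊆-+ʳ ⟨ x ⟩ S y (f y∈V)) all)
      (sublistSums-complete V xs)))

  opaque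
    subspaces : List Subspace
    subspaces = sublistSums vectorList

    subspaces-enumeration : Enumerates.IsEnumeration ≐-setoid subspaces
    subspaces-enumeration V = Any.map
      (λ {S} (S⊆V , all) →
        (λ x → lookupₛ ≈ᴹ-setoid
          (λ y≈z f z∈V → Subspace.resp S y≈z (f (Subspace.resp V (≈ᴹ-sym y≈z) z∈V)))
          all (vectorList-enumeration x))
        , S⊆V)
      (sublistSums-complete V vectorList)

module _ {F : FiniteField c ℓ} (E : VectorSpace F m ℓm) (E′ : VectorSpace F n ℓn) where
  private
    module F  = FiniteField F
    module E  = VectorSpace E
    module E′ = VectorSpace E′
    module S  = Subspaces E
    module S′ = Subspaces E′
  open LeftModuleMorphisms E.rawLeftModule E′.rawLeftModule

  module _ {f : E.Carrierᴹ → E′.Carrierᴹ} (homo : IsLeftModuleHomomorphism f) where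
    private module f = IsLeftModuleHomomorphism homo

    InImage : S.Subspace → Pred E′.Carrierᴹ _
    InImage V y = ∃ λ x → x S.∈ V × y E′.≈ᴹ f x

    InImage? : ∀ V → Decidable (InImage V)
    InImage? V y = ∃-dec E.≈ᴹ-setoid E.vectorList-enumeration
      (λ x≈x′ (x∈V , e) → S.Subspace.resp V x≈x′ x∈V , E′.≈ᴹ-trans e (f.⟦⟧-cong x≈x′))
      (λ x → (x S.∈? V) ×-dec (y E′.≟ᴹ f x))

    InImage-isSubspace : ∀ V → S′.IsSubspace (InImage V)
    InImage-isSubspace V = record
      { resp     = λ y≈z (x , x∈V , e) → x , x∈V , E′.≈ᴹ-trans (E′.≈ᴹ-sym y≈z) e
      ; 0-mem    = E.0ᴹ , V.0-mem , E′.≈ᴹ-sym f.0ᴹ-homo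
      ; +-closed = λ (x , x∈V , e) (x′ , x′∈V , e′) →
          x E.+ᴹ x′ , V.+-closed x∈V x′∈V ,
          E′.≈ᴹ-trans (E′.+ᴹ-cong e e′) (E′.≈ᴹ-sym (f.+ᴹ-homo x x′))
      ; *-closed = λ α (x , x∈V , e) →
          α E.*ₗ x , V.*-closed α x∈V ,
          E′.≈ᴹ-trans (E′.*ₗ-cong F.refl e) (E′.≈ᴹ-sym (f.*ₗ-homo α x))
      }
      where module V = S.Subspace V

    opaque
      image : S.Subspace → S′.Subspace
      image V = S′.comprehension (InImage? V) (InImage-isSubspace V)

      ∈-image⁺ : ∀ {V y} → InImage V y → y S′.∈ image V
      ∈-image⁺ {V} = S′.∈-comprehension⁺ (InImage? V) (InImage-isSubspace V)

      ∈-image⁻ : ∀ {V y} → y S′.∈ image V → InImage V y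
      ∈-image⁻ {V} = S′.∈-comprehension⁻ (InImage? V) (InImage-isSubspace V)

module _ {F : FiniteField c ℓ} (E₁ : VectorSpace F m ℓm) (E₂ : VectorSpace F n ℓn) where
  private
    module F  = FiniteField F
    module E₁ = VectorSpace E₁
    module E₂ = VectorSpace E₂
    product = DirectProduct.leftModule E₁.leftModule E₂.leftModule
    module P = LeftModule product
    module L = LinearCombination F product
    d₁ = E₁.dimension
    d₂ = E₂.dimension
    basis₁ : Vector P.Carrierᴹ d₁
    basis₁ i = E₁.basis i , E₂.0ᴹ
    basis₂ : Vector P.Carrierᴹ d₂
    basis₂ j = E₁.0ᴹ , E₂.basis j
    basis₁₂ : Vector P.Carrierᴹ (d₁ ℕ.+ d₂)
    basis₁₂ = basis₁ Vector.++ basis₂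

    lincomb₁ : ∀ {k} (α : Vector F.Carrier k) (v : Vector E₁.Carrierᴹ k) →
               L.lincomb α (λ i → v i , E₂.0ᴹ) P.≈ᴹ (E₁.lincomb α v , E₂.0ᴹ)
    lincomb₁ {ℕ.zero}  α v = P.≈ᴹ-refl
    lincomb₁ {ℕ.suc k} α v = P.≈ᴹ-trans (P.+ᴹ-congˡ (lincomb₁ (α ∘ suc) (v ∘ suc)))
      (E₁.≈ᴹ-refl , E₂.≈ᴹ-trans (E₂.+ᴹ-identityʳ _) (E₂.*ₗ-zeroʳ (α zero)))

    lincomb₂ : ∀ {k} (α : Vector F.Carrier k) (v : Vector E₂.Carrierᴹ k) →
               L.lincomb α (λ i → E₁.0ᴹ , v i) P.≈ᴹ (E₁.0ᴹ , E₂.lincomb α v)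
    lincomb₂ {ℕ.zero}  α v = P.≈ᴹ-refl
    lincomb₂ {ℕ.suc k} α v = P.≈ᴹ-trans (P.+ᴹ-congˡ (lincomb₂ (α ∘ suc) (v ∘ suc)))
      (E₁.≈ᴹ-trans (E₁.+ᴹ-identityʳ _) (E₁.*ₗ-zeroʳ (α zero)) , E₂.≈ᴹ-refl)

    lincomb-split : ∀ k {l} (α : Vector F.Carrier (k ℕ.+ l)) (v : Vector P.Carrierᴹ (k ℕ.+ l)) →
      L.lincomb α v P.≈ᴹ
      L.lincomb (α ∘ (_↑ˡ l)) (v ∘ (_↑ˡ l)) P.+ᴹ L.lincomb (α ∘ (k ↑ʳ_)) (v ∘ (k ↑ʳ_))
    lincomb-split ℕ.zero    α v = P.≈ᴹ-sym (P.+ᴹ-identityˡ _)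
    lincomb-split (ℕ.suc k) α v = P.≈ᴹ-trans
      (P.+ᴹ-congˡ (lincomb-split k (α ∘ suc) (v ∘ suc))) (P.≈ᴹ-sym (P.+ᴹ-assoc _ _ _))

    lincomb-cong₂ : ∀ {k} {α β : Vector F.Carrier k} {v w : Vector P.Carrierᴹ k} →
      (∀ i → α i ≡ β i) → (∀ i → v i ≡ w i) → L.lincomb α v P.≈ᴹ L.lincomb β w
    lincomb-cong₂ e e′ = MonoidSum.sum-cong-≋ P.+ᴹ-monoid
      λ i → P.≈ᴹ-reflexive (≡.cong₂ P._*ₗ_ (e i) (e′ i))

    lincomb₁₂ : ∀ α → L.lincomb α basis₁₂ P.≈ᴹ
      (E₁.lincomb (α ∘ (_↑ˡ d₂)) E₁.basis , E₂.lincomb (α ∘ (d₁ ↑ʳ_)) E₂.basis)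
    lincomb₁₂ α = begin
      L.lincomb α basis₁₂
        ≈⟨ lincomb-split d₁ α basis₁₂ ⟩
      L.lincomb α₁ (basis₁₂ ∘ (_↑ˡ d₂)) P.+ᴹ L.lincomb α₂ (basis₁₂ ∘ (d₁ ↑ʳ_))
        ≈⟨ P.+ᴹ-cong (lincomb-cong₂ (λ _ → ≡.refl) (lookup-++ˡ basis₁ basis₂))
                     (lincomb-cong₂ (λ _ → ≡.refl) (lookup-++ʳ basis₁ basis₂)) ⟩
      L.lincomb α₁ basis₁ P.+ᴹ L.lincomb α₂ basis₂
        ≈⟨ P.+ᴹ-cong (lincomb₁ α₁ E₁.basis) (lincomb₂ α₂ E₂.basis) ⟩
      (E₁.lincomb α₁ E₁.basis , E₂.0ᴹ) P.+ᴹ (E₁.0ᴹ , E₂.lincomb α₂ E₂.basis)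
        ≈⟨ E₁.+ᴹ-identityʳ _ , E₂.+ᴹ-identityˡ _ ⟩
      (E₁.lincomb α₁ E₁.basis , E₂.lincomb α₂ E₂.basis) ∎
      where
      open SetoidReasoning P.≈ᴹ-setoid
      α₁ = α ∘ (_↑ˡ d₂)
      α₂ = α ∘ (d₁ ↑ʳ_)

  infixr 6 _⊕ᵛ_
  _⊕ᵛ_ : VectorSpace F (m ⊔ n) (ℓm ⊔ ℓn)
  _⊕ᵛ_ = record
    { leftModule  = product
    ; basis       = basis₁₂
    ; independent = λ α e →
        let (e₁ , e₂) = P.≈ᴹ-trans (P.≈ᴹ-sym (lincomb₁₂ α)) e in
        coordinates α (E₁.independent _ e₁) (E₂.independent _ e₂)
    ; spanning    = λ (x , y) →
        let (α , e) = E₁.spanning x ; (β , e′) = E₂.spanning y ; γ = α Vector.++ β in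
        γ , P.≈ᴹ-trans (lincomb₁₂ γ)
              ( E₁.≈ᴹ-trans (E₁.lincomb-cong E₁.basis (F.reflexive ∘ lookup-++ˡ α β)) e
              , E₂.≈ᴹ-trans (E₂.lincomb-cong E₂.basis (F.reflexive ∘ lookup-++ʳ α β)) e′)
    }
    where
    coordinates : ∀ α → (∀ i → α (i ↑ˡ d₂) F.≈ F.0#) → (∀ j → α (d₁ ↑ʳ j) F.≈ F.0#) →
                  ∀ k → α k F.≈ F.0#
    coordinates α f g k with splitAt d₁ k in eq
    ... | inj₁ i = ≡.subst (λ k → α k F.≈ F.0#) (splitAt⁻¹-↑ˡ eq) (f i)
    ... | inj₂ j = ≡.subst (λ k → α k F.≈ F.0#) (splitAt⁻¹-↑ʳ eq) (g j)

  open LeftModuleMorphisms P.rawLeftModule E₁.rawLeftModule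
    using () renaming (IsLeftModuleHomomorphism to IsHomomorphism₁)
  open LeftModuleMorphisms P.rawLeftModule E₂.rawLeftModule
    using () renaming (IsLeftModuleHomomorphism to IsHomomorphism₂)

  π₁-homomorphism : IsHomomorphism₁ proj₁
  π₁-homomorphism = record
    { +ᴹ-isGroupHomomorphism = record
      { isMonoidHomomorphism = record
        { isMagmaHomomorphism = record
          { isRelHomomorphism = record { cong = proj₁ }
          ; homo = λ _ _ → E₁.≈ᴹ-refl }
        ; ε-homo = E₁.≈ᴹ-refl }
      ; ⁻¹-homo = λ _ → E₁.≈ᴹ-refl }
    ; *ₗ-homo = λ _ _ → E₁.≈ᴹ-refl
    }

  π₂-homomorphism : IsHomomorphism₂ proj₂
  π₂-homomorphism = record
    { +ᴹ-isGroupHomomorphism = record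
      { isMonoidHomomorphism = record
        { isMagmaHomomorphism = record
          { isRelHomomorphism = record { cong = proj₂ }
          ; homo = λ _ _ → E₂.≈ᴹ-refl }
        ; ε-homo = E₂.≈ᴹ-refl }
      ; ⁻¹-homo = λ _ → E₂.≈ᴹ-refl }
    ; *ₗ-homo = λ _ _ → E₂.≈ᴹ-refl
    }

module _ (F : FiniteField c ℓ) where
  private module F = FiniteField F

  zeroSpace : VectorSpace F c ℓ
  zeroSpace = record
    { leftModule  = Zero.leftModule
    ; basis       = Vector.[]
    ; independent = λ _ _ ()
    ; spanning    = λ _ → Vector.[] , _
    }

  line : VectorSpace F c ℓ
  line = record
    { leftModule  = TensorUnit.leftModule
    ; basis       = λ (_ : Fin 1) → F.1#
    ; independent = λ { α e zero → F.trans (F.sym (simplify (α zero))) e }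
    ; spanning    = λ x → (λ _ → x) , simplify x
    }
    where
    simplify : ∀ x → x F.* F.1# F.+ F.0# F.≈ x
    simplify x = F.trans (F.+-identityʳ _) (F.*-identityʳ x)

  infix 9 _^ᵛ_
  _^ᵛ_ : ℕ → VectorSpace F c ℓ
  _^ᵛ_ ℕ.zero    = zeroSpace
  _^ᵛ_ (ℕ.suc n) = line ⊕ᵛ (_^ᵛ_ n)

-- A ground space with a rank function, without the axioms.  Uniform
-- q-matroids, direct sums and equivalence are defined from this data alone.
record RawQMatroid (F : FiniteField c ℓ) m ℓm : Set (c ⊔ ℓ ⊔ lsuc (m ⊔ ℓm)) where
  field
    space : VectorSpace F m ℓm
  open Subspaces space public
  field
    ρ : Subspace → ℕ

record IsQMatroid {F : FiniteField c ℓ} (M : RawQMatroid F m ℓm) : Set (c ⊔ ℓ ⊔ m ⊔ ℓm) where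
  open RawQMatroid M
  field
    bounded    : ∀ V → ρ V ≤ dim V
    monotone   : ∀ {V W} → V ⊆ W → ρ V ≤ ρ W
    submodular : ∀ V W → ρ (V +ˢ W) ℕ.+ ρ (V ∩ W) ≤ ρ V ℕ.+ ρ W

  ρ-cong : ∀ {V W} → V ≐ W → ρ V ≡ ρ W
  ρ-cong (V⊆W , W⊆V) = ℕ.≤-antisym (monotone V⊆W) (monotone W⊆V)

record QMatroid (F : FiniteField c ℓ) m ℓm : Set (c ⊔ ℓ ⊔ lsuc (m ⊔ ℓm)) where
  field
    raw        : RawQMatroid F m ℓm
    isQMatroid : IsQMatroid raw
  open RawQMatroid raw public
  open IsQMatroid isQMatroid public

module _ {F : FiniteField c ℓ} (M : QMatroid F m ℓm) where
  private module F = FiniteField F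
  open QMatroid M
  open VectorSpace space
    using (Carrierᴹ; _≈ᴹ_; _+ᴹ_; _*ₗ_; 0ᴹ; ≈ᴹ-refl; ≈ᴹ-sym; ≈ᴹ-trans; ≈ᴹ-setoid;
           +ᴹ-congˡ; +ᴹ-congʳ; +ᴹ-assoc; +ᴹ-identityˡ; +ᴹ-identityʳ;
           *ₗ-cong; *ₗ-zeroˡ; *ₗ-identityˡ; *ₗ-assoc; *ₗ-distribʳ; vectorList)

  -- vectorList runs through all vectors of the ground space (up to _≈ᴹ_).
  cl : Subspace → Subspace
  cl V = ∑ˢ (List.map ⟨_⟩ (filter (λ x → ρ (V +ˢ ⟨ x ⟩) ℕ.≟ ρ V) vectorList))

  InCyc : Subspace → Pred Carrierᴹ _
  InCyc V x = x ∈ V × (∀ W → W ⊆ V × W +ˢ ⟨ x ⟩ ≐ V → ρ W ≡ ρ V)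

  InCyc? : ∀ V → Decidable (InCyc V)
  InCyc? V x = (x ∈? V) ×-dec ∀-dec ≐-setoid subspaces-enumeration
    (λ {W} {W′} (W⊆W′ , W′⊆W) f (W′⊆V , (l , r)) →
      ≡.trans (ρ-cong (W′⊆W , W⊆W′))
        (f ( (λ y → W′⊆V y ∘ W⊆W′ y)
           , (λ y → l y ∘ mono W⊆W′ y)
           , (λ y → mono W′⊆W y ∘ r y))))
    (λ W → ((W ⊆? V) ×-dec ((W +ˢ ⟨ x ⟩) ≐? V)) →-dec (ρ W ℕ.≟ ρ V))
    where
    mono : ∀ {W W′} → W ⊆ W′ → W +ˢ ⟨ x ⟩ ⊆ W′ +ˢ ⟨ x ⟩
    mono {W} {W′} i = +-⊆ W ⟨ x ⟩ {W′ +ˢ ⟨ x ⟩}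
      (λ y → ⊆-+ˡ W′ ⟨ x ⟩ y ∘ i y) (⊆-+ʳ W′ ⟨ x ⟩)

  InCyc-isSubspace : ∀ V → IsSubspace (InCyc V)
  InCyc-isSubspace V = record
    { resp = λ {x} {y} x≈y (x∈V , f) → V.resp x≈y x∈V , λ W (W⊆V , W+y≐V) →
        f W (W⊆V , exchange W x y W⊆V x∈V W+y≐V (Subspace.resp (W +ˢ ⟨ x ⟩) x≈y (new W)))
    ; 0-mem = V.0-mem , λ W (W⊆V , (_ , V⊆W+0)) →
        ρ-cong {W} {V} (W⊆V , λ y →
          +-⊆ W ⟨ 0ᴹ ⟩ {W} (λ _ w → w) (⟨x⟩⊆ W (Subspace.0-mem W)) y ∘ V⊆W+0 y)
    ; +-closed = +-closed
    ; *-closed = λ α {x} (x∈V , f) → V.*-closed α x∈V , λ W (W⊆V , W+αx≐V) →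
        f W (W⊆V , exchange W x (α *ₗ x) W⊆V x∈V W+αx≐V
          (Subspace.*-closed (W +ˢ ⟨ x ⟩) α (new W)))
    }
    where
    module V = Subspace V

    new : ∀ {x} W → x ∈ W +ˢ ⟨ x ⟩
    new {x} W = ⊆-+ʳ W ⟨ x ⟩ x (x∈⟨x⟩ x)

    exchange : ∀ W x y → W ⊆ V → x ∈ V → W +ˢ ⟨ y ⟩ ≐ V → y ∈ W +ˢ ⟨ x ⟩ → W +ˢ ⟨ x ⟩ ≐ V
    exchange W x y W⊆V x∈V (_ , V⊆) y∈ =
      +-⊆ W ⟨ x ⟩ {V} W⊆V (⟨x⟩⊆ V x∈V) ,
      λ z → +-⊆ W ⟨ y ⟩ {W +ˢ ⟨ x ⟩} (⊆-+ˡ W ⟨ x ⟩) (⟨x⟩⊆ (W +ˢ ⟨ x ⟩) y∈) z ∘ V⊆ z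

    cancel : ∀ U {u v} → u ∈ U → (u +ᴹ v) ∈ U → v ∈ U
    cancel U {u} {v} u∈U u+v∈U = Subspace.resp U (begin
      (F.- F.1#) *ₗ u +ᴹ (u +ᴹ v)            ≈⟨ +ᴹ-assoc _ u v ⟨
      ((F.- F.1#) *ₗ u +ᴹ u) +ᴹ v            ≈⟨ +ᴹ-congʳ (+ᴹ-congˡ (*ₗ-identityˡ u)) ⟨
      ((F.- F.1#) *ₗ u +ᴹ F.1# *ₗ u) +ᴹ v    ≈⟨ +ᴹ-congʳ (*ₗ-distribʳ u _ _) ⟨
      (F.- F.1# F.+ F.1#) *ₗ u +ᴹ v          ≈⟨ +ᴹ-congʳ (*ₗ-cong (F.-‿inverseˡ F.1#) ≈ᴹ-refl) ⟩
      F.0# *ₗ u +ᴹ v                         ≈⟨ +ᴹ-congʳ (*ₗ-zeroˡ u) ⟩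
      0ᴹ +ᴹ v                                ≈⟨ +ᴹ-identityˡ v ⟩
      v                                      ∎)
      (Subspace.+-closed U (Subspace.*-closed U (F.- F.1#) u∈U) u+v∈U)
      where open SetoidReasoning ≈ᴹ-setoid

    unscale : ∀ U {α z} → ¬ (α F.≈ F.0#) → (α *ₗ z) ∈ U → z ∈ U
    unscale U {α} {z} α≉0 αz∈U with F.inverse α α≉0
    ... | β , βα≈1 = Subspace.resp U
      (≈ᴹ-trans (≈ᴹ-sym (*ₗ-assoc β α z)) (≈ᴹ-trans (*ₗ-cong βα≈1 ≈ᴹ-refl) (*ₗ-identityˡ z)))
      (Subspace.*-closed U β αz∈U)

    -- If z ∈ ⟨s⟩ and y = w + z with w ∈ W and y ∉ W, then s ∈ W + ⟨y⟩.
    solve : ∀ W {s y w z} → ¬ (y ∈ W) → w ∈ W → InLine s z → y ≈ᴹ w +ᴹ z → s ∈ W +ˢ ⟨ y ⟩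
    solve W {s} {y} {w} {z} y∉W w∈W (α , z≈αs) y≈w+z = go (α F.≟ F.0#)
      where
      U = W +ˢ ⟨ y ⟩
      go : Dec (α F.≈ F.0#) → s ∈ U
      go (yes α≈0) = contradiction (Subspace.resp W (≈ᴹ-sym y≈w) w∈W) y∉W
        where
        y≈w : y ≈ᴹ w
        y≈w = ≈ᴹ-trans y≈w+z (≈ᴹ-trans
          (+ᴹ-congˡ (≈ᴹ-trans z≈αs (≈ᴹ-trans (*ₗ-cong α≈0 ≈ᴹ-refl) (*ₗ-zeroˡ _))))
          (+ᴹ-identityʳ w))
      go (no α≉0) = unscale U α≉0 (Subspace.resp U z≈αs
        (cancel U (⊆-+ˡ W ⟨ y ⟩ w w∈W) (Subspace.resp U y≈w+z (new W))))

    -- Let W + ⟨x+y⟩ = V.  If y ∈ W, then W + ⟨x⟩ = V.  Otherwise W + ⟨y⟩ = V.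
    +-closed : ∀ {x y} → InCyc V x → InCyc V y → InCyc V (x +ᴹ y)
    +-closed {x} {y} (x∈V , f) (y∈V , g) =
      V.+-closed x∈V y∈V , λ W (W⊆V , eq) → h W W⊆V eq (y ∈? W)
      where
      h : ∀ W → W ⊆ V → W +ˢ ⟨ x +ᴹ y ⟩ ≐ V → Dec (y ∈ W) → ρ W ≡ ρ V
      h W W⊆V eq (yes y∈W) = f W (W⊆V , exchange W x (x +ᴹ y) W⊆V x∈V eq
        (Subspace.+-closed (W +ˢ ⟨ x ⟩) (new W) (⊆-+ˡ W ⟨ x ⟩ y y∈W)))
      h W W⊆V eq (no y∉W) =
        let (w , w∈W , z , z∈⟨x+y⟩ , y≈w+z) = ∈-+⁻ {W} {⟨ x +ᴹ y ⟩} (proj₂ eq y y∈V)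
            z∈line = ∈-⟨⟩⁻ {x +ᴹ y} z∈⟨x+y⟩
        in g W (W⊆V , exchange W y (x +ᴹ y) W⊆V y∈V eq (solve W y∉W w∈W z∈line y≈w+z))

  opaque
    cyc : Subspace → Subspace
    cyc V = comprehension (InCyc? V) (InCyc-isSubspace V)

    ∈-cyc⁺ : ∀ {V x} → InCyc V x → x ∈ cyc V
    ∈-cyc⁺ {V} = ∈-comprehension⁺ (InCyc? V) (InCyc-isSubspace V)

    ∈-cyc⁻ : ∀ {V x} → x ∈ cyc V → InCyc V x
    ∈-cyc⁻ {V} = ∈-comprehension⁻ (InCyc? V) (InCyc-isSubspace V)

  Full : Set m
  Full = cl 0ˢ ≐ 0ˢ × cyc whole ≐ whole

uniform : {F : FiniteField c ℓ} → ℕ → VectorSpace F m ℓm → RawQMatroid F m ℓm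
uniform k E = record { space = E ; ρ = λ V → k ⊓ Subspaces.dim E V }

𝒰 : (F : FiniteField c ℓ) → ℕ → ℕ → RawQMatroid F c ℓ
𝒰 F k n = uniform k (_^ᵛ_ F n)

infixr 6 _⊕_
_⊕_ : {F : FiniteField c ℓ} → RawQMatroid F m ℓm → RawQMatroid F n ℓn →
      RawQMatroid F (m ⊔ n) (ℓm ⊔ ℓn)
M₁ ⊕ M₂ = record { space = E ; ρ = λ V → min (r V V) (List.map (r V) (filter (_⊆? V) subspaces)) }
  where
  module M₁ = RawQMatroid M₁
  module M₂ = RawQMatroid M₂
  E = M₁.space ⊕ᵛ M₂.space
  open Subspaces E
  -- dim V + (ρ₁(π₁ X) + ρ₂(π₂ X) − dim X).  For X ≤ V the truncated
  -- subtraction is exact.  The first argument of min is its default for an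
  -- empty list; here it is the value at X = V.
  r : Subspace → Subspace → ℕ
  r V X = M₁.ρ (image E M₁.space (π₁-homomorphism M₁.space M₂.space) X)
        ℕ.+ M₂.ρ (image E M₂.space (π₂-homomorphism M₁.space M₂.space) X)
        ℕ.+ (dim V ∸ dim X)

infix 4 _≅_
record _≅_ {F : FiniteField c ℓ} (M : RawQMatroid F m ℓm) (N : RawQMatroid F n ℓn) :
           Set (c ⊔ m ⊔ ℓm ⊔ n ⊔ ℓn) where
  private
    module M = RawQMatroid M
    module N = RawQMatroid N
    module E = VectorSpace M.space
    module E′ = VectorSpace N.space
  open LeftModuleMorphisms E.rawLeftModule E′.rawLeftModule
  field
    to            : E.Carrierᴹ → E′.Carrierᴹ
    isIsomorphism : IsLeftModuleIsomorphism to
  open IsLeftModuleIsomorphism isIsomorphism public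
  field
    ρ-preserving  : ∀ V → N.ρ (image M.space N.space isLeftModuleHomomorphism V) ≡ M.ρ V

{-# OPTIONS --safe #-}
module Submission where

-- Let L = cl(0) and C = cyc(E).  An equivalence M ≈ 𝒰₀,ₐ ⊕ 𝒰_b,b ⊕ N amounts to
-- linear maps α, β, γ from E to the three ground spaces which are jointly
-- bijective and satisfy ρ(V) = dim β(V) + ρ_N(γ(V ∩ ker β)).  If N is full, then
-- ker β = C and ker β ∩ ker γ = L.  This determines a and b, and γ identifies N
-- with the quotient of M|C by L.
--
-- For existence, ρ(V) = dim V − dim(V ∩ C) + ρ(V ∩ C): a vector x ∉ C has a
-- complementary hyperplane W of smaller rank, which contains C, and by
-- submodularity ρ(V ∩ W) < ρ(V) if x ∈ V.  The projections of E along complements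
-- of L and of C give α and β, and M′ lives on the remaining summand of E.

open import Defs
open import Data.Nat.Base using (ℕ; _∸_)
open import Data.Product.Base using (Σ; _×_)
open import Relation.Binary.PropositionalEquality.Core using (_≡_)

open import Algebra.Bundles using (module CommutativeMonoid)
import Algebra.Properties.AbelianGroup as AbelianGroup
import Algebra.Properties.CommutativeMonoid.Sum as Sum
import Algebra.Properties.CommutativeSemigroup as CommutativeSemigroup
import Algebra.Properties.Ring as Ring
open import Algebra.Module.Bundles using (LeftModule)
open import Algebra.Module.Bundles.Raw using (RawLeftModule)
import Algebra.Module.Morphism.LeftModuleMonomorphism as LeftModuleMonomorphism
open import Algebra.Module.Morphism.Structures using (module LeftModuleMorphisms)
open import Data.Bool.Base using (Bool; true; false)
open import Data.Fin.Base using (Fin; zero; suc; _↑ˡ_; _↑ʳ_; punchIn; splitAt)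
open import Data.Fin.Properties using (any?; splitAt⁻¹-↑ˡ; splitAt⁻¹-↑ʳ)
open import Data.List.Base as List using (List; []; _∷_; filter)
open import Data.List.Extrema.Nat using (min; min≤v⁺; v≤min⁺)
open import Data.List.Membership.Propositional as List using (find; lose)
open import Data.List.Membership.Propositional.Properties using (∈-filter⁺; ∈-filter⁻; ∈-map⁺)
open import Data.List.Relation.Unary.All using (lookupₛ)
import Data.List.Relation.Unary.All as All
import Data.List.Relation.Unary.All.Properties as All
import Data.List.Relation.Unary.Any as Any
import Data.List.Relation.Unary.Any.Properties as Any
open import Data.Nat.Base as ℕ using (_+_; _≤_; _<_; z≤n; s≤s)
import Data.Nat.Properties as ℕ
open import Data.Nat.Solver using (module +-*-Solver)
open import Data.Product.Base using (∃; _,_; proj₁; proj₂)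
open import Data.Sum.Base using (inj₁; inj₂)
open import Data.Vec.Functional as Vector using (Vector; removeAt; insertAt)
open import Data.Vec.Functional.Properties using (insertAt-lookup; insertAt-punchIn; lookup-++ˡ; lookup-++ʳ)
open import Function.Base using (_∘_)
open import Level using (Level; _⊔_)
open import Relation.Binary.PropositionalEquality using (module ≡-Reasoning)
import Relation.Binary.PropositionalEquality.Core as ≡
import Relation.Binary.Reasoning.Setoid as SetoidReasoning
open import Relation.Nullary.Decidable.Core using (Dec; yes; no; ¬?; decidable-stable)
open import Relation.Nullary.Negation.Core using (¬_; contradiction)

-- The rank of a direct sum is a minimum over all subspaces of V, and the statement contains two
-- nested ones. Both disappear because ρ(V) - ρ(X) ≤ dim V - dim X for X ≤ V (`UnitIncreasing`): a
-- summand of rank zero puts the minimum at V itself, a free summand puts it at V ∩ ker π₁. From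
-- then on only the rank formula of a `Splitting` is used. Complements in a vector space are not
-- canonical, so two decompositions cannot be matched summand by summand: their full summands may
-- sit in E as different subspaces. What they share is the pair L ≤ C, and each full summand is a
-- copy of C/L, whichever complement was chosen. This is why uniqueness passes through `CoreMap`,
-- whose conditions on γ concern C alone.

private
  variable
    c ℓ m ℓm n ℓn o ℓo p ℓp : Level

-- Bases and dimension

module Combinations (F : FiniteField c ℓ) (E : LeftModule (FiniteField.ring F) m ℓm) where
  private module F = FiniteField F
  open LeftModule E
  open LinearCombination F E
  open Sum +ᴹ-commutativeMonoid using (sum-cong-≋; sum-remove; ∑-distrib-+)
  open SetoidReasoning ≈ᴹ-setoid
  open CommutativeSemigroup
    (CommutativeMonoid.commutativeSemigroup +ᴹ-commutativeMonoid)
    public using () renaming (interchange to +ᴹ-medial)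
  open AbelianGroup +ᴹ-abelianGroup public using () renaming
    (inverseˡ-unique to -ᴹ-unique)

  infixl 6 _-ᴹ_
  _-ᴹ_ : Carrierᴹ → Carrierᴹ → Carrierᴹ
  x -ᴹ y = x +ᴹ (F.- F.1#) *ₗ y

  -1*x+x≈0 : ∀ x → (F.- F.1#) *ₗ x +ᴹ x ≈ᴹ 0ᴹ
  -1*x+x≈0 x = begin
    (F.- F.1#) *ₗ x +ᴹ x             ≈⟨ +ᴹ-congˡ (*ₗ-identityˡ x) ⟨
    (F.- F.1#) *ₗ x +ᴹ F.1# *ₗ x     ≈⟨ *ₗ-distribʳ x _ _ ⟨
    (F.- F.1# F.+ F.1#) *ₗ x         ≈⟨ *ₗ-cong (F.-‿inverseˡ F.1#) ≈ᴹ-refl ⟩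
    F.0# *ₗ x                        ≈⟨ *ₗ-zeroˡ x ⟩
    0ᴹ                               ∎

  x-y+y≈x : ∀ x y → (x -ᴹ y) +ᴹ y ≈ᴹ x
  x-y+y≈x x y = ≈ᴹ-trans (+ᴹ-assoc _ _ _) (≈ᴹ-trans (+ᴹ-congˡ (-1*x+x≈0 y)) (+ᴹ-identityʳ x))

  x-x≈0 : ∀ x → x -ᴹ x ≈ᴹ 0ᴹ
  x-x≈0 x = ≈ᴹ-trans (+ᴹ-comm _ _) (-1*x+x≈0 x)

  x-y≈0⇒x≈y : ∀ {x y} → x -ᴹ y ≈ᴹ 0ᴹ → x ≈ᴹ y
  x-y≈0⇒x≈y {x} {y} e =
    ≈ᴹ-trans (≈ᴹ-sym (x-y+y≈x x y)) (≈ᴹ-trans (+ᴹ-congʳ e) (+ᴹ-identityˡ y))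

  x+y-y≈x : ∀ x y → (x +ᴹ y) -ᴹ y ≈ᴹ x
  x+y-y≈x x y = ≈ᴹ-trans (+ᴹ-assoc _ _ _) (≈ᴹ-trans (+ᴹ-congˡ (x-x≈0 y)) (+ᴹ-identityʳ x))

  lincomb-+ : ∀ {k} (α β : Vector F.Carrier k) v →
              lincomb (λ i → α i F.+ β i) v ≈ᴹ lincomb α v +ᴹ lincomb β v
  lincomb-+ α β v = ≈ᴹ-trans (sum-cong-≋ λ i → *ₗ-distribʳ (v i) (α i) (β i))
    (∑-distrib-+ (λ i → α i *ₗ v i) (λ i → β i *ₗ v i))

  lincomb-* : ∀ {k} γ (α : Vector F.Carrier k) v →
              lincomb (λ i → γ F.* α i) v ≈ᴹ γ *ₗ lincomb α v
  lincomb-* {ℕ.zero}  γ α v = ≈ᴹ-sym (*ₗ-zeroʳ γ)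
  lincomb-* {ℕ.suc k} γ α v = ≈ᴹ-trans
    (+ᴹ-cong (*ₗ-assoc γ _ _) (lincomb-* γ (α ∘ suc) (v ∘ suc))) (≈ᴹ-sym (*ₗ-distribˡ γ _ _))

  lincomb-cong₂ : ∀ {k} {α β : Vector F.Carrier k} {v w : Vector Carrierᴹ k} →
                  (∀ i → α i F.≈ β i) → (∀ i → v i ≈ᴹ w i) → lincomb α v ≈ᴹ lincomb β w
  lincomb-cong₂ α≈β v≈w = sum-cong-≋ λ i → *ₗ-cong (α≈β i) (v≈w i)

  lincomb-++ : ∀ k {l} (α : Vector F.Carrier (k + l)) (v : Vector Carrierᴹ k) (w : Vector Carrierᴹ l) →
               lincomb α (v Vector.++ w) ≈ᴹ lincomb (α ∘ (_↑ˡ l)) v +ᴹ lincomb (α ∘ (k ↑ʳ_)) w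
  lincomb-++ k {l} α v w = ≈ᴹ-trans (split k α (v Vector.++ w)) (+ᴹ-cong
    (lincomb-cong₂ (λ _ → F.refl) (≈ᴹ-reflexive ∘ lookup-++ˡ v w))
    (lincomb-cong₂ (λ _ → F.refl) (≈ᴹ-reflexive ∘ lookup-++ʳ v w)))
    where
    split : ∀ k {l} (α : Vector F.Carrier (k + l)) (u : Vector Carrierᴹ (k + l)) →
      lincomb α u ≈ᴹ lincomb (α ∘ (_↑ˡ l)) (u ∘ (_↑ˡ l)) +ᴹ lincomb (α ∘ (k ↑ʳ_)) (u ∘ (k ↑ʳ_))
    split ℕ.zero    α u = ≈ᴹ-sym (+ᴹ-identityˡ _)
    split (ℕ.suc k) α u = ≈ᴹ-trans (+ᴹ-congˡ (split k (α ∘ suc) (u ∘ suc))) (≈ᴹ-sym (+ᴹ-assoc _ _ _))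

  lincomb-0 : ∀ {k} (v : Vector Carrierᴹ k) → lincomb (λ _ → F.0#) v ≈ᴹ 0ᴹ
  lincomb-0 v = lincomb-zero v λ _ → F.refl

  InSpan-+ : ∀ {k} {v : Vector Carrierᴹ k} {x y} → InSpan v x → InSpan v y → InSpan v (x +ᴹ y)
  InSpan-+ {v = v} (α , e) (β , e′) = _ , ≈ᴹ-trans (lincomb-+ α β v) (+ᴹ-cong e e′)

  InSpan-* : ∀ {k} {v : Vector Carrierᴹ k} γ {x} → InSpan v x → InSpan v (γ *ₗ x)
  InSpan-* {v = v} γ (α , e) = _ , ≈ᴹ-trans (lincomb-* γ α v) (*ₗ-cong F.refl e)

  basisVector∈span : ∀ {k} (v : Vector Carrierᴹ k) i → InSpan v (v i)
  basisVector∈span v zero    = (F.1# Vector.∷ λ _ → F.0#) ,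
    ≈ᴹ-trans (+ᴹ-cong (*ₗ-identityˡ _) (lincomb-0 (v ∘ suc))) (+ᴹ-identityʳ _)
  basisVector∈span v (suc i) with basisVector∈span (v ∘ suc) i
  ... | α , e = (F.0# Vector.∷ α) , ≈ᴹ-trans (+ᴹ-cong (*ₗ-zeroˡ _) e) (+ᴹ-identityˡ _)

  -- Exchange: if some vᵢ involves w₀, subtracting suitable multiples of it from
  -- the other vectors of v puts them into the span of the remaining w's.
  independent≤spanning : ∀ k {l} (v : Vector Carrierᴹ l) (w : Vector Carrierᴹ k) →
    LinearlyIndependent v → (∀ i → InSpan w (v i)) → l ≤ k
  independent≤spanning k {ℕ.zero} v w ind sp = z≤n
  independent≤spanning ℕ.zero {ℕ.suc l} v w ind sp =
    contradiction (ind (λ _ → F.1#) (≈ᴹ-trans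
      (lincomb-cong₂ {α = λ _ → F.1#} {w = λ _ → 0ᴹ} (λ _ → F.refl) λ i → ≈ᴹ-sym (proj₂ (sp i)))
      (zeros (ℕ.suc l))) zero) F.1≉0
    where
    zeros : ∀ l → lincomb {l} (λ _ → F.1#) (λ _ → 0ᴹ) ≈ᴹ 0ᴹ
    zeros ℕ.zero    = ≈ᴹ-refl
    zeros (ℕ.suc l) = ≈ᴹ-trans (+ᴹ-cong (*ₗ-zeroʳ _) (zeros l)) (+ᴹ-identityˡ _)
  independent≤spanning (ℕ.suc k) {ℕ.suc l} v w ind sp =
    go (any? λ i → ¬? (proj₁ (sp i) zero F.≟ F.0#))
    where
    a : Fin (ℕ.suc l) → F.Carrier
    a i = proj₁ (sp i) zero
    b : Fin (ℕ.suc l) → Vector F.Carrier k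
    b i = proj₁ (sp i) ∘ suc
    w′ = w ∘ suc

    decomposition : ∀ i → v i ≈ᴹ a i *ₗ w zero +ᴹ lincomb (b i) w′
    decomposition i = ≈ᴹ-sym (proj₂ (sp i))

    go : Dec (∃ λ i → ¬ (a i F.≈ F.0#)) → ℕ.suc l ≤ ℕ.suc k
    go (no none) = ℕ.≤-trans (independent≤spanning k v w′ ind λ i → b i , (begin
      lincomb (b i) w′                       ≈⟨ +ᴹ-identityˡ _ ⟨
      0ᴹ +ᴹ lincomb (b i) w′                 ≈⟨ +ᴹ-congʳ (*ₗ-zeroˡ _) ⟨
      F.0# *ₗ w zero +ᴹ lincomb (b i) w′     ≈⟨ +ᴹ-congʳ (*ₗ-cong (a≈0 i) ≈ᴹ-refl) ⟨
      a i *ₗ w zero +ᴹ lincomb (b i) w′      ≈⟨ decomposition i ⟨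
      v i                                    ∎)) (ℕ.n≤1+n k)
      where
      a≈0 : ∀ i → a i F.≈ F.0#
      a≈0 i with a i F.≟ F.0#
      ... | yes e = e
      ... | no ne = contradiction (i , ne) none
    go (yes (i , aᵢ≉0)) = s≤s (independent≤spanning k v′ w′ ind′ sp′)
      where
      aᵢ⁻¹ = proj₁ (F.inverse (a i) aᵢ≉0)
      r : Vector F.Carrier l
      r j = F.- (a (punchIn i j) F.* aᵢ⁻¹)
      v′ : Vector Carrierᴹ l
      v′ j = v (punchIn i j) +ᴹ r j *ₗ v i

      cancel : ∀ j → a (punchIn i j) F.+ r j F.* a i F.≈ F.0#
      cancel j = F.trans (F.+-congˡ (F.trans
        (F.sym (Ring.-‿distribˡ-* F.ring _ _))
        (F.-‿cong (F.trans (F.*-assoc _ _ _)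
          (F.trans (F.*-congˡ (proj₂ (F.inverse (a i) aᵢ≉0))) (F.*-identityʳ _))))))
        (F.-‿inverseʳ _)

      sp′ : ∀ j → InSpan w′ (v′ j)
      sp′ j = proj₁ sp″ , (begin
        lincomb (proj₁ sp″) w′       ≈⟨ proj₂ sp″ ⟩
        B                            ≈⟨ +ᴹ-identityˡ _ ⟨
        0ᴹ +ᴹ B                      ≈⟨ +ᴹ-congʳ A≈0 ⟨
        (a j′ *ₗ w zero +ᴹ r j *ₗ (a i *ₗ w zero)) +ᴹ B   ≈⟨ +ᴹ-medial _ _ _ _ ⟩
        (a j′ *ₗ w zero +ᴹ lincomb (b j′) w′) +ᴹ (r j *ₗ (a i *ₗ w zero) +ᴹ r j *ₗ lincomb (b i) w′)
          ≈⟨ +ᴹ-cong (decomposition j′) (≈ᴹ-trans (*ₗ-cong F.refl (decomposition i)) (*ₗ-distribˡ _ _ _)) ⟨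
        v′ j                         ∎)
        where
        j′ = punchIn i j
        B = lincomb (b j′) w′ +ᴹ r j *ₗ lincomb (b i) w′
        sp″ : InSpan w′ B
        sp″ = InSpan-+ (b j′ , ≈ᴹ-refl) (InSpan-* (r j) (b i , ≈ᴹ-refl))
        A≈0 : a j′ *ₗ w zero +ᴹ r j *ₗ (a i *ₗ w zero) ≈ᴹ 0ᴹ
        A≈0 = begin
          a j′ *ₗ w zero +ᴹ r j *ₗ (a i *ₗ w zero)   ≈⟨ +ᴹ-congˡ (*ₗ-assoc _ _ _) ⟨
          a j′ *ₗ w zero +ᴹ (r j F.* a i) *ₗ w zero  ≈⟨ *ₗ-distribʳ _ _ _ ⟨
          (a j′ F.+ r j F.* a i) *ₗ w zero           ≈⟨ *ₗ-cong (cancel j) ≈ᴹ-refl ⟩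
          F.0# *ₗ w zero                             ≈⟨ *ₗ-zeroˡ _ ⟩
          0ᴹ                                         ∎

      ind′ : LinearlyIndependent v′
      ind′ γ e j = F.trans (F.sym (F.reflexive (insertAt-punchIn γ i s j))) (ind δ (begin
        lincomb δ v                                       ≈⟨ sum-remove {i = i} (λ j → δ j *ₗ v j) ⟩
        δ i *ₗ v i +ᴹ lincomb (removeAt δ i) (removeAt v i) ≈⟨ +ᴹ-cong
          (*ₗ-cong (F.reflexive (insertAt-lookup γ i s)) ≈ᴹ-refl)
          (lincomb-cong (removeAt v i) (F.reflexive ∘ insertAt-punchIn γ i s)) ⟩
        s *ₗ v i +ᴹ lincomb γ (removeAt v i)              ≈⟨ +ᴹ-comm _ _ ⟩
        lincomb γ (removeAt v i) +ᴹ s *ₗ v i              ≈⟨ proj₂ (lincomb-shift γ (removeAt v i)) ⟨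
        lincomb γ v′                                      ≈⟨ e ⟩
        0ᴹ                                                ∎) (punchIn i j))
        where
        lincomb-shift : ∀ {l} (γ : Vector F.Carrier l) {r : Vector F.Carrier l} {x} u →
          ∃ λ s → lincomb γ (λ j → u j +ᴹ r j *ₗ x) ≈ᴹ lincomb γ u +ᴹ s *ₗ x
        lincomb-shift {ℕ.zero}  γ u = F.0# ,
          ≈ᴹ-sym (≈ᴹ-trans (+ᴹ-identityˡ _) (*ₗ-zeroˡ _))
        lincomb-shift {ℕ.suc l} γ {r} {x} u with lincomb-shift (γ ∘ suc) {r ∘ suc} {x} (u ∘ suc)
        ... | s , eq = γ zero F.* r zero F.+ s , (begin
          γ zero *ₗ (u zero +ᴹ r zero *ₗ x) +ᴹ lincomb (γ ∘ suc) (λ j → u (suc j) +ᴹ r (suc j) *ₗ x)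
            ≈⟨ +ᴹ-cong (≈ᴹ-trans (*ₗ-distribˡ _ _ _) (+ᴹ-congˡ (≈ᴹ-sym (*ₗ-assoc _ _ _)))) eq ⟩
          (γ zero *ₗ u zero +ᴹ (γ zero F.* r zero) *ₗ x) +ᴹ (lincomb (γ ∘ suc) (u ∘ suc) +ᴹ s *ₗ x)
            ≈⟨ +ᴹ-medial _ _ _ _ ⟩
          lincomb γ u +ᴹ ((γ zero F.* r zero) *ₗ x +ᴹ s *ₗ x)
            ≈⟨ +ᴹ-congˡ (*ₗ-distribʳ _ _ _) ⟨
          lincomb γ u +ᴹ (γ zero F.* r zero F.+ s) *ₗ x ∎)
        -- The total multiple of `v i` collected from the `v′ j`. Inserted as the coefficient at
        -- `i`, it turns a relation among the `v′ j` into one among all the `v j`.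
        s = proj₁ (lincomb-shift γ {r} {v i} (removeAt v i))
        δ = insertAt γ i s

module SubspaceProperties {F : FiniteField c ℓ} (E : VectorSpace F m ℓm) where
  private module F = FiniteField F
  open VectorSpace E
  open Subspaces E
  open Combinations F leftModule
  open SetoidReasoning ≈ᴹ-setoid

  module _ (V : Subspace) where
    open Subspace V

    -‿closed : ∀ {x y} → x ∈ V → y ∈ V → (x -ᴹ y) ∈ V
    -‿closed x∈V y∈V = +-closed x∈V (*-closed _ y∈V)

    +-cancelʳ-∈ : ∀ {x y} → y ∈ V → (x +ᴹ y) ∈ V → x ∈ V
    +-cancelʳ-∈ {x} {y} y∈V x+y∈V = resp (x+y-y≈x x y) (-‿closed x+y∈V y∈V)

    *-cancel-∈ : ∀ {α x} → ¬ (α F.≈ F.0#) → (α *ₗ x) ∈ V → x ∈ V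
    *-cancel-∈ {α} {x} α≉0 αx∈V with F.inverse α α≉0
    ... | β , βα≈1 = resp
      (≈ᴹ-trans (≈ᴹ-sym (*ₗ-assoc β α x)) (≈ᴹ-trans (*ₗ-cong βα≈1 ≈ᴹ-refl) (*ₗ-identityˡ x)))
      (*-closed β αx∈V)

    lincomb-closed : ∀ {k} α {v : Vector Carrierᴹ k} → (∀ i → v i ∈ V) → lincomb α v ∈ V
    lincomb-closed {ℕ.zero}  α v∈V = 0-mem
    lincomb-closed {ℕ.suc k} α v∈V =
      +-closed (*-closed (α zero) (v∈V zero)) (lincomb-closed (α ∘ suc) (v∈V ∘ suc))

  ⊆-whole : ∀ V → V ⊆ whole
  ⊆-whole V x _ = ∈-whole

  0ˢ-⊆ : ∀ V → 0ˢ ⊆ V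
  0ˢ-⊆ V x x∈0 = Subspace.resp V (≈ᴹ-sym (∈-0⁻ x∈0)) (Subspace.0-mem V)

  ∩-⊆ˡ : ∀ V W → V ∩ W ⊆ V
  ∩-⊆ˡ V W x x∈ = proj₁ (∈-∩⁻ {V} {W} x∈)

  ∩-⊆ʳ : ∀ V W → V ∩ W ⊆ W
  ∩-⊆ʳ V W x x∈ = proj₂ (∈-∩⁻ {V} {W} x∈)

  ∩-monoˡ : ∀ {X V} W → X ⊆ V → X ∩ W ⊆ V ∩ W
  ∩-monoˡ {X} {V} W X⊆V x x∈ =
    let (x∈X , x∈W) = ∈-∩⁻ {X} {W} x∈ in ∈-∩⁺ {V} {W} (X⊆V x x∈X , x∈W)

  +-intro : ∀ V W {v w} → v ∈ V → w ∈ W → (v +ᴹ w) ∈ V +ˢ W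
  +-intro V W v∈V w∈W = ∈-+⁺ {V} {W} (_ , v∈V , _ , w∈W , ≈ᴹ-refl)

  span-isSubspace : ∀ {k} (v : Vector Carrierᴹ k) → IsSubspace (InSpan v)
  span-isSubspace v = record
    { resp     = λ x≈y (α , e) → α , ≈ᴹ-trans e x≈y
    ; 0-mem    = _ , lincomb-0 v
    ; +-closed = InSpan-+
    ; *-closed = InSpan-*
    }

  opaque
    span : ∀ {k} → Vector Carrierᴹ k → Subspace
    span v = comprehension (InSpan? v) (span-isSubspace v)

    ∈-span⁺ : ∀ {k} (v : Vector Carrierᴹ k) {x} → InSpan v x → x ∈ span v
    ∈-span⁺ v = ∈-comprehension⁺ (InSpan? v) (span-isSubspace v)

    ∈-span⁻ : ∀ {k} (v : Vector Carrierᴹ k) {x} → x ∈ span v → InSpan v x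
    ∈-span⁻ v = ∈-comprehension⁻ (InSpan? v) (span-isSubspace v)

  vector∈span : ∀ {k} (v : Vector Carrierᴹ k) i → v i ∈ span v
  vector∈span v i = ∈-span⁺ v (basisVector∈span v i)

  span-⊆ : ∀ {k} (v : Vector Carrierᴹ k) V → (∀ i → v i ∈ V) → span v ⊆ V
  span-⊆ v V v∈V x x∈ with ∈-span⁻ v x∈
  ... | α , e = Subspace.resp V e (lincomb-closed V α v∈V)

  +-⊆-span-++ : ∀ V W {k l} (v : Vector Carrierᴹ k) (w : Vector Carrierᴹ l) →
                V ⊆ span v → W ⊆ span w → V +ˢ W ⊆ span (v Vector.++ w)
  +-⊆-span-++ V W {k} {l} v w V⊆ W⊆ = +-⊆ V W {U}
    (λ x → span-⊆ v U (λ i → Subspace.resp U (≈ᴹ-reflexive (lookup-++ˡ v w i)) (vector∈span u (i ↑ˡ l))) x ∘ V⊆ x)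
    (λ x → span-⊆ w U (λ j → Subspace.resp U (≈ᴹ-reflexive (lookup-++ʳ v w j)) (vector∈span u (k ↑ʳ j))) x ∘ W⊆ x)
    where
    u = v Vector.++ w
    U = span u

  -- Representatives in V of a basis of (V + X)/X. The one notion serves for extending bases, for
  -- complements and for quotients.
  record BasisModulo (X V : Subspace) : Set (c ⊔ ℓ ⊔ m ⊔ ℓm) where
    field
      {size}      : ℕ
      vector      : Vector Carrierᴹ size
      vector∈     : ∀ i → vector i ∈ V
      independent : ∀ α → lincomb α vector ∈ X → ∀ i → α i F.≈ F.0#
      spanning    : V ⊆ span vector +ˢ X

  private
    record PartialBasisModulo (X V : Subspace) (xs : List Carrierᴹ) : Set (c ⊔ ℓ ⊔ m ⊔ ℓm) where
      field
        {size}      : ℕ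
        vector      : Vector Carrierᴹ size
        vector∈     : ∀ i → vector i ∈ V
        independent : ∀ α → lincomb α vector ∈ X → ∀ i → α i F.≈ F.0#
        covers      : All.All (λ x → x ∈ V → x ∈ span vector +ˢ X) xs

  -- The greedy choice behind `basisOf`, with X added to the span of the vectors already kept.
  partialBasisModulo : ∀ X V xs → PartialBasisModulo X V xs
  partialBasisModulo X V [] = record
    { vector = Vector.[] ; vector∈ = λ () ; independent = λ _ _ () ; covers = All.[] }
  partialBasisModulo X V (x ∷ xs) = go (x ∈? V) (x ∈? U)
    where
    module B = PartialBasisModulo (partialBasisModulo X V xs)
    U = span B.vector +ˢ X

    go : Dec (x ∈ V) → Dec (x ∈ U) → PartialBasisModulo X V (x ∷ xs)
    go (no x∉V) _ = record
      { vector = B.vector ; vector∈ = B.vector∈ ; independent = B.independent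
      ; covers = (λ x∈V → contradiction x∈V x∉V) All.∷ B.covers }
    go (yes _) (yes x∈U) = record
      { vector = B.vector ; vector∈ = B.vector∈ ; independent = B.independent
      ; covers = (λ _ → x∈U) All.∷ B.covers }
    go (yes x∈V) (no x∉U) = record
      { vector = v
      ; vector∈ = λ { zero → x∈V ; (suc i) → B.vector∈ i }
      ; independent = λ α e → independent′ α e (α zero F.≟ F.0#)
      ; covers = (λ _ → ⊆-+ˡ (span v) X x (vector∈span v zero))
                 All.∷ All.map (λ {y} f y∈V → U⊆ y (f y∈V)) B.covers
      }
      where
      v = x Vector.∷ B.vector
      U⊆ : U ⊆ span v +ˢ X
      U⊆ = +-⊆ (span B.vector) X {span v +ˢ X}
        (λ y y∈ → ⊆-+ˡ (span v) X y (span-⊆ B.vector (span v) (λ i → vector∈span v (suc i)) y y∈))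
        (⊆-+ʳ (span v) X)
      independent′ : ∀ α → lincomb α v ∈ X → Dec (α zero F.≈ F.0#) → ∀ i → α i F.≈ F.0#
      independent′ α e (yes α₀≈0) zero    = α₀≈0
      independent′ α e (yes α₀≈0) (suc i) = B.independent (α ∘ suc)
        (Subspace.resp X (≈ᴹ-trans
          (+ᴹ-congʳ (≈ᴹ-trans (*ₗ-cong α₀≈0 ≈ᴹ-refl) (*ₗ-zeroˡ x))) (+ᴹ-identityˡ _)) e) i
      independent′ α e (no α₀≉0) = contradiction
        (*-cancel-∈ U α₀≉0 (+-cancelʳ-∈ U
          (⊆-+ˡ (span B.vector) X _ (∈-span⁺ B.vector (α ∘ suc , ≈ᴹ-refl)))
          (⊆-+ʳ (span B.vector) X _ e)))
        x∉U

  opaque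
    basisModulo : ∀ X V → BasisModulo X V
    basisModulo X V = record
      { vector = B.vector ; vector∈ = B.vector∈ ; independent = B.independent
      ; spanning = λ x → lookupₛ ≈ᴹ-setoid covers-resp B.covers (vectorList-enumeration x)
      }
      where
      module B = PartialBasisModulo (partialBasisModulo X V vectorList)
      covers-resp : ∀ {y z} → y ≈ᴹ z → (y ∈ V → y ∈ span B.vector +ˢ X) → z ∈ V → z ∈ span B.vector +ˢ X
      covers-resp y≈z f z∈V = Subspace.resp (span B.vector +ˢ X) y≈z
        (f (Subspace.resp V (≈ᴹ-sym y≈z) z∈V))

  dim-minimal : ∀ V {k} (v : Vector Carrierᴹ k) → V ⊆ span v → dim V ≤ k
  dim-minimal V {k} v V⊆ = independent≤spanning k B.vector v B.independent
    λ i → ∈-span⁻ v (V⊆ _ (B.vector∈ i))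
    where module B = Basis (basisOf V)

  dim-maximal : ∀ V {k} (v : Vector Carrierᴹ k) → (∀ i → v i ∈ V) → LinearlyIndependent v → k ≤ dim V
  dim-maximal V v v∈V ind = independent≤spanning _ v B.vector ind λ i → B.spanning _ (v∈V i)
    where module B = Basis (basisOf V)

  dim-mono : ∀ {V W} → V ⊆ W → dim V ≤ dim W
  dim-mono {V} {W} V⊆W = dim-maximal W B.vector (λ i → V⊆W _ (B.vector∈ i)) B.independent
    where module B = Basis (basisOf V)

  dim-cong : ∀ {V W} → V ≐ W → dim V ≡ dim W
  dim-cong (V⊆W , W⊆V) = ℕ.≤-antisym (dim-mono V⊆W) (dim-mono W⊆V)

  dim-0ˢ : dim 0ˢ ≡ 0
  dim-0ˢ = ℕ.n≤0⇒n≡0 (dim-minimal 0ˢ Vector.[] (0ˢ-⊆ (span Vector.[])))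

  dim-whole : dim whole ≡ dimension
  dim-whole = ℕ.≤-antisym
    (dim-minimal whole basis λ x _ → ∈-span⁺ basis (spanning x))
    (dim-maximal whole basis (λ _ → ∈-whole) independent)

  -- The representatives followed by a basis of X form a basis of V.
  dim-modulo : ∀ {X V} → X ⊆ V → (B : BasisModulo X V) → dim V ≡ BasisModulo.size B + dim X
  dim-modulo {X} {V} X⊆V B = ℕ.≤-antisym
    (dim-minimal V w V⊆span) (dim-maximal V w w∈V w-independent)
    where
    module B = BasisModulo B
    module X = Basis (basisOf X)
    k = B.size
    w : Vector Carrierᴹ (k + X.size)
    w = B.vector Vector.++ X.vector

    wˡ : ∀ i → w (i ↑ˡ X.size) ≈ᴹ B.vector i
    wˡ i = ≈ᴹ-reflexive (lookup-++ˡ B.vector X.vector i)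
    wʳ : ∀ j → w (k ↑ʳ j) ≈ᴹ X.vector j
    wʳ j = ≈ᴹ-reflexive (lookup-++ʳ B.vector X.vector j)

    split : ∀ {p} (P : Fin (k + X.size) → Set p) →
            (∀ i → P (i ↑ˡ X.size)) → (∀ j → P (k ↑ʳ j)) → ∀ i → P i
    split P l r i with splitAt k i in eq
    ... | inj₁ i′ = ≡.subst P (splitAt⁻¹-↑ˡ eq) (l i′)
    ... | inj₂ j  = ≡.subst P (splitAt⁻¹-↑ʳ eq) (r j)

    w∈V : ∀ i → w i ∈ V
    w∈V = split (λ i → w i ∈ V)
      (λ i → Subspace.resp V (≈ᴹ-sym (wˡ i)) (B.vector∈ i))
      (λ j → Subspace.resp V (≈ᴹ-sym (wʳ j)) (X⊆V _ (X.vector∈ j)))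

    V⊆span : V ⊆ span w
    V⊆span x x∈V = +-⊆-span-++ (span B.vector) X B.vector X.vector
      (λ _ y∈ → y∈) (λ y → ∈-span⁺ X.vector ∘ X.spanning y) x (B.spanning x x∈V)

    w-independent : LinearlyIndependent w
    w-independent α e = split (λ i → α i F.≈ F.0#) α₁≈0 (X.independent (α ∘ (k ↑ʳ_)) (begin
      lincomb (α ∘ (k ↑ʳ_)) X.vector   ≈⟨ +ᴹ-identityˡ _ ⟨
      0ᴹ +ᴹ lincomb (α ∘ (k ↑ʳ_)) X.vector ≈⟨ +ᴹ-congʳ (lincomb-zero B.vector α₁≈0) ⟨
      lincomb (α ∘ (_↑ˡ X.size)) B.vector +ᴹ lincomb (α ∘ (k ↑ʳ_)) X.vector ≈⟨ e′ ⟩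
      0ᴹ ∎))
      where
      e′ = ≈ᴹ-trans (≈ᴹ-sym (lincomb-++ k α B.vector X.vector)) e
      -- The second block of the relation lies in X, hence so does the first, and independence
      -- modulo X kills its coefficients. Only then does independence of the basis of X apply.
      α₁≈0 : ∀ i → α (i ↑ˡ X.size) F.≈ F.0#
      α₁≈0 = B.independent (α ∘ (_↑ˡ X.size)) (+-cancelʳ-∈ X
        (lincomb-closed X (α ∘ (k ↑ʳ_)) X.vector∈)
        (Subspace.resp X (≈ᴹ-sym e′) (Subspace.0-mem X)))

  dim-+⟨⟩ : ∀ {X V x} → X ⊆ V → x ∈ V → ¬ (x ∈ X) → V ⊆ X +ˢ ⟨ x ⟩ → dim V ≡ ℕ.suc (dim X)
  dim-+⟨⟩ {X} {V} {x} X⊆V x∈V x∉X V⊆ = dim-modulo {X} {V} X⊆V (record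
    { vector      = v
    ; vector∈     = λ _ → x∈V
    ; independent = λ α e i → independent′ α e i (α zero F.≟ F.0#)
    ; spanning    = λ y y∈V → +-⊆ X ⟨ x ⟩ {span v +ˢ X} (⊆-+ʳ (span v) X)
        (⟨x⟩⊆ (span v +ˢ X) (⊆-+ˡ (span v) X x (vector∈span v zero))) y (V⊆ y y∈V)
    })
    where
    v : Vector Carrierᴹ 1
    v _ = x
    independent′ : ∀ α → lincomb α v ∈ X → ∀ i → Dec (α zero F.≈ F.0#) → α i F.≈ F.0#
    independent′ α e zero (yes α₀≈0) = α₀≈0
    independent′ α e i    (no α₀≉0) = contradiction
      (*-cancel-∈ X α₀≉0 (Subspace.resp X (+ᴹ-identityʳ _) e)) x∉X

  dim≡0⇒≈0 : ∀ V → dim V ≡ 0 → ∀ {x} → x ∈ V → x ≈ᴹ 0ᴹ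
  dim≡0⇒≈0 V e {x} x∈V = ≈ᴹ-trans (≈ᴹ-sym (proj₂ (B.spanning x x∈V))) (empty e _ B.vector)
    where
    module B = Basis (basisOf V)
    empty : ∀ {k} → k ≡ 0 → ∀ α (v : Vector Carrierᴹ k) → lincomb α v ≈ᴹ 0ᴹ
    empty ≡.refl α v = ≈ᴹ-refl

  ⊆0⇒dim≡0 : ∀ V → (∀ x → x ∈ V → x ≈ᴹ 0ᴹ) → dim V ≡ 0
  ⊆0⇒dim≡0 V f = ≡.trans (dim-cong {V} {0ˢ} ((λ x x∈V → ∈-0⁺ (f x x∈V)) , 0ˢ-⊆ V)) dim-0ˢ

  -- Add to X the representatives of a basis of E modulo X + ⟨x⟩. If x = s + y with s in their span
  -- and y ∈ X, then s ∈ X + ⟨x⟩, so s = 0 and x would lie in X.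
  hyperplane : ∀ X {x} → ¬ (x ∈ X) → ∃ λ W → X ⊆ W × ¬ (x ∈ W) × W +ˢ ⟨ x ⟩ ≐ whole
  hyperplane X {x} x∉X = W , ⊆-+ʳ S X , x∉W , ⊆-whole (W +ˢ ⟨ x ⟩) ,
    λ y _ → +-⊆ S (X +ˢ ⟨ x ⟩) {W +ˢ ⟨ x ⟩}
      (λ z z∈ → ⊆-+ˡ W ⟨ x ⟩ z (⊆-+ˡ S X z z∈))
      (+-⊆ X ⟨ x ⟩ {W +ˢ ⟨ x ⟩} (λ z z∈ → ⊆-+ˡ W ⟨ x ⟩ z (⊆-+ʳ S X z z∈)) (⊆-+ʳ W ⟨ x ⟩))
      y (B.spanning y ∈-whole)
    where
    module B = BasisModulo (basisModulo (X +ˢ ⟨ x ⟩) whole)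
    S = span B.vector
    W = S +ˢ X
    x∉W : ¬ (x ∈ W)
    x∉W x∈W = x∉X (Subspace.resp X (≈ᴹ-sym (≈ᴹ-trans x≈s+y (≈ᴹ-trans (+ᴹ-congʳ s≈0) (+ᴹ-identityˡ _)))) y∈X)
      where
      split = ∈-+⁻ {S} {X} x∈W
      s = proj₁ split
      y = proj₁ (proj₂ (proj₂ split))
      y∈X : y ∈ X
      y∈X = proj₁ (proj₂ (proj₂ (proj₂ split)))
      x≈s+y : x ≈ᴹ s +ᴹ y
      x≈s+y = proj₂ (proj₂ (proj₂ (proj₂ split)))
      s∈span : InSpan B.vector s
      s∈span = ∈-span⁻ B.vector (proj₁ (proj₂ split))
      s∈ : s ∈ X +ˢ ⟨ x ⟩
      s∈ = +-cancelʳ-∈ (X +ˢ ⟨ x ⟩) (⊆-+ˡ X ⟨ x ⟩ y y∈X)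
        (Subspace.resp (X +ˢ ⟨ x ⟩) x≈s+y (⊆-+ʳ X ⟨ x ⟩ x (x∈⟨x⟩ x)))
      s≈0 : s ≈ᴹ 0ᴹ
      s≈0 = ≈ᴹ-trans (≈ᴹ-sym (proj₂ s∈span)) (lincomb-zero B.vector
        (B.independent (proj₁ s∈span) (Subspace.resp (X +ˢ ⟨ x ⟩) (≈ᴹ-sym (proj₂ s∈span)) s∈)))

module _ {F : FiniteField c ℓ} where
  private module F = FiniteField F

  -- Linear maps

  infix 3 _⟶_
  record _⟶_ (E : VectorSpace F m ℓm) (E′ : VectorSpace F n ℓn) : Set (c ⊔ m ⊔ ℓm ⊔ n ⊔ ℓn) where
    private
      module E  = VectorSpace E
      module E′ = VectorSpace E′
    open LeftModuleMorphisms E.rawLeftModule E′.rawLeftModule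
    field
      to             : E.Carrierᴹ → E′.Carrierᴹ
      isHomomorphism : IsLeftModuleHomomorphism to
    open IsLeftModuleHomomorphism isHomomorphism public

  infixr 8 _·_
  _·_ : {E : VectorSpace F m ℓm} {E′ : VectorSpace F n ℓn} →
        (E ⟶ E′) → VectorSpace.Carrierᴹ E → VectorSpace.Carrierᴹ E′
  h · x = _⟶_.to h x

  module _ (E : VectorSpace F m ℓm) (E′ : VectorSpace F n ℓn) where
    private
      module E  = VectorSpace E
      module E′ = VectorSpace E′

    linear : (f : E.Carrierᴹ → E′.Carrierᴹ) → (∀ {x y} → x E.≈ᴹ y → f x E′.≈ᴹ f y) →
             (∀ x y → f (x E.+ᴹ y) E′.≈ᴹ f x E′.+ᴹ f y) → (∀ α x → f (α E.*ₗ x) E′.≈ᴹ α E′.*ₗ f x) →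
             E ⟶ E′
    linear f cong +-homo *-homo = record
      { to = f
      ; isHomomorphism = record
        { +ᴹ-isGroupHomomorphism = record
          { isMonoidHomomorphism = record
            { isMagmaHomomorphism = record { isRelHomomorphism = record { cong = cong } ; homo = +-homo }
            ; ε-homo = 0-homo }
          ; ⁻¹-homo = λ x → Combinations.-ᴹ-unique F E′.leftModule _ _ (E′.≈ᴹ-trans
              (E′.≈ᴹ-sym (+-homo _ _)) (E′.≈ᴹ-trans (cong (E.-ᴹ‿inverseˡ x)) 0-homo)) }
        ; *ₗ-homo = *-homo
        }
      }
      where
      0-homo : f E.0ᴹ E′.≈ᴹ E′.0ᴹ
      0-homo = E′.≈ᴹ-trans (cong (E.≈ᴹ-sym (E.*ₗ-zeroˡ E.0ᴹ)))
        (E′.≈ᴹ-trans (*-homo F.0# E.0ᴹ) (E′.*ₗ-zeroˡ _))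

  identity : (E : VectorSpace F m ℓm) → E ⟶ E
  identity E = linear E E (λ x → x) (λ e → e) (λ _ _ → ≈ᴹ-refl) (λ _ _ → ≈ᴹ-refl)
    where open VectorSpace E

  infixr 9 _⊚_
  _⊚_ : {E : VectorSpace F m ℓm} {E′ : VectorSpace F n ℓn} {E″ : VectorSpace F o ℓo} →
        (E′ ⟶ E″) → (E ⟶ E′) → E ⟶ E″
  _⊚_ {E = E} {E″ = E″} g h = linear E E″ (λ x → g · h · x) (g.⟦⟧-cong ∘ h.⟦⟧-cong)
    (λ x y → ≈ᴹ-trans (g.⟦⟧-cong (h.+ᴹ-homo x y)) (g.+ᴹ-homo _ _))
    (λ α x → ≈ᴹ-trans (g.⟦⟧-cong (h.*ₗ-homo α x)) (g.*ₗ-homo α _))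
    where
    open VectorSpace E″
    module g = _⟶_ g
    module h = _⟶_ h

  infixl 6 _-ᴸ_
  _-ᴸ_ : {E : VectorSpace F m ℓm} {E′ : VectorSpace F n ℓn} → (E ⟶ E′) → (E ⟶ E′) → E ⟶ E′
  _-ᴸ_ {E = E} {E′ = E′} g h = linear E E′ (λ x → g · x -ᴹ h · x)
    (λ e → +ᴹ-cong (g.⟦⟧-cong e) (*ₗ-cong F.refl (h.⟦⟧-cong e)))
    (λ x y → ≈ᴹ-trans (+ᴹ-cong (g.+ᴹ-homo x y)
      (≈ᴹ-trans (*ₗ-cong F.refl (h.+ᴹ-homo x y)) (*ₗ-distribˡ _ _ _))) (+ᴹ-medial _ _ _ _))
    (λ α x → ≈ᴹ-trans (+ᴹ-cong (g.*ₗ-homo α x) (begin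
      (F.- F.1#) *ₗ h · (α E.*ₗ x)    ≈⟨ *ₗ-cong F.refl (h.*ₗ-homo α x) ⟩
      (F.- F.1#) *ₗ α *ₗ h · x        ≈⟨ *ₗ-assoc _ _ _ ⟨
      ((F.- F.1#) F.* α) *ₗ h · x     ≈⟨ *ₗ-cong (F.*-comm _ _) ≈ᴹ-refl ⟩
      (α F.* (F.- F.1#)) *ₗ h · x     ≈⟨ *ₗ-assoc _ _ _ ⟩
      α *ₗ (F.- F.1#) *ₗ h · x        ∎)) (≈ᴹ-sym (*ₗ-distribˡ _ _ _)))
    where
    module E = VectorSpace E
    open VectorSpace E′
    open Combinations F leftModule
    open SetoidReasoning ≈ᴹ-setoid
    module g = _⟶_ g
    module h = _⟶_ h

module LinearMapProperties {F : FiniteField c ℓ} {E : VectorSpace F m ℓm} {E′ : VectorSpace F n ℓn}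
                           (h : E ⟶ E′) where
  private
    module F  = FiniteField F
    module E  = VectorSpace E
    module E′ = VectorSpace E′
    module S  = Subspaces E
    module S′ = Subspaces E′
    module P  = SubspaceProperties E
    module P′ = SubspaceProperties E′
    module C  = Combinations F E.leftModule
    module C′ = Combinations F E′.leftModule
    module h = _⟶_ h
  open S  using (_∈_; _⊆_; _≐_; _∩_; _+ˢ_)
  open S′ using () renaming (_∈_ to _∈′_; _⊆_ to _⊆′_; _≐_ to _≐′_; _∩_ to _∩′_; _+ˢ_ to _+′_)

  image[_] : S.Subspace → S′.Subspace
  image[ V ] = image E E′ h.isHomomorphism V

  image⁺ : ∀ V {x} → x ∈ V → h · x ∈′ image[ V ]
  image⁺ V x∈V = ∈-image⁺ E E′ h.isHomomorphism {V} (_ , x∈V , E′.≈ᴹ-refl)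

  image⁻ : ∀ V {y} → y ∈′ image[ V ] → ∃ λ x → x ∈ V × y E′.≈ᴹ h · x
  image⁻ V = ∈-image⁻ E E′ h.isHomomorphism {V}

  image-⊆ : ∀ V {W} → (∀ x → x ∈ V → h · x ∈′ W) → image[ V ] ⊆′ W
  image-⊆ V {W} f y y∈ with image⁻ V y∈
  ... | x , x∈V , e = S′.Subspace.resp W (E′.≈ᴹ-sym e) (f x x∈V)

  image-mono : ∀ {V W} → V ⊆ W → image[ V ] ⊆′ image[ W ]
  image-mono {V} {W} V⊆W = image-⊆ V {image[ W ]} λ x x∈V → image⁺ W (V⊆W x x∈V)

  image-cong : ∀ {V W} → V ≐ W → image[ V ] ≐′ image[ W ]
  image-cong {V} {W} (l , r) = image-mono {V} {W} l , image-mono {W} {V} r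

  image-+ : ∀ V W → image[ V +ˢ W ] ⊆′ image[ V ] +′ image[ W ]
  image-+ V W = image-⊆ (V +ˢ W) {U} λ x x∈ →
    let (v , v∈V , w , w∈W , e) = S.∈-+⁻ {V} {W} x∈ in
    S′.Subspace.resp U (E′.≈ᴹ-sym (E′.≈ᴹ-trans (h.⟦⟧-cong e) (h.+ᴹ-homo v w)))
      (P′.+-intro image[ V ] image[ W ] (image⁺ V v∈V) (image⁺ W w∈W))
    where U = image[ V ] +′ image[ W ]

  image-∩ : ∀ V W → image[ V ∩ W ] ⊆′ image[ V ] ∩′ image[ W ]
  image-∩ V W = image-⊆ (V ∩ W) {image[ V ] ∩′ image[ W ]} λ x x∈ →
    let (x∈V , x∈W) = S.∈-∩⁻ {V} {W} x∈ in
    S′.∈-∩⁺ {image[ V ]} {image[ W ]} (image⁺ V x∈V , image⁺ W x∈W)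

  image-⟨⟩ : ∀ x → image[ S.⟨ x ⟩ ] ≐′ S′.⟨ h · x ⟩
  image-⟨⟩ x =
    image-⊆ S.⟨ x ⟩ {S′.⟨ h · x ⟩} (λ y y∈ → let (α , e) = S.∈-⟨⟩⁻ {x} y∈ in
      S′.∈-⟨⟩⁺ {h · x} (α , E′.≈ᴹ-trans (h.⟦⟧-cong e) (h.*ₗ-homo α x))) ,
    S′.⟨x⟩⊆ image[ S.⟨ x ⟩ ] (image⁺ S.⟨ x ⟩ (S.x∈⟨x⟩ x))

  preimage-isSubspace : ∀ V → S.IsSubspace (λ x → h · x ∈′ V)
  preimage-isSubspace V = record
    { resp     = λ e → V.resp (h.⟦⟧-cong e)
    ; 0-mem    = V.resp (E′.≈ᴹ-sym h.0ᴹ-homo) V.0-mem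
    ; +-closed = λ u v → V.resp (E′.≈ᴹ-sym (h.+ᴹ-homo _ _)) (V.+-closed u v)
    ; *-closed = λ α u → V.resp (E′.≈ᴹ-sym (h.*ₗ-homo α _)) (V.*-closed α u)
    }
    where module V = S′.Subspace V

  opaque
    preimage : S′.Subspace → S.Subspace
    preimage V = S.comprehension (λ x → h · x S′.∈? V) (preimage-isSubspace V)

    ∈-preimage⁺ : ∀ V {x} → h · x ∈′ V → x ∈ preimage V
    ∈-preimage⁺ V = S.∈-comprehension⁺ (λ x → h · x S′.∈? V) (preimage-isSubspace V)

    ∈-preimage⁻ : ∀ V {x} → x ∈ preimage V → h · x ∈′ V
    ∈-preimage⁻ V = S.∈-comprehension⁻ (λ x → h · x S′.∈? V) (preimage-isSubspace V)

  kernel : S.Subspace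
  kernel = preimage S′.0ˢ

  ∈-kernel⁺ : ∀ {x} → h · x E′.≈ᴹ E′.0ᴹ → x ∈ kernel
  ∈-kernel⁺ e = ∈-preimage⁺ S′.0ˢ (S′.∈-0⁺ e)

  ∈-kernel⁻ : ∀ {x} → x ∈ kernel → h · x E′.≈ᴹ E′.0ᴹ
  ∈-kernel⁻ x∈ = S′.∈-0⁻ (∈-preimage⁻ S′.0ˢ x∈)

  homo-- : ∀ x y → h · (x C.-ᴹ y) E′.≈ᴹ h · x C′.-ᴹ h · y
  homo-- x y = E′.≈ᴹ-trans (h.+ᴹ-homo x _) (E′.+ᴹ-congˡ (h.*ₗ-homo _ y))

  kernel-- : ∀ {x y} → h · x E′.≈ᴹ h · y → (x C.-ᴹ y) ∈ kernel
  kernel-- {x} {y} e = ∈-kernel⁺ (E′.≈ᴹ-trans (homo-- x y)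
    (E′.≈ᴹ-trans (E′.+ᴹ-congʳ e) (C′.x-x≈0 _)))

  kernel--⁻ : ∀ {x y} → (x C.-ᴹ y) ∈ kernel → h · x E′.≈ᴹ h · y
  kernel--⁻ {x} {y} x-y∈ = C′.x-y≈0⇒x≈y (E′.≈ᴹ-trans (E′.≈ᴹ-sym (homo-- x y)) (∈-kernel⁻ x-y∈))

  lincomb-homo : ∀ {k} α (v : Vector E.Carrierᴹ k) →
                 h · E.lincomb α v E′.≈ᴹ E′.lincomb α (λ i → h · v i)
  lincomb-homo {ℕ.zero}  α v = h.0ᴹ-homo
  lincomb-homo {ℕ.suc k} α v = E′.≈ᴹ-trans (h.+ᴹ-homo _ _)
    (E′.+ᴹ-cong (h.*ₗ-homo _ _) (lincomb-homo (α ∘ suc) (v ∘ suc)))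

  image-span : ∀ {k} (v : Vector E.Carrierᴹ k) → image[ P.span v ] ⊆′ P′.span (λ i → h · v i)
  image-span v = image-⊆ (P.span v) {P′.span (λ i → h · v i)} λ x x∈ →
    let (α , e) = P.∈-span⁻ v x∈ in
    P′.∈-span⁺ (λ i → h · v i) (α , E′.≈ᴹ-trans (E′.≈ᴹ-sym (lincomb-homo α v)) (h.⟦⟧-cong e))

  -- A basis of V modulo V ∩ ker h is mapped to a basis of h(V).
  rank-nullity : ∀ V → S.dim V ≡ S′.dim image[ V ] + S.dim (V ∩ kernel)
  rank-nullity V = ≡.trans (P.dim-modulo {V ∩ kernel} {V} (P.∩-⊆ˡ V kernel) B)
    (≡.cong (_+ S.dim (V ∩ kernel)) (ℕ.≤-antisym
      (P′.dim-maximal image[ V ] hv (λ i → image⁺ V (B.vector∈ i)) λ α e →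
        B.independent α (S.∈-∩⁺ {V} {kernel}
          (P.lincomb-closed V α B.vector∈ , ∈-kernel⁺ (E′.≈ᴹ-trans (lincomb-homo α B.vector) e))))
      (P′.dim-minimal image[ V ] hv (image-⊆ V {P′.span hv} λ x x∈V →
        let (y , y∈ , z , z∈ , e) = S.∈-+⁻ {P.span B.vector} {V ∩ kernel} (B.spanning x x∈V) in
        S′.Subspace.resp (P′.span hv)
          (E′.≈ᴹ-sym (E′.≈ᴹ-trans (h.⟦⟧-cong e) (E′.≈ᴹ-trans (h.+ᴹ-homo y z)
            (E′.≈ᴹ-trans (E′.+ᴹ-congˡ (∈-kernel⁻ (P.∩-⊆ʳ V kernel z z∈))) (E′.+ᴹ-identityʳ _)))))
          (image-span B.vector _ (image⁺ (P.span B.vector) y∈))))))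
    where
    B = P.basisModulo (V ∩ kernel) V
    module B = P.BasisModulo B
    hv : Vector E′.Carrierᴹ B.size
    hv i = h · B.vector i

  dim-image-≤ : ∀ V → S′.dim image[ V ] ≤ S.dim V
  dim-image-≤ V = ≡.subst (S′.dim image[ V ] ≤_) (≡.sym (rank-nullity V)) (ℕ.m≤m+n _ _)

-- The rank function of a direct sum

dimension-^ᵛ : (F : FiniteField c ℓ) (k : ℕ) → VectorSpace.dimension (_^ᵛ_ F k) ≡ k
dimension-^ᵛ F ℕ.zero    = ≡.refl
dimension-^ᵛ F (ℕ.suc k) = ≡.cong ℕ.suc (dimension-^ᵛ F k)

dim-whole-^ᵛ : (F : FiniteField c ℓ) (k : ℕ) → Subspaces.dim (_^ᵛ_ F k) (Subspaces.whole (_^ᵛ_ F k)) ≡ k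
dim-whole-^ᵛ F k = ≡.trans (SubspaceProperties.dim-whole (_^ᵛ_ F k)) (dimension-^ᵛ F k)

module _ {F : FiniteField c ℓ} (E : VectorSpace F m ℓm) where
  open Subspaces E

  -- The inequality r(V) - r(X) ≤ dim V - dim X without subtraction. It decides where the minimum
  -- defining the rank of a direct sum is attained.
  UnitIncreasing : (Subspace → ℕ) → Set _
  UnitIncreasing r = ∀ {X V} → X ⊆ V → r V + dim X ≤ r X + dim V

  -- Mutually included subspaces have equal dimension, so the defining inequality applies in both
  -- directions. This supplies congruence for the inner direct sum, which is known here only to be
  -- unit increasing.
  unitIncreasing⇒cong : ∀ {r} → UnitIncreasing r → ∀ {V W} → V ≐ W → r V ≡ r W
  unitIncreasing⇒cong {r} ui {V} {W} V≐W@(V⊆W , W⊆V) = ℕ.≤-antisym (half {W} {V} W⊆V (≡.sym e)) (half {V} {W} V⊆W e)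
    where
    e : dim V ≡ dim W
    e = SubspaceProperties.dim-cong E {V} {W} V≐W
    half : ∀ {X Y} → X ⊆ Y → dim X ≡ dim Y → r Y ≤ r X
    half {X} {Y} X⊆Y e = ℕ.+-cancelʳ-≤ (dim X) _ _
      (≡.subst (λ d → r Y + dim X ≤ r X + d) (≡.sym e) (ui {X} {Y} X⊆Y))

module _ {F : FiniteField c ℓ} {E : VectorSpace F m ℓm} {E′ : VectorSpace F n ℓn} (h : E ⟶ E′) where
  private
    module S  = Subspaces E
    module S′ = Subspaces E′
    module P  = SubspaceProperties E
  open LinearMapProperties h

  -- By rank-nullity the growth of dim from X to V is that of the image plus that of the
  -- intersection with the kernel, and the latter is nonnegative.
  unitIncreasing-image : ∀ {r} → UnitIncreasing E′ r → UnitIncreasing E (λ V → r image[ V ])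
  unitIncreasing-image {r} ui {X} {V} X⊆V = begin
    r hV + S.dim X                            ≡⟨ ≡.cong (r hV +_) (rank-nullity X) ⟩
    r hV + (S′.dim hX + S.dim (X S.∩ kernel)) ≡⟨ ℕ.+-assoc (r hV) _ _ ⟨
    r hV + S′.dim hX + S.dim (X S.∩ kernel)   ≤⟨ ℕ.+-mono-≤ (ui {hX} {hV} (image-mono {X} {V} X⊆V))
                                                   (P.dim-mono {X S.∩ kernel} {V S.∩ kernel} (P.∩-monoˡ {X} {V} kernel X⊆V)) ⟩
    r hX + S′.dim hV + S.dim (V S.∩ kernel)   ≡⟨ ℕ.+-assoc (r hX) _ _ ⟩
    r hX + (S′.dim hV + S.dim (V S.∩ kernel)) ≡⟨ ≡.cong (r hX +_) (rank-nullity V) ⟨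
    r hX + S.dim V                            ∎
    where
    open ℕ.≤-Reasoning
    hX = image[ X ]
    hV = image[ V ]

module QMatroidProperties {F : FiniteField c ℓ} (M : QMatroid F m ℓm) where
  open QMatroid M
  open SubspaceProperties space

  subadditive : ∀ V W → ρ (V +ˢ W) ≤ ρ V + ρ W
  subadditive V W = ℕ.≤-trans (ℕ.m≤m+n _ _) (submodular V W)

  -- V lies in X plus the span of dim V - dim X vectors, and the rank of that span is at most their
  -- number.
  ρ-unitIncreasing : UnitIncreasing space ρ
  ρ-unitIncreasing {X} {V} X⊆V = begin
    ρ V + dim X                       ≤⟨ ℕ.+-monoˡ-≤ (dim X) (monotone {V} {span B.vector +ˢ X} B.spanning) ⟩
    ρ (span B.vector +ˢ X) + dim X    ≤⟨ ℕ.+-monoˡ-≤ (dim X) (subadditive (span B.vector) X) ⟩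
    ρ (span B.vector) + ρ X + dim X   ≤⟨ ℕ.+-monoˡ-≤ (dim X) (ℕ.+-monoˡ-≤ (ρ X) (ℕ.≤-trans (bounded (span B.vector))
                                          (dim-minimal (span B.vector) B.vector λ _ x∈ → x∈))) ⟩
    B.size + ρ X + dim X              ≡⟨ ≡.cong (_+ dim X) (ℕ.+-comm B.size (ρ X)) ⟩
    ρ X + B.size + dim X              ≡⟨ ℕ.+-assoc (ρ X) _ _ ⟩
    ρ X + (B.size + dim X)            ≡⟨ ≡.cong (ρ X +_) (dim-modulo {X} {V} X⊆V (basisModulo X V)) ⟨
    ρ X + dim V                       ∎
    where
    open ℕ.≤-Reasoning
    module B = BasisModulo (basisModulo X V)

module _ {F : FiniteField c ℓ} (E₁ : VectorSpace F m ℓm) (E₂ : VectorSpace F n ℓn) where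

  π₁ : E₁ ⊕ᵛ E₂ ⟶ E₁
  π₁ = record { to = proj₁ ; isHomomorphism = π₁-homomorphism E₁ E₂ }

  π₂ : E₁ ⊕ᵛ E₂ ⟶ E₂
  π₂ = record { to = proj₂ ; isHomomorphism = π₂-homomorphism E₁ E₂ }

module DirectSum {F : FiniteField c ℓ} {E₁ : VectorSpace F m ℓm} {E₂ : VectorSpace F n ℓn}
                 (ρ₁ : Subspaces.Subspace E₁ → ℕ) (ρ₂ : Subspaces.Subspace E₂ → ℕ) where
  private
    module I₁ = LinearMapProperties (π₁ E₁ E₂)
    module I₂ = LinearMapProperties (π₂ E₁ E₂)
    module E₁ = Subspaces E₁
    module E₂ = Subspaces E₂
  open Subspaces (E₁ ⊕ᵛ E₂)
  open SubspaceProperties (E₁ ⊕ᵛ E₂) using (dim-mono; dim-cong)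

  -- The minimum over all subspaces is kept folded. `ρ-≥` and `ρ-≤` bound it from the two sides, and
  -- the computations below rest on these bounds.
  opaque
    ρ : Subspace → ℕ
    ρ = RawQMatroid.ρ (record { space = E₁ ; ρ = ρ₁ } ⊕ record { space = E₂ ; ρ = ρ₂ })

  s : Subspace → ℕ
  s X = ρ₁ I₁.image[ X ] + ρ₂ I₂.image[ X ]

  opaque
    unfolding ρ

    ρ-≡ : ∀ V → ρ V ≡
      min (s V + (dim V ∸ dim V)) (List.map (λ X → s X + (dim V ∸ dim X)) (filter (_⊆? V) subspaces))
    ρ-≡ V = ≡.refl

  ρ-≥ : ∀ {k} V → (∀ X → X ⊆ V → k ≤ s X + (dim V ∸ dim X)) → k ≤ ρ V
  ρ-≥ {k} V f = ≡.subst (k ≤_) (≡.sym (ρ-≡ V)) (v≤min⁺ (f V λ _ v → v)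
    (All.map⁺ (All.tabulate {xs = filter (_⊆? V) subspaces} λ {X} X∈ →
      f X (proj₂ (∈-filter⁻ (_⊆? V) {xs = subspaces} X∈)))))

  module _ (ρ₁-cong : ∀ {V W} → V E₁.≐ W → ρ₁ V ≡ ρ₁ W) (ρ₂-cong : ∀ {V W} → V E₂.≐ W → ρ₂ V ≡ ρ₂ W) where

    s-cong : ∀ {X Y} → X ≐ Y → s X ≡ s Y
    s-cong {X} {Y} X≐Y = ≡.cong₂ _+_
      (ρ₁-cong {I₁.image[ X ]} {I₁.image[ Y ]} (I₁.image-cong {X} {Y} X≐Y))
      (ρ₂-cong {I₂.image[ X ]} {I₂.image[ Y ]} (I₂.image-cong {X} {Y} X≐Y))

    -- The list `subspaces` contains X only up to `_≐_`; the congruence of both rank functions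
    -- carries the bound from the listed copy Y to X.
    ρ-≤ : ∀ {X V} → X ⊆ V → ρ V ≤ s X + (dim V ∸ dim X)
    ρ-≤ {X} {V} X⊆V = ≡.subst (_≤ s X + (dim V ∸ dim X)) (≡.sym (ρ-≡ V))
      (min≤v⁺ _ _ (inj₂ (Any.map⁺ (lose
        (∈-filter⁺ (_⊆? V) Y∈ (λ x → X⊆V x ∘ proj₂ X≐Y x))
        (ℕ.≤-reflexive (≡.sym (≡.cong₂ (λ k d → k + (dim V ∸ d)) (s-cong {X} {Y} X≐Y) (dim-cong {X} {Y} X≐Y))))))))
      where
      found = find (subspaces-enumeration X)
      Y   = proj₁ found
      Y∈  = proj₁ (proj₂ found)
      X≐Y = proj₂ (proj₂ found)

    -- Every candidate Y ≤ X for the minimum at X is also a candidate at V, where its value is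
    -- larger by exactly dim V - dim X.
    ⊕-unitIncreasing : UnitIncreasing (E₁ ⊕ᵛ E₂) ρ
    ⊕-unitIncreasing {X} {V} X⊆V = ℕ.≤-trans (ℕ.m≤n+m∸n (ρ V + dim X) (dim V)) (ℕ.≤-trans
      -- `ρ-≥` bounds `ρ X` alone, so `dim V` is first split off by truncated subtraction and added
      -- back afterwards.
      (ℕ.+-monoʳ-≤ (dim V) (ρ-≥ X λ Y Y⊆X → ℕ.m≤n+o⇒m∸n≤o _ (dim V) (bound Y Y⊆X)))
      (ℕ.≤-reflexive (ℕ.+-comm (dim V) (ρ X))))
      where
      open ℕ.≤-Reasoning
      bound : ∀ Y → Y ⊆ X → ρ V + dim X ≤ dim V + (s Y + (dim X ∸ dim Y))
      bound Y Y⊆X = begin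
        ρ V + dim X                       ≤⟨ ℕ.+-monoˡ-≤ (dim X) (ρ-≤ {Y} {V} λ y → X⊆V y ∘ Y⊆X y) ⟩
        s Y + (dim V ∸ dim Y) + dim X     ≡⟨ ℕ.+-assoc (s Y) _ _ ⟩
        s Y + ((dim V ∸ dim Y) + dim X)   ≡⟨ ≡.cong (s Y +_) (≡.trans
          (≡.sym (ℕ.+-∸-comm (dim X) dY≤dV)) (ℕ.+-∸-assoc (dim V) dY≤dX)) ⟩
        s Y + (dim V + (dim X ∸ dim Y))   ≡⟨ solve 3 (λ x y z → x :+ (y :+ z) := y :+ (x :+ z)) ≡.refl (s Y) (dim V) _ ⟩
        dim V + (s Y + (dim X ∸ dim Y))   ∎
        where
        open +-*-Solver
        dY≤dX = dim-mono {Y} {X} Y⊆X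
        dY≤dV = ℕ.≤-trans dY≤dX (dim-mono {X} {V} X⊆V)

module _ (F : FiniteField c ℓ) (k : ℕ) where
  private B = _^ᵛ_ F k
  open Subspaces B

  dim-≤-^ᵛ : ∀ V → dim V ≤ k
  dim-≤-^ᵛ V = ≡.subst (dim V ≤_) (dim-whole-^ᵛ F k)
    (SubspaceProperties.dim-mono B {V} {whole} (SubspaceProperties.⊆-whole B V))

  ρ-𝒰-free : ∀ V → RawQMatroid.ρ (𝒰 F k k) V ≡ dim V
  ρ-𝒰-free V = ℕ.m≥n⇒m⊓n≡n (dim-≤-^ᵛ V)

module _ {F : FiniteField c ℓ} {E₁ : VectorSpace F m ℓm} {E₂ : VectorSpace F n ℓn}
         {r₁ : Subspaces.Subspace E₁ → ℕ} {r₂ : Subspaces.Subspace E₂ → ℕ} (ui₂ : UnitIncreasing E₂ r₂) where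
  open Subspaces (E₁ ⊕ᵛ E₂)
  open ℕ.≤-Reasoning
  open +-*-Solver
  private
    module E₁ = Subspaces E₁
    module D  = DirectSum r₁ r₂
    module I₁ = LinearMapProperties (π₁ E₁ E₂)
    module I₂ = LinearMapProperties (π₂ E₁ E₂)
    module P  = SubspaceProperties (E₁ ⊕ᵛ E₂)
    module P₁ = SubspaceProperties E₁

  -- Enlarging X to V raises r₂(π₂ X) by at most dim V - dim X, which is what the term dim V - dim X
  -- loses. Hence the minimum is attained at X = V.
  ρ-null⊕ : (∀ V → r₁ V ≡ 0) → ∀ V → D.ρ V ≡ r₂ I₂.image[ V ]
  ρ-null⊕ r₁≡0 V = ℕ.≤-antisym
    (begin
      D.ρ V                                       ≤⟨ D.ρ-≤ (λ {X} {Y} _ → ≡.trans (r₁≡0 X) (≡.sym (r₁≡0 Y)))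
                                                      (unitIncreasing⇒cong E₂ ui₂) {V} {V} (λ _ v → v) ⟩
      D.s V + (dim V ∸ dim V)                     ≡⟨ ≡.cong₂ _+_ (s-≡ V) (ℕ.n∸n≡0 (dim V)) ⟩
      r₂ I₂.image[ V ] + 0                        ≡⟨ ℕ.+-identityʳ _ ⟩
      r₂ I₂.image[ V ]                            ∎)
    (D.ρ-≥ V λ X X⊆V → ℕ.+-cancelʳ-≤ (dim X) _ _ (begin
      r₂ I₂.image[ V ] + dim X                    ≤⟨ unitIncreasing-image (π₂ E₁ E₂) ui₂ {X} {V} X⊆V ⟩
      r₂ I₂.image[ X ] + dim V                    ≡⟨ ≡.cong₂ _+_ (s-≡ X) (ℕ.m∸n+n≡m (P.dim-mono {X} {V} X⊆V)) ⟨
      D.s X + (dim V ∸ dim X + dim X)             ≡⟨ ℕ.+-assoc (D.s X) _ _ ⟨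
      D.s X + (dim V ∸ dim X) + dim X             ∎))
    where
    s-≡ : ∀ X → D.s X ≡ r₂ I₂.image[ X ]
    s-≡ X = ≡.cong (_+ r₂ I₂.image[ X ]) (r₁≡0 I₁.image[ X ])

  -- The minimum is attained at V ∩ ker π₁.
  ρ-free⊕ : (∀ V → r₁ V ≡ E₁.dim V) → (∀ {V W} → Subspaces._⊆_ E₂ V W → r₂ V ≤ r₂ W) →
            ∀ V → D.ρ V ≡ E₁.dim I₁.image[ V ] + r₂ I₂.image[ V ∩ I₁.kernel ]
  ρ-free⊕ r₁≡dim mono₂ V = ℕ.≤-antisym upper (D.ρ-≥ V lower)
    where
    K : Subspace
    K = I₁.kernel

    s-≡ : ∀ X → D.s X ≡ E₁.dim I₁.image[ X ] + r₂ I₂.image[ X ]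
    s-≡ X = ≡.cong (_+ r₂ I₂.image[ X ]) (r₁≡dim I₁.image[ X ])

    dim-image-kernel : E₁.dim I₁.image[ V ∩ K ] ≡ 0
    dim-image-kernel = ≡.trans
      (P₁.dim-cong {I₁.image[ V ∩ K ]} {E₁.0ˢ}
        ( I₁.image-⊆ (V ∩ K) {E₁.0ˢ} (λ x x∈ → E₁.∈-0⁺ (I₁.∈-kernel⁻ (P.∩-⊆ʳ V K x x∈)))
        , P₁.0ˢ-⊆ I₁.image[ V ∩ K ]))
      P₁.dim-0ˢ

    r₁-cong : ∀ {X Y} → X E₁.≐ Y → r₁ X ≡ r₁ Y
    r₁-cong {X} {Y} X≐Y = ≡.trans (r₁≡dim X) (≡.trans (P₁.dim-cong {X} {Y} X≐Y) (≡.sym (r₁≡dim Y)))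

    upper : D.ρ V ≤ E₁.dim I₁.image[ V ] + r₂ I₂.image[ V ∩ K ]
    upper = begin
      D.ρ V                                                    ≤⟨ D.ρ-≤ r₁-cong (unitIncreasing⇒cong E₂ ui₂) {V ∩ K} {V} (P.∩-⊆ˡ V K) ⟩
      D.s (V ∩ K) + (dim V ∸ dim (V ∩ K))                      ≡⟨ ≡.cong₂ _+_
        (≡.trans (s-≡ (V ∩ K)) (≡.cong (_+ r₂ I₂.image[ V ∩ K ]) dim-image-kernel))
        (≡.trans (≡.cong (_∸ dim (V ∩ K)) (I₁.rank-nullity V)) (ℕ.m+n∸n≡m _ (dim (V ∩ K)))) ⟩
      r₂ I₂.image[ V ∩ K ] + E₁.dim I₁.image[ V ]              ≡⟨ ℕ.+-comm (r₂ I₂.image[ V ∩ K ]) _ ⟩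
      E₁.dim I₁.image[ V ] + r₂ I₂.image[ V ∩ K ]              ∎

    -- After adding dim X, rank-nullity for π₁ splits dim X and dim V. What remains is unit increase
    -- from X ∩ ker π₁ to V ∩ ker π₁, followed by monotonicity from X ∩ ker π₁ to X.
    lower : ∀ X → X ⊆ V → E₁.dim I₁.image[ V ] + r₂ I₂.image[ V ∩ K ] ≤ D.s X + (dim V ∸ dim X)
    lower X X⊆V = ℕ.+-cancelʳ-≤ (dim X) _ _ (begin
      dV + rV + dim X                  ≡⟨ ≡.cong (dV + rV +_) (I₁.rank-nullity X) ⟩
      dV + rV + (dX + kX)              ≡⟨ solve 4 (λ p q r s → p :+ q :+ (r :+ s) := (q :+ s) :+ (p :+ r)) ≡.refl dV rV dX kX ⟩
      (rV + kX) + (dV + dX)            ≤⟨ ℕ.+-monoˡ-≤ (dV + dX) (unitIncreasing-image (π₂ E₁ E₂) ui₂ {X ∩ K} {V ∩ K} (P.∩-monoˡ {X} {V} K X⊆V)) ⟩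
      (rX + kV) + (dV + dX)            ≤⟨ ℕ.+-monoˡ-≤ (dV + dX) (ℕ.+-monoˡ-≤ kV
                                            (mono₂ {I₂.image[ X ∩ K ]} {I₂.image[ X ]} (I₂.image-mono {X ∩ K} {X} (P.∩-⊆ˡ X K)))) ⟩
      (r + kV) + (dV + dX)             ≡⟨ solve 4 (λ p q r s → (p :+ q) :+ (r :+ s) := s :+ p :+ (r :+ q)) ≡.refl r kV dV dX ⟩
      dX + r + (dV + kV)               ≡⟨ ≡.cong₂ _+_ (s-≡ X) (I₁.rank-nullity V) ⟨
      D.s X + dim V                    ≡⟨ ≡.cong (D.s X +_) (ℕ.m∸n+n≡m (P.dim-mono {X} {V} X⊆V)) ⟨
      D.s X + (dim V ∸ dim X + dim X)  ≡⟨ ℕ.+-assoc (D.s X) _ _ ⟨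
      D.s X + (dim V ∸ dim X) + dim X  ∎)
      where
      dV = E₁.dim I₁.image[ V ]
      dX = E₁.dim I₁.image[ X ]
      kV = dim (V ∩ K)
      kX = dim (X ∩ K)
      rV = r₂ I₂.image[ V ∩ K ]
      rX = r₂ I₂.image[ X ∩ K ]
      r  = r₂ I₂.image[ X ]

-- Loops and splittings

module Loops {F : FiniteField c ℓ} (M : QMatroid F m ℓm) where
  open QMatroid M
  open VectorSpace space
  open SubspaceProperties space
  open QMatroidProperties M

  ρ-0ˢ : ρ 0ˢ ≡ 0
  ρ-0ˢ = ℕ.n≤0⇒n≡0 (≡.subst (ρ 0ˢ ≤_) dim-0ˢ (bounded 0ˢ))

  ρ-⊆-null : ∀ {V W} → V ⊆ W → ρ W ≡ 0 → ρ V ≡ 0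
  ρ-⊆-null {V} {W} V⊆W e = ℕ.n≤0⇒n≡0 (≡.subst (ρ V ≤_) e (monotone {V} {W} V⊆W))

  ρ-∑ˢ-null : ∀ {Vs} → All.All (λ V → ρ V ≡ 0) Vs → ρ (∑ˢ Vs) ≡ 0
  ρ-∑ˢ-null All.[]       = ρ-0ˢ
  ρ-∑ˢ-null {V ∷ Vs} (e All.∷ es) = ℕ.n≤0⇒n≡0
    (≡.subst₂ (λ x y → ρ (V +ˢ ∑ˢ Vs) ≤ x + y) e (ρ-∑ˢ-null es) (subadditive V (∑ˢ Vs)))

  ⊆-∑ˢ : ∀ {Vs V} → V List.∈ Vs → V ⊆ ∑ˢ Vs
  ⊆-∑ˢ {V ∷ Vs} (Any.here ≡.refl) = ⊆-+ˡ V (∑ˢ Vs)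
  ⊆-∑ˢ {W ∷ Vs} (Any.there V∈)    = λ x → ⊆-+ʳ W (∑ˢ Vs) x ∘ ⊆-∑ˢ V∈ x

  L : Subspace
  L = cl M 0ˢ

  private
    0+⟨⟩ : ∀ x → 0ˢ +ˢ ⟨ x ⟩ ≐ ⟨ x ⟩
    0+⟨⟩ x = +-⊆ 0ˢ ⟨ x ⟩ {⟨ x ⟩} (0ˢ-⊆ ⟨ x ⟩) (λ _ y∈ → y∈) , ⊆-+ʳ 0ˢ ⟨ x ⟩

    isLoop? = λ x → ρ (0ˢ +ˢ ⟨ x ⟩) ℕ.≟ ρ 0ˢ
    loops = filter isLoop? vectorList

  -- cl(0) is a finite sum of lines of rank 0, and subadditivity keeps the rank of the sum at 0.
  ρ-L : ρ L ≡ 0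
  ρ-L = ρ-∑ˢ-null (All.map⁺ (All.tabulate {xs = loops} λ {x} x∈ → ≡.trans
    (≡.sym (ρ-cong {0ˢ +ˢ ⟨ x ⟩} {⟨ x ⟩} (0+⟨⟩ x)))
    (≡.trans (proj₂ (∈-filter⁻ isLoop? {xs = vectorList} x∈)) ρ-0ˢ)))

  ∈-L⁻ : ∀ {x} → x ∈ L → ρ ⟨ x ⟩ ≡ 0
  ∈-L⁻ {x} x∈L = ρ-⊆-null {⟨ x ⟩} {L} (⟨x⟩⊆ L x∈L) ρ-L

  ∈-L⁺ : ∀ {x} → ρ ⟨ x ⟩ ≡ 0 → x ∈ L
  ∈-L⁺ {x} e = Subspace.resp L (≈ᴹ-sym x≈y) (⊆-∑ˢ (∈-map⁺ ⟨_⟩ y∈loops) y (x∈⟨x⟩ y))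
    where
    found = find (vectorList-enumeration x)
    y = proj₁ found
    x≈y : x ≈ᴹ y
    x≈y = proj₂ (proj₂ found)
    y∈loops : y List.∈ loops
    y∈loops = ∈-filter⁺ isLoop? (proj₁ (proj₂ found)) (≡.trans
      (ρ-cong {0ˢ +ˢ ⟨ y ⟩} {⟨ y ⟩} (0+⟨⟩ y)) (≡.trans
      (ρ-⊆-null {⟨ y ⟩} {⟨ x ⟩} (⟨x⟩⊆ ⟨ x ⟩ (Subspace.resp ⟨ x ⟩ x≈y (x∈⟨x⟩ x))) e) (≡.sym ρ-0ˢ)))

  C : Subspace
  C = cyc M whole

  ∈-C⁻ : ∀ {x} W → x ∈ C → W +ˢ ⟨ x ⟩ ≐ whole → ρ W ≡ ρ whole
  ∈-C⁻ W x∈C e = proj₂ (∈-cyc⁻ M {whole} x∈C) W (⊆-whole W , e)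

  ∈-C⁺ : ∀ {x} → (∀ W → W +ˢ ⟨ x ⟩ ≐ whole → ρ W ≡ ρ whole) → x ∈ C
  ∈-C⁺ f = ∈-cyc⁺ M {whole} (∈-whole , λ W (_ , e) → f W e)

module _ {F : FiniteField c ℓ} {N : QMatroid F m ℓm} (full : Full N) where
  open QMatroid N
  open VectorSpace space
  open Loops N

  full⇒loopless : ∀ {x} → ρ ⟨ x ⟩ ≡ 0 → x ≈ᴹ 0ᴹ
  full⇒loopless e = ∈-0⁻ (proj₁ (proj₁ full) _ (∈-L⁺ e))

  full⇒cyclic : ∀ {x} W → W +ˢ ⟨ x ⟩ ≐ whole → ρ W ≡ ρ whole
  full⇒cyclic {x} W = ∈-C⁻ W (proj₂ (proj₂ full) x ∈-whole)

module _ {F : FiniteField c ℓ} {E : VectorSpace F m ℓm} {E′ : VectorSpace F n ℓn} {E″ : VectorSpace F o ℓo}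
         (h : E ⟶ E′) (g : E′ ⟶ E″) (f : E ⟶ E″) where
  private
    module E′ = VectorSpace E′
    module E″ = VectorSpace E″
    module S  = Subspaces E
    module S′ = Subspaces E′
    module S″ = Subspaces E″
    module If = LinearMapProperties f
    module Ig = LinearMapProperties g
    module Ih = LinearMapProperties h

  image-image : (∀ x → f · x E″.≈ᴹ g · h · x) → ∀ V → Ig.image[ Ih.image[ V ] ] S″.≐ If.image[ V ]
  image-image f≈gh V =
    Ig.image-⊆ Ih.image[ V ] {If.image[ V ]} (λ y y∈ → let (x , x∈V , y≈hx) = Ih.image⁻ V y∈ in
      S″.Subspace.resp If.image[ V ]
        (E″.≈ᴹ-trans (f≈gh x) (_⟶_.⟦⟧-cong g (E′.≈ᴹ-sym y≈hx))) (If.image⁺ V x∈V)) ,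
    If.image-⊆ V {Ig.image[ Ih.image[ V ] ]} (λ x x∈V →
      S″.Subspace.resp Ig.image[ Ih.image[ V ] ] (E″.≈ᴹ-sym (f≈gh x))
        (Ig.image⁺ Ih.image[ V ] (Ih.image⁺ V x∈V)))

module _ {F : FiniteField c ℓ} {E : VectorSpace F m ℓm} {E′ : VectorSpace F n ℓn} {E″ : VectorSpace F o ℓo}
         (h : E ⟶ E′) (g : E′ ⟶ E″) (f : E ⟶ E″) where
  private
    module E′ = VectorSpace E′
    module E″ = VectorSpace E″
    module S  = Subspaces E
    module S′ = Subspaces E′
    module If = LinearMapProperties f
    module Ig = LinearMapProperties g
    module Ih = LinearMapProperties h

  image-∩-kernel : (∀ x → f · x E″.≈ᴹ g · h · x) → ∀ V →
                   Ih.image[ V ] S′.∩ Ig.kernel S′.≐ Ih.image[ V S.∩ If.kernel ]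
  image-∩-kernel f≈gh V =
    (λ y y∈ → let (y∈hV , y∈ker) = S′.∈-∩⁻ {Ih.image[ V ]} {Ig.kernel} y∈
                  (x , x∈V , y≈hx) = Ih.image⁻ V y∈hV in
      S′.Subspace.resp Ih.image[ V S.∩ If.kernel ] (E′.≈ᴹ-sym y≈hx)
        (Ih.image⁺ (V S.∩ If.kernel) (S.∈-∩⁺ {V} {If.kernel} (x∈V , If.∈-kernel⁺
          (E″.≈ᴹ-trans (f≈gh x) (E″.≈ᴹ-trans (_⟶_.⟦⟧-cong g (E′.≈ᴹ-sym y≈hx)) (Ig.∈-kernel⁻ y∈ker))))))) ,
    Ih.image-⊆ (V S.∩ If.kernel) {Ih.image[ V ] S′.∩ Ig.kernel} (λ x x∈ →
      let (x∈V , x∈ker) = S.∈-∩⁻ {V} {If.kernel} x∈ in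
      S′.∈-∩⁺ {Ih.image[ V ]} {Ig.kernel} (Ih.image⁺ V x∈V ,
        Ig.∈-kernel⁺ (E″.≈ᴹ-trans (E″.≈ᴹ-sym (f≈gh x)) (If.∈-kernel⁻ x∈ker))))

module _ {F : FiniteField c ℓ} {E : VectorSpace F m ℓm} (ρ : Subspaces.Subspace E → ℕ)
         (A : VectorSpace F n ℓn) (B : VectorSpace F o ℓo) {G : VectorSpace F p ℓp} (ρ′ : Subspaces.Subspace G → ℕ) where
  private
    module E  = VectorSpace E
    module A  = VectorSpace A
    module B  = VectorSpace B
    module G  = VectorSpace G
    module SE = Subspaces E
    module SB = Subspaces B
    module SG = Subspaces G

  -- A decomposition read from E through its three coordinate maps. The rank formula is what
  -- `ρ-null⊕` and `ρ-free⊕` leave of the two nested minima; A, all of whose vectors are loops,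
  -- enters through joint bijectivity.
  record Splitting : Set (c ⊔ ℓ ⊔ m ⊔ ℓm ⊔ n ⊔ ℓn ⊔ o ⊔ ℓo ⊔ p ⊔ ℓp) where
    field
      α : E ⟶ A
      β : E ⟶ B
      γ : E ⟶ G
      injective  : ∀ x → α · x A.≈ᴹ A.0ᴹ → β · x B.≈ᴹ B.0ᴹ → γ · x G.≈ᴹ G.0ᴹ → x E.≈ᴹ E.0ᴹ
      surjective : ∀ u v w → ∃ λ x → α · x A.≈ᴹ u × β · x B.≈ᴹ v × γ · x G.≈ᴹ w
    module α = LinearMapProperties α
    module β = LinearMapProperties β
    module γ = LinearMapProperties γ
    field
      rank : ∀ V → ρ V ≡ SB.dim β.image[ V ] + ρ′ γ.image[ V SE.∩ β.kernel ]

  module _ {r₁ : Subspaces.Subspace A → ℕ} {r₂ : SB.Subspace → ℕ}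
           (r₁≡0 : ∀ V → r₁ V ≡ 0) (r₂≡dim : ∀ V → r₂ V ≡ SB.dim V)
           (ui : UnitIncreasing G ρ′) (mono : ∀ {V W} → V SG.⊆ W → ρ′ V ≤ ρ′ W) where
    private
      module D₂ = DirectSum r₂ ρ′
      module D₁ = DirectSum r₁ D₂.ρ
      module BG = Subspaces (B ⊕ᵛ G)

      -- Unit increase of the inner sum is what `ρ-null⊕` asks of the second summand of the outer
      -- one.
      ui₂ : UnitIncreasing (B ⊕ᵛ G) D₂.ρ
      ui₂ {X} {V} = D₂.⊕-unitIncreasing
        (λ {V} {W} e → ≡.trans (r₂≡dim V) (≡.trans (SubspaceProperties.dim-cong B {V} {W} e) (≡.sym (r₂≡dim W))))
        (unitIncreasing⇒cong G ui) {X} {V}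

      module _ (φ : E ⟶ A ⊕ᵛ (B ⊕ᵛ G)) (ψ : E ⟶ B ⊕ᵛ G) (β : E ⟶ B) (γ : E ⟶ G)
               (ψ-≈ : ∀ x → VectorSpace._≈ᴹ_ (B ⊕ᵛ G) (ψ · x) (proj₂ (φ · x)))
               (β-≈ : ∀ x → β · x B.≈ᴹ proj₁ (ψ · x)) (γ-≈ : ∀ x → γ · x G.≈ᴹ proj₂ (ψ · x)) where
        module Iφ = LinearMapProperties φ
        module Iψ = LinearMapProperties ψ
        module Iβ = LinearMapProperties β
        module Iγ = LinearMapProperties γ
        module I₁ = LinearMapProperties (π₁ B G)
        module I₂ = LinearMapProperties (π₂ B G)
        module J₂ = LinearMapProperties (π₂ A (B ⊕ᵛ G))

        -- The null summand drops out first; `ρ-free⊕` then evaluates the sum of the other two. Both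
        -- directions between equivalences and splittings rest on this computation.
        ρ-image : ∀ V → D₁.ρ Iφ.image[ V ] ≡ SB.dim Iβ.image[ V ] + ρ′ Iγ.image[ V SE.∩ Iβ.kernel ]
        ρ-image V = begin
          D₁.ρ Iφ.image[ V ]
            ≡⟨ ρ-null⊕ {E₁ = A} {E₂ = B ⊕ᵛ G} {r₁ = r₁} {r₂ = D₂.ρ} ui₂ r₁≡0 Iφ.image[ V ] ⟩
          D₂.ρ J₂.image[ Iφ.image[ V ] ]
            ≡⟨ unitIncreasing⇒cong (B ⊕ᵛ G) {D₂.ρ} ui₂ {J₂.image[ Iφ.image[ V ] ]} {Iψ.image[ V ]}
                 (image-image φ (π₂ A (B ⊕ᵛ G)) ψ ψ-≈ V) ⟩
          D₂.ρ Iψ.image[ V ]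
            ≡⟨ ρ-free⊕ {E₁ = B} {E₂ = G} {r₁ = r₂} {r₂ = ρ′} ui r₂≡dim mono Iψ.image[ V ] ⟩
          SB.dim I₁.image[ Iψ.image[ V ] ] + ρ′ I₂.image[ Iψ.image[ V ] BG.∩ I₁.kernel ]
            ≡⟨ ≡.cong₂ _+_
              (SubspaceProperties.dim-cong B {I₁.image[ Iψ.image[ V ] ]} {Iβ.image[ V ]} (image-image ψ (π₁ B G) β β-≈ V))
              (≡.trans (ρ′-cong {I₂.image[ Iψ.image[ V ] BG.∩ I₁.kernel ]} {I₂.image[ Iψ.image[ V SE.∩ Iβ.kernel ] ]}
                (I₂.image-cong {Iψ.image[ V ] BG.∩ I₁.kernel} {Iψ.image[ V SE.∩ Iβ.kernel ]} (image-∩-kernel ψ (π₁ B G) β β-≈ V)))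
                (ρ′-cong {I₂.image[ Iψ.image[ V SE.∩ Iβ.kernel ] ]} {Iγ.image[ V SE.∩ Iβ.kernel ]}
                  (image-image ψ (π₂ B G) γ γ-≈ (V SE.∩ Iβ.kernel)))) ⟩
          SB.dim Iβ.image[ V ] + ρ′ Iγ.image[ V SE.∩ Iβ.kernel ] ∎
          where
          open ≡-Reasoning
          ρ′-cong : ∀ {V W} → V SG.≐ W → ρ′ V ≡ ρ′ W
          ρ′-cong = unitIncreasing⇒cong G {ρ′} ui

    sum : RawQMatroid F (n ⊔ o ⊔ p) (ℓn ⊔ ℓo ⊔ ℓp)
    sum = record { space = A ⊕ᵛ (B ⊕ᵛ G) ; ρ = D₁.ρ }

    ≅⇒splitting : record { space = E ; ρ = ρ } ≅ sum → Splitting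
    ≅⇒splitting iso = record
      { α = π₁ A (B ⊕ᵛ G) ⊚ φ
      ; β = β
      ; γ = γ
      ; injective = λ x e e′ e″ → I.injective {x} {E.0ᴹ} (VectorSpace.≈ᴹ-trans (A ⊕ᵛ (B ⊕ᵛ G)) (e , e′ , e″)
          (VectorSpace.≈ᴹ-sym (A ⊕ᵛ (B ⊕ᵛ G)) I.0ᴹ-homo))
      ; surjective = λ u v w → let (x , f) = I.surjective (u , v , w) ; (e , e′ , e″) = f E.≈ᴹ-refl in x , e , e′ , e″
      ; rank = λ V → ≡.trans (≡.sym (I.ρ-preserving V))
          (ρ-image φ ψ β γ (λ _ → VectorSpace.≈ᴹ-refl (B ⊕ᵛ G)) (λ _ → B.≈ᴹ-refl) (λ _ → G.≈ᴹ-refl) V)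
      }
      where
      module I = _≅_ iso
      φ : E ⟶ A ⊕ᵛ (B ⊕ᵛ G)
      φ = record { to = I.to ; isHomomorphism = I.isLeftModuleHomomorphism }
      ψ : E ⟶ B ⊕ᵛ G
      ψ = π₂ A (B ⊕ᵛ G) ⊚ φ
      β : E ⟶ B
      β = π₁ B G ⊚ ψ
      γ : E ⟶ G
      γ = π₂ B G ⊚ ψ

    splitting⇒≅ : Splitting → record { space = E ; ρ = ρ } ≅ sum
    splitting⇒≅ S = record
      { to = φ ·_
      ; isIsomorphism = record
        { isLeftModuleMonomorphism = record
          { isLeftModuleHomomorphism = _⟶_.isHomomorphism φ
          ; injective = λ {x} {y} e → CE.x-y≈0⇒x≈y (injective _
              (α.∈-kernel⁻ (α.kernel-- (proj₁ e))) (β.∈-kernel⁻ (β.kernel-- (proj₁ (proj₂ e))))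
              (γ.∈-kernel⁻ (γ.kernel-- (proj₂ (proj₂ e)))))
          }
        ; surjective = λ (u , v , w) → let (x , e , e′ , e″) = surjective u v w in
            x , λ z≈x → VectorSpace.≈ᴹ-trans (A ⊕ᵛ (B ⊕ᵛ G)) (_⟶_.⟦⟧-cong φ z≈x) (e , e′ , e″)
        }
      ; ρ-preserving = λ V → ≡.trans
          (ρ-image φ ψ β γ (λ _ → VectorSpace.≈ᴹ-refl (B ⊕ᵛ G)) (λ _ → B.≈ᴹ-refl) (λ _ → G.≈ᴹ-refl) V)
          (≡.sym (rank V))
      }
      where
      open Splitting S
      module CE = Combinations F E.leftModule
      module a = _⟶_ α
      module b = _⟶_ β
      module g = _⟶_ γ
      ψ : E ⟶ B ⊕ᵛ G
      ψ = linear E (B ⊕ᵛ G) (λ x → β · x , γ · x) (λ e → b.⟦⟧-cong e , g.⟦⟧-cong e)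
        (λ x y → b.+ᴹ-homo x y , g.+ᴹ-homo x y) (λ k x → b.*ₗ-homo k x , g.*ₗ-homo k x)
      φ : E ⟶ A ⊕ᵛ (B ⊕ᵛ G)
      φ = linear E (A ⊕ᵛ (B ⊕ᵛ G)) (λ x → α · x , ψ · x) (λ e → a.⟦⟧-cong e , _⟶_.⟦⟧-cong ψ e)
        (λ x y → a.+ᴹ-homo x y , _⟶_.+ᴹ-homo ψ x y) (λ k x → a.*ₗ-homo k x , _⟶_.*ₗ-homo ψ k x)

-- Uniqueness

module _ {F : FiniteField c ℓ} (M : QMatroid F m ℓm) (C L : QMatroid.Subspace M) (N : QMatroid F n ℓn) where
  private
    module M = QMatroid M
    module N = QMatroid N
    module E = VectorSpace M.space
    module G = VectorSpace N.space

  -- The restriction of γ to C has kernel L, is onto and preserves rank, so it identifies C/L with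
  -- the ground space of N. Outside C the values of γ depend on the chosen complements.
  record CoreMap : Set (c ⊔ ℓ ⊔ m ⊔ ℓm ⊔ n ⊔ ℓn) where
    field
      γ        : M.space ⟶ N.space
      onto     : ∀ g → ∃ λ x → x M.∈ C × γ · x G.≈ᴹ g
      null     : ∀ {x} → x M.∈ C → x M.∈ L → γ · x G.≈ᴹ G.0ᴹ
      faithful : ∀ {x} → x M.∈ C → γ · x G.≈ᴹ G.0ᴹ → x M.∈ L
    module γ = LinearMapProperties γ
    field
      rank     : ∀ V → V M.⊆ C → N.ρ γ.image[ V ] ≡ M.ρ V

module _ {F : FiniteField c ℓ} (M : QMatroid F m ℓm) (C L : QMatroid.Subspace M)
         (N : QMatroid F n ℓn) (N′ : QMatroid F o ℓo)
         (Γ : CoreMap M C L N) (Γ′ : CoreMap M C L N′) where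
  private
    module M  = QMatroid M
    module N  = QMatroid N
    module N′ = QMatroid N′
    module E  = VectorSpace M.space
    module G  = VectorSpace N.space
    module G′ = VectorSpace N′.space
    module Γ  = CoreMap Γ
    module Γ′ = CoreMap Γ′
    module g  = _⟶_ Γ.γ
    module g′ = _⟶_ Γ′.γ
    module CE = Combinations F E.leftModule
    module P  = SubspaceProperties M.space

    lift : G.Carrierᴹ → E.Carrierᴹ
    lift y = proj₁ (Γ.onto y)
    lift∈ : ∀ y → lift y M.∈ C
    lift∈ y = proj₁ (proj₂ (Γ.onto y))
    γ-lift : ∀ y → Γ.γ · lift y G.≈ᴹ y
    γ-lift y = proj₂ (proj₂ (Γ.onto y))

    -- The difference x - y lies in C and is killed by γ, so it lies in L, which γ′ kills as well.
    -- This makes `φ` well defined and linear although `lift` is an arbitrary choice.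
    transport : ∀ {x y} → x M.∈ C → y M.∈ C → Γ.γ · x G.≈ᴹ Γ.γ · y → Γ′.γ · x G′.≈ᴹ Γ′.γ · y
    transport x∈C y∈C e = Γ′.γ.kernel--⁻ (Γ′.γ.∈-kernel⁺ (Γ′.null x-y∈C
      (Γ.faithful x-y∈C (Γ.γ.∈-kernel⁻ (Γ.γ.kernel-- e)))))
      where x-y∈C = P.-‿closed C x∈C y∈C

    transport⁻ : ∀ {x y} → x M.∈ C → y M.∈ C → Γ′.γ · x G′.≈ᴹ Γ′.γ · y → Γ.γ · x G.≈ᴹ Γ.γ · y
    transport⁻ x∈C y∈C e = Γ.γ.kernel--⁻ (Γ.γ.∈-kernel⁺ (Γ.null x-y∈C
      (Γ′.faithful x-y∈C (Γ′.γ.∈-kernel⁻ (Γ′.γ.kernel-- e)))))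
      where x-y∈C = P.-‿closed C x∈C y∈C

    -- Both γ and γ′ identify C/L with their targets.
    φ : N.space ⟶ N′.space
    φ = linear N.space N′.space (λ y → Γ′.γ · lift y)
      (λ {x} {y} x≈y → transport (lift∈ x) (lift∈ y)
        (G.≈ᴹ-trans (γ-lift x) (G.≈ᴹ-trans x≈y (G.≈ᴹ-sym (γ-lift y)))))
      (λ x y → G′.≈ᴹ-trans
        (transport (lift∈ (x G.+ᴹ y)) (M.Subspace.+-closed C (lift∈ x) (lift∈ y))
          (G.≈ᴹ-trans (γ-lift _) (G.≈ᴹ-sym (G.≈ᴹ-trans (g.+ᴹ-homo _ _) (G.+ᴹ-cong (γ-lift x) (γ-lift y))))))
        (g′.+ᴹ-homo _ _))
      (λ k x → G′.≈ᴹ-trans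
        (transport (lift∈ (k G.*ₗ x)) (M.Subspace.*-closed C k (lift∈ x))
          (G.≈ᴹ-trans (γ-lift _) (G.≈ᴹ-sym (G.≈ᴹ-trans (g.*ₗ-homo _ _) (G.*ₗ-cong (FiniteField.refl F) (γ-lift x))))))
        (g′.*ₗ-homo _ _))

    φ-γ : ∀ {x} → x M.∈ C → φ · Γ.γ · x G′.≈ᴹ Γ′.γ · x
    φ-γ {x} x∈C = transport (lift∈ (Γ.γ · x)) x∈C (γ-lift (Γ.γ · x))

    module φ = LinearMapProperties φ

    -- The subspace γ⁻¹(V) ∩ C is mapped onto V by γ and onto φ(V) by γ′, and both maps preserve its
    -- rank.
    ρ-φ : ∀ V → N′.ρ φ.image[ V ] ≡ N.ρ V
    ρ-φ V = begin
      N′.ρ φ.image[ V ]      ≡⟨ N′.ρ-cong {φ.image[ V ]} {Γ′.γ.image[ U ]} (φV⊆ , ⊆φV) ⟩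
      N′.ρ Γ′.γ.image[ U ]   ≡⟨ Γ′.rank U U⊆C ⟩
      M.ρ U                  ≡⟨ Γ.rank U U⊆C ⟨
      N.ρ Γ.γ.image[ U ]     ≡⟨ N.ρ-cong {Γ.γ.image[ U ]} {V} (γU⊆ , ⊆γU) ⟩
      N.ρ V                  ∎
      where
      open ≡-Reasoning
      U : M.Subspace
      U = Γ.γ.preimage V M.∩ C
      U⊆C : U M.⊆ C
      U⊆C = P.∩-⊆ʳ (Γ.γ.preimage V) C
      U⊆γ⁻¹V : U M.⊆ Γ.γ.preimage V
      U⊆γ⁻¹V = P.∩-⊆ˡ (Γ.γ.preimage V) C
      lift∈U : ∀ {y} → y N.∈ V → lift y M.∈ U
      lift∈U {y} y∈V = M.∈-∩⁺ {Γ.γ.preimage V} {C}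
        (Γ.γ.∈-preimage⁺ V (N.Subspace.resp V (G.≈ᴹ-sym (γ-lift y)) y∈V) , lift∈ y)
      γU⊆ : Γ.γ.image[ U ] N.⊆ V
      γU⊆ = Γ.γ.image-⊆ U {V} λ x x∈U → Γ.γ.∈-preimage⁻ V (U⊆γ⁻¹V x x∈U)
      ⊆γU : V N.⊆ Γ.γ.image[ U ]
      ⊆γU y y∈V = N.Subspace.resp Γ.γ.image[ U ] (γ-lift y) (Γ.γ.image⁺ U (lift∈U y∈V))
      φV⊆ : φ.image[ V ] N′.⊆ Γ′.γ.image[ U ]
      φV⊆ = φ.image-⊆ V {Γ′.γ.image[ U ]} λ y y∈V → Γ′.γ.image⁺ U (lift∈U y∈V)
      ⊆φV : Γ′.γ.image[ U ] N′.⊆ φ.image[ V ]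
      ⊆φV = Γ′.γ.image-⊆ U {φ.image[ V ]} λ x x∈U →
        N′.Subspace.resp φ.image[ V ] (φ-γ (U⊆C x x∈U))
          (φ.image⁺ V (Γ.γ.∈-preimage⁻ V (U⊆γ⁻¹V x x∈U)))

  coreMap-unique : N.raw ≅ N′.raw
  coreMap-unique = record
    { to = φ ·_
    ; isIsomorphism = record
      { isLeftModuleMonomorphism = record
        { isLeftModuleHomomorphism = _⟶_.isHomomorphism φ
        ; injective = λ {x} {y} e → G.≈ᴹ-trans (G.≈ᴹ-sym (γ-lift x))
            (G.≈ᴹ-trans (transport⁻ (lift∈ x) (lift∈ y) e) (γ-lift y))
        }
      ; surjective = λ y → let (x , x∈C , e) = Γ′.onto y in
          Γ.γ · x , λ z≈γx → G′.≈ᴹ-trans (_⟶_.⟦⟧-cong φ z≈γx) (G′.≈ᴹ-trans (φ-γ x∈C) e)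
      }
    ; ρ-preserving = ρ-φ
    }

module SplittingProperties {F : FiniteField c ℓ} (M : QMatroid F m ℓm) (N : QMatroid F n ℓn)
         {A : VectorSpace F o ℓo} {B : VectorSpace F p ℓp}
         (S : Splitting (QMatroid.ρ M) A B (QMatroid.ρ N)) (full : Full N) where
  private
    module M = QMatroid M
    module N = QMatroid N
    module E = VectorSpace M.space
    module G = VectorSpace N.space
    module A = VectorSpace A
    module B = VectorSpace B
    module SA = Subspaces A
    module SB = Subspaces B
    module P  = SubspaceProperties M.space
    module PN = SubspaceProperties N.space
    module PB = SubspaceProperties B
  open Splitting S
  open Loops M using (L; C; ∈-L⁺; ∈-L⁻; ∈-C⁺; ∈-C⁻)
  open M

  private
    β-null : ∀ {V} → V ⊆ β.kernel → SB.dim β.image[ V ] ≡ 0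
    β-null {V} V⊆ = SubspaceProperties.⊆0⇒dim≡0 B β.image[ V ] λ y y∈ →
      let (x , x∈V , e) = β.image⁻ V y∈ in B.≈ᴹ-trans e (β.∈-kernel⁻ (V⊆ x x∈V))

    ρ-kernel : ∀ {V} → V ⊆ β.kernel → N.ρ γ.image[ V ] ≡ ρ V
    ρ-kernel {V} V⊆ = ≡.sym (≡.trans (rank V) (≡.cong₂ _+_ (β-null {V} V⊆)
      (N.ρ-cong {γ.image[ V ∩ β.kernel ]} {γ.image[ V ]} (γ.image-cong {V ∩ β.kernel} {V}
        (P.∩-⊆ˡ V β.kernel , λ x x∈V → ∈-∩⁺ {V} {β.kernel} (x∈V , V⊆ x x∈V))))))

  -- Both terms of the rank formula for ⟨x⟩ are nonnegative, so dim β⟨x⟩ = 0.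
  ∈-L⇒β≈0 : ∀ {x} → x ∈ L → β · x B.≈ᴹ B.0ᴹ
  ∈-L⇒β≈0 {x} x∈L = SubspaceProperties.dim≡0⇒≈0 B β.image[ ⟨ x ⟩ ]
    (ℕ.m+n≡0⇒m≡0 _ (≡.trans (≡.sym (rank ⟨ x ⟩)) (∈-L⁻ x∈L))) (β.image⁺ ⟨ x ⟩ (x∈⟨x⟩ x))

  private
    ρ-⟨γ⟩ : ∀ {x} → β · x B.≈ᴹ B.0ᴹ → N.ρ N.⟨ γ · x ⟩ ≡ ρ ⟨ x ⟩
    ρ-⟨γ⟩ {x} e = ≡.trans (N.ρ-cong {N.⟨ γ · x ⟩} {γ.image[ ⟨ x ⟩ ]} (proj₂ γx , proj₁ γx))
      (ρ-kernel {⟨ x ⟩} (⟨x⟩⊆ β.kernel (β.∈-kernel⁺ e)))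
      where γx = γ.image-⟨⟩ x

  -- A loop lies in ker β, where γ preserves ranks, so γ x spans a line of rank 0 in the full N.
  ∈-L⇒γ≈0 : ∀ {x} → x ∈ L → γ · x G.≈ᴹ G.0ᴹ
  ∈-L⇒γ≈0 {x} x∈L = full⇒loopless {N = N} full (≡.trans (ρ-⟨γ⟩ (∈-L⇒β≈0 x∈L)) (∈-L⁻ x∈L))

  β≈0∧γ≈0⇒∈-L : ∀ {x} → β · x B.≈ᴹ B.0ᴹ → γ · x G.≈ᴹ G.0ᴹ → x ∈ L
  β≈0∧γ≈0⇒∈-L {x} βx≈0 γx≈0 = ∈-L⁺ (≡.trans (≡.sym (ρ-⟨γ⟩ βx≈0))
    (Loops.ρ-⊆-null N {N.⟨ γ · x ⟩} {N.0ˢ} (N.⟨x⟩⊆ N.0ˢ (N.∈-0⁺ γx≈0)) (Loops.ρ-0ˢ N)))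

  -- If β x ≠ 0, a hyperplane W ≥ ker β avoids x. The second term of the rank formula is the same
  -- for W and E, so x ∈ C would force dim β(W) = dim β(E), and then dim W = dim E by rank-nullity.
  C⊆kernel : C ⊆ β.kernel
  C⊆kernel x x∈C with x ∈? β.kernel
  ... | yes x∈ = x∈
  ... | no x∉ = contradiction dim-eq (λ e → ℕ.1+n≢n (≡.trans
          (≡.sym (P.dim-+⟨⟩ {W} {whole} (P.⊆-whole W) ∈-whole x∉W (proj₂ W+x))) (≡.sym e)))
    where
    H = P.hyperplane β.kernel x∉
    W = proj₁ H
    K⊆W : β.kernel ⊆ W
    K⊆W = proj₁ (proj₂ H)
    x∉W : ¬ (x ∈ W)
    x∉W = proj₁ (proj₂ (proj₂ H))
    W+x : W +ˢ ⟨ x ⟩ ≐ whole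
    W+x = proj₂ (proj₂ (proj₂ H))
    same-kernel : W ∩ β.kernel ≐ whole ∩ β.kernel
    same-kernel = P.∩-monoˡ {W} {whole} β.kernel (P.⊆-whole W) ,
      λ y y∈ → let y∈K = P.∩-⊆ʳ whole β.kernel y y∈ in ∈-∩⁺ {W} {β.kernel} (K⊆W y y∈K , y∈K)
    dim-β-eq : SB.dim β.image[ W ] ≡ SB.dim β.image[ whole ]
    dim-β-eq = ℕ.+-cancelʳ-≡ (N.ρ γ.image[ whole ∩ β.kernel ]) _ _ (begin
      SB.dim β.image[ W ] + N.ρ γ.image[ whole ∩ β.kernel ]
        ≡⟨ ≡.cong (SB.dim β.image[ W ] +_) (N.ρ-cong {γ.image[ W ∩ β.kernel ]} {γ.image[ whole ∩ β.kernel ]}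
             (γ.image-cong {W ∩ β.kernel} {whole ∩ β.kernel} same-kernel)) ⟨
      SB.dim β.image[ W ] + N.ρ γ.image[ W ∩ β.kernel ]           ≡⟨ rank W ⟨
      ρ W                                                         ≡⟨ ∈-C⁻ W x∈C W+x ⟩
      ρ whole                                                     ≡⟨ rank whole ⟩
      SB.dim β.image[ whole ] + N.ρ γ.image[ whole ∩ β.kernel ]   ∎)
      where open ≡-Reasoning
    dim-eq : dim W ≡ dim whole
    dim-eq = ≡.trans (β.rank-nullity W) (≡.trans
      (≡.cong₂ _+_ dim-β-eq (P.dim-cong {W ∩ β.kernel} {whole ∩ β.kernel} same-kernel))
      (≡.sym (β.rank-nullity whole)))

  private
    γ-kernel-onto : ∀ g → ∃ λ x → x ∈ β.kernel × γ · x G.≈ᴹ g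
    γ-kernel-onto g = let (x , _ , e , e′) = surjective A.0ᴹ B.0ᴹ g in x , β.∈-kernel⁺ e , e′

  -- Let β x = 0 and W + ⟨x⟩ = E. Then β(W) = β(E), and γ(W ∩ ker β) + ⟨γ x⟩ is the whole space of
  -- N, so fullness of N shows that the second term of the rank formula is unchanged too.
  kernel⊆C : β.kernel ⊆ C
  kernel⊆C x x∈K = ∈-C⁺ λ W W+x → begin
      ρ W                                                         ≡⟨ rank W ⟩
      SB.dim β.image[ W ] + N.ρ γ.image[ W ∩ β.kernel ]
        ≡⟨ ≡.cong₂ _+_ (PB.dim-cong {β.image[ W ]} {β.image[ whole ]} (βW≐ W W+x)) (γW W W+x) ⟩
      SB.dim β.image[ whole ] + N.ρ γ.image[ whole ∩ β.kernel ]   ≡⟨ rank whole ⟨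
      ρ whole                                                     ∎
    where
    open ≡-Reasoning
    K = β.kernel
    module b = _⟶_ β
    module g = _⟶_ γ

    ⟨x⟩⊆K : ⟨ x ⟩ ⊆ K
    ⟨x⟩⊆K = ⟨x⟩⊆ K x∈K

    βW≐ : ∀ W → W +ˢ ⟨ x ⟩ ≐ whole → β.image[ W ] SB.≐ β.image[ whole ]
    βW≐ W (_ , whole⊆) = β.image-mono {W} {whole} (P.⊆-whole W) , β.image-⊆ whole {β.image[ W ]} λ y y∈ →
      let (w , w∈W , z , z∈x , e) = ∈-+⁻ {W} {⟨ x ⟩} (whole⊆ y y∈) in
      SB.Subspace.resp β.image[ W ]
        (B.≈ᴹ-sym (B.≈ᴹ-trans (b.⟦⟧-cong e) (B.≈ᴹ-trans (b.+ᴹ-homo w z)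
          (B.≈ᴹ-trans (B.+ᴹ-congˡ (β.∈-kernel⁻ (⟨x⟩⊆K z z∈x))) (B.+ᴹ-identityʳ _)))))
        (β.image⁺ W w∈W)

    γ-whole : N.ρ γ.image[ whole ∩ K ] ≡ N.ρ N.whole
    γ-whole = N.ρ-cong {γ.image[ whole ∩ K ]} {N.whole}
      (PN.⊆-whole γ.image[ whole ∩ K ] , λ g _ → let (y , y∈K , e) = γ-kernel-onto g in
        N.Subspace.resp γ.image[ whole ∩ K ] e
          (γ.image⁺ (whole ∩ K) (∈-∩⁺ {whole} {K} (∈-whole , y∈K))))

    γW+x : ∀ W → W +ˢ ⟨ x ⟩ ≐ whole → γ.image[ W ∩ K ] N.+ˢ N.⟨ γ · x ⟩ N.≐ N.whole
    γW+x W (_ , whole⊆) = PN.⊆-whole U , λ g _ →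
      let (y , y∈K , e) = γ-kernel-onto g
          (w , w∈W , z , z∈x , e′) = ∈-+⁻ {W} {⟨ x ⟩} (whole⊆ y ∈-whole)
          -- Modular law: y and z lie in ker β, hence so does w, the part of y in W.
          w∈K = P.+-cancelʳ-∈ K (⟨x⟩⊆K z z∈x) (Subspace.resp K e′ y∈K)
      in N.Subspace.resp U
        (G.≈ᴹ-sym (G.≈ᴹ-trans (G.≈ᴹ-sym e) (G.≈ᴹ-trans (g.⟦⟧-cong e′) (g.+ᴹ-homo w z))))
        (PN.+-intro γ.image[ W ∩ K ] N.⟨ γ · x ⟩
          (γ.image⁺ (W ∩ K) (∈-∩⁺ {W} {K} (w∈W , w∈K)))
          (proj₁ (γ.image-⟨⟩ x) _ (γ.image⁺ ⟨ x ⟩ z∈x)))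
      where U = γ.image[ W ∩ K ] N.+ˢ N.⟨ γ · x ⟩

    γW : ∀ W → W +ˢ ⟨ x ⟩ ≐ whole → N.ρ γ.image[ W ∩ K ] ≡ N.ρ γ.image[ whole ∩ K ]
    γW W W+x = ≡.trans (full⇒cyclic {N = N} full γ.image[ W ∩ K ] (γW+x W W+x)) (≡.sym γ-whole)

  splitting⇒coreMap : CoreMap M C L N
  splitting⇒coreMap = record
    { γ        = γ
    ; onto     = λ g → let (x , x∈K , e) = γ-kernel-onto g in x , kernel⊆C x x∈K , e
    ; null     = λ _ x∈L → ∈-L⇒γ≈0 x∈L
    ; faithful = λ {x} x∈C e → β≈0∧γ≈0⇒∈-L (β.∈-kernel⁻ (C⊆kernel x x∈C)) e
    ; rank     = λ V V⊆C → ρ-kernel {V} λ x x∈V → C⊆kernel x (V⊆C x x∈V)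
    }

  -- α maps L bijectively onto A: loops are killed by β and γ, so joint injectivity applies to α
  -- alone, and the preimage of (u, 0, 0) is a loop.
  dim-A : SA.dim SA.whole ≡ dim L
  dim-A = begin
    SA.dim SA.whole                         ≡⟨ SubspaceProperties.dim-cong A {SA.whole} {α.image[ L ]}
                                                 (αL , SubspaceProperties.⊆-whole A α.image[ L ]) ⟩
    SA.dim α.image[ L ]                     ≡⟨ ℕ.+-identityʳ _ ⟨
    SA.dim α.image[ L ] + 0                 ≡⟨ ≡.cong (SA.dim α.image[ L ] +_) (P.⊆0⇒dim≡0 (L ∩ α.kernel) λ x x∈ →
        let (x∈L , x∈K) = ∈-∩⁻ {L} {α.kernel} x∈ in
        injective x (α.∈-kernel⁻ x∈K) (∈-L⇒β≈0 x∈L) (∈-L⇒γ≈0 x∈L)) ⟨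
    SA.dim α.image[ L ] + dim (L ∩ α.kernel) ≡⟨ α.rank-nullity L ⟨
    dim L                                   ∎
    where
    open ≡-Reasoning
    αL : SA.whole SA.⊆ α.image[ L ]
    αL u _ = let (x , e , e′ , e″) = surjective u B.0ᴹ G.0ᴹ in
      SA.Subspace.resp α.image[ L ] e (α.image⁺ L (β≈0∧γ≈0⇒∈-L e′ e″))

  -- Rank-nullity for β, which is onto and has kernel C.
  dim-B : SB.dim SB.whole ≡ dim whole ∸ dim C
  dim-B = begin
    SB.dim SB.whole                                             ≡⟨ PB.dim-cong {SB.whole} {β.image[ whole ]}
                                                                     (βE , PB.⊆-whole β.image[ whole ]) ⟩
    SB.dim β.image[ whole ]                                     ≡⟨ ℕ.m+n∸n≡m _ (dim C) ⟨
    SB.dim β.image[ whole ] + dim C ∸ dim C                     ≡⟨ ≡.cong (λ d → SB.dim β.image[ whole ] + d ∸ dim C)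
      (P.dim-cong {C} {whole ∩ β.kernel}
        ( (λ x x∈C → ∈-∩⁺ {whole} {β.kernel} (∈-whole , C⊆kernel x x∈C))
        , (λ x x∈ → kernel⊆C x (P.∩-⊆ʳ whole β.kernel x x∈)))) ⟩
    SB.dim β.image[ whole ] + dim (whole ∩ β.kernel) ∸ dim C    ≡⟨ ≡.cong (_∸ dim C) (β.rank-nullity whole) ⟨
    dim whole ∸ dim C                                           ∎
    where
    open ≡-Reasoning
    βE : SB.whole SB.⊆ β.image[ whole ]
    βE v _ = let (x , _ , e , _) = surjective A.0ᴹ v G.0ᴹ in
      SB.Subspace.resp β.image[ whole ] e (β.image⁺ whole ∈-whole)

-- Existence

module Coloops {F : FiniteField c ℓ} (M : QMatroid F m ℓm) where
  open QMatroid M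
  open VectorSpace space
  open SubspaceProperties space
  open QMatroidProperties M
  open Loops M
  open Combinations F leftModule
  private module F = FiniteField F

  -- Adding a loop to W does not raise its rank.
  L⊆C : L ⊆ C
  L⊆C x x∈L = ∈-C⁺ λ W (_ , whole⊆) → ℕ.≤-antisym (monotone {W} {whole} (⊆-whole W)) (begin
    ρ whole              ≤⟨ monotone {whole} {W +ˢ ⟨ x ⟩} whole⊆ ⟩
    ρ (W +ˢ ⟨ x ⟩)       ≤⟨ subadditive W ⟨ x ⟩ ⟩
    ρ W + ρ ⟨ x ⟩        ≡⟨ ≡.cong (ρ W +_) (∈-L⁻ x∈L) ⟩
    ρ W + 0              ≡⟨ ℕ.+-identityʳ _ ⟩
    ρ W                  ∎)
    where open ℕ.≤-Reasoning

  private
    exchange : ∀ W {x y} → y ∈ W +ˢ ⟨ x ⟩ → ¬ (y ∈ W) → x ∈ W +ˢ ⟨ y ⟩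
    exchange W {x} {y} y∈ y∉W with ∈-+⁻ {W} {⟨ x ⟩} y∈
    ... | w , w∈W , z , z∈x , y≈w+z with ∈-⟨⟩⁻ {x} z∈x
    ...   | a , z≈ax with a F.≟ F.0#
    ...     | yes a≈0 = contradiction (Subspace.resp W (≈ᴹ-sym (≈ᴹ-trans y≈w+z (≈ᴹ-trans
                (+ᴹ-congˡ (≈ᴹ-trans z≈ax (≈ᴹ-trans (*ₗ-cong a≈0 ≈ᴹ-refl) (*ₗ-zeroˡ x)))) (+ᴹ-identityʳ w)))) w∈W) y∉W
    ...     | no a≉0 = *-cancel-∈ U a≉0 (Subspace.resp U z≈ax (+-cancelʳ-∈ U (⊆-+ˡ W ⟨ y ⟩ w w∈W)
                (Subspace.resp U (≈ᴹ-trans y≈w+z (+ᴹ-comm w z)) (⊆-+ʳ W ⟨ y ⟩ y (x∈⟨x⟩ y)))))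
      where U = W +ˢ ⟨ y ⟩

    -- The nullity dim - ρ of V is at most that of V ∩ C. The reverse inequality is unit increase,
    -- so this is the half of `ρ-∩C` that needs the definition of C.
    Bound : Subspace → Set
    Bound V = dim V + ρ (V ∩ C) ≤ ρ V + dim (V ∩ C)

    bound-⊆ : ∀ V → V ⊆ C → Bound V
    bound-⊆ V V⊆C = ℕ.≤-reflexive (begin
      dim V + ρ (V ∩ C)   ≡⟨ ≡.cong (dim V +_) (ρ-cong {V ∩ C} {V} e) ⟩
      dim V + ρ V         ≡⟨ ℕ.+-comm (dim V) (ρ V) ⟩
      ρ V + dim V         ≡⟨ ≡.cong (ρ V +_) (dim-cong {V ∩ C} {V} e) ⟨
      ρ V + dim (V ∩ C)   ∎)
      where
      open ≡-Reasoning
      e : V ∩ C ≐ V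
      e = ∩-⊆ˡ V C , λ x x∈V → ∈-∩⁺ {V} {C} (x∈V , V⊆C x x∈V)

    -- A hyperplane W of smaller rank contains C and loses one unit of rank on V.
    bound-step : ∀ V W {x} → x ∈ V → W +ˢ ⟨ x ⟩ ≐ whole → ¬ (ρ W ≡ ρ whole) →
                 (dim (W ∩ V) < dim V → Bound (W ∩ V)) → Bound V
    bound-step V W {x} x∈V (_ , whole⊆) ρW≢ hyp = begin
      dim V + ρ (V ∩ C)                ≡⟨ ≡.cong₂ _+_ dim-V (ρ-cong {V ∩ C} {U ∩ C} VC≐UC) ⟩
      ℕ.suc (dim U + ρ (U ∩ C))        ≤⟨ s≤s (hyp (ℕ.≤-reflexive (≡.sym dim-V))) ⟩
      ℕ.suc (ρ U) + dim (U ∩ C)        ≤⟨ ℕ.+-mono-≤ ρU<ρV (ℕ.≤-reflexive (dim-cong {U ∩ C} {V ∩ C} (proj₂ VC≐UC , proj₁ VC≐UC))) ⟩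
      ρ V + dim (V ∩ C)                ∎
      where
      open ℕ.≤-Reasoning
      U : Subspace
      U = W ∩ V
      x∉W : ¬ (x ∈ W)
      x∉W x∈W = ρW≢ (ρ-cong {W} {whole} (⊆-whole W , λ y y∈ →
        +-⊆ W ⟨ x ⟩ {W} (λ _ w → w) (⟨x⟩⊆ W x∈W) y (whole⊆ y y∈)))
      -- A vector y ∈ C outside W could be exchanged for x, giving W + ⟨y⟩ = E, and then W would
      -- have full rank.
      C⊆W : C ⊆ W
      C⊆W y y∈C = decidable-stable (y ∈? W) λ y∉W → ρW≢ (∈-C⁻ W y∈C
        (⊆-whole (W +ˢ ⟨ y ⟩) , λ z z∈ → +-⊆ W ⟨ x ⟩ {W +ˢ ⟨ y ⟩} (⊆-+ˡ W ⟨ y ⟩)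
          (⟨x⟩⊆ (W +ˢ ⟨ y ⟩) (exchange W (whole⊆ y ∈-whole) y∉W)) z (whole⊆ z z∈)))
      VC≐UC : V ∩ C ≐ U ∩ C
      VC≐UC = (λ y y∈ → let (y∈V , y∈C) = ∈-∩⁻ {V} {C} y∈ in
                ∈-∩⁺ {U} {C} (∈-∩⁺ {W} {V} (C⊆W y y∈C , y∈V) , y∈C)) ,
              ∩-monoˡ {U} {V} C (∩-⊆ʳ W V)
      dim-V : dim V ≡ ℕ.suc (dim U)
      dim-V = dim-+⟨⟩ {U} {V} (∩-⊆ʳ W V) x∈V (x∉W ∘ ∩-⊆ˡ W V x) λ v v∈V →
        let (w , w∈W , z , z∈x , e) = ∈-+⁻ {W} {⟨ x ⟩} (whole⊆ v ∈-whole) in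
        ∈-+⁺ {U} {⟨ x ⟩} (w , ∈-∩⁺ {W} {V} (w∈W ,
          +-cancelʳ-∈ V (⟨x⟩⊆ V x∈V z z∈x) (Subspace.resp V e v∈V)) , z , z∈x , e)
      ρU<ρV : ρ U < ρ V
      ρU<ρV = ℕ.+-cancelˡ-≤ (ρ W) _ _ (begin
        ρ W + ℕ.suc (ρ U)           ≡⟨ ℕ.+-suc (ρ W) (ρ U) ⟩
        ℕ.suc (ρ W) + ρ U           ≤⟨ ℕ.+-monoˡ-≤ (ρ U) (ℕ.≤∧≢⇒< (monotone {W} {whole} (⊆-whole W)) ρW≢) ⟩
        ρ whole + ρ U               ≤⟨ ℕ.+-monoˡ-≤ (ρ U) (monotone {whole} {W +ˢ V} λ y y∈ →
          +-⊆ W ⟨ x ⟩ {W +ˢ V} (⊆-+ˡ W V) (λ z z∈ → ⊆-+ʳ W V z (⟨x⟩⊆ V x∈V z z∈)) y (whole⊆ y y∈)) ⟩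
        ρ (W +ˢ V) + ρ U            ≤⟨ submodular W V ⟩
        ρ W + ρ V                   ∎)

    -- Inequalities of natural numbers are stable, so x and W may be found by contradiction.
    bound : ∀ k V → dim V < k → Bound V
    bound (ℕ.suc k) V (s≤s dimV≤k) = decidable-stable (_ ℕ.≤? _) λ fails →
      fails (bound-⊆ V λ x x∈V → decidable-stable (x ∈? C) λ x∉C →
        x∉C (∈-C⁺ λ W e → decidable-stable (ρ W ℕ.≟ ρ whole) λ ne →
          fails (bound-step V W x∈V e ne λ lt → bound k (W ∩ V) (ℕ.<-≤-trans lt dimV≤k))))

  ρ-∩C : ∀ V → dim V + ρ (V ∩ C) ≡ ρ V + dim (V ∩ C)
  ρ-∩C V = ℕ.≤-antisym (bound _ V (ℕ.n<1+n _))
    (ℕ.≤-trans (ρ-unitIncreasing {V ∩ C} {V} (∩-⊆ˡ V C)) (ℕ.≤-reflexive (ℕ.+-comm (ρ (V ∩ C)) (dim V))))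

-- Coordinates, retractions and quotients

module Coordinates (F : FiniteField c ℓ) where
  private
    module F = FiniteField F
    module K k = VectorSpace (_^ᵛ_ F k)

  -- The space `F ^ᵛ k` is an iterated product of lines, whereas coefficients of linear combinations
  -- are functions on `Fin k`.
  pack : ∀ k → Vector F.Carrier k → K.Carrierᴹ k
  pack ℕ.zero    v = _
  pack (ℕ.suc k) v = v zero , pack k (v ∘ suc)

  unpack : ∀ k → K.Carrierᴹ k → Vector F.Carrier k
  unpack (ℕ.suc k) (x , v) zero    = x
  unpack (ℕ.suc k) (x , v) (suc i) = unpack k v i

  pack-cong : ∀ k {v w : Vector F.Carrier k} → (∀ i → v i F.≈ w i) → K._≈ᴹ_ k (pack k v) (pack k w)
  pack-cong ℕ.zero    e = _
  pack-cong (ℕ.suc k) e = e zero , pack-cong k (e ∘ suc)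

  unpack-cong : ∀ k {x y : K.Carrierᴹ k} → K._≈ᴹ_ k x y → ∀ i → unpack k x i F.≈ unpack k y i
  unpack-cong (ℕ.suc k) (e , es) zero    = e
  unpack-cong (ℕ.suc k) (e , es) (suc i) = unpack-cong k es i

  pack-unpack : ∀ k (x : K.Carrierᴹ k) → K._≈ᴹ_ k (pack k (unpack k x)) x
  pack-unpack ℕ.zero    x       = _
  pack-unpack (ℕ.suc k) (x , v) = F.refl , pack-unpack k v

  unpack-pack : ∀ k (v : Vector F.Carrier k) i → unpack k (pack k v) i F.≈ v i
  unpack-pack (ℕ.suc k) v zero    = F.refl
  unpack-pack (ℕ.suc k) v (suc i) = unpack-pack k (v ∘ suc) i

  pack-+ : ∀ k (v w : Vector F.Carrier k) →
           K._≈ᴹ_ k (pack k (λ i → v i F.+ w i)) (K._+ᴹ_ k (pack k v) (pack k w))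
  pack-+ ℕ.zero    v w = _
  pack-+ (ℕ.suc k) v w = F.refl , pack-+ k (v ∘ suc) (w ∘ suc)

  pack-* : ∀ k a (v : Vector F.Carrier k) →
           K._≈ᴹ_ k (pack k (λ i → a F.* v i)) (K._*ₗ_ k a (pack k v))
  pack-* ℕ.zero    a v = _
  pack-* (ℕ.suc k) a v = F.refl , pack-* k a (v ∘ suc)

  unpack-+ : ∀ k (x y : K.Carrierᴹ k) i → unpack k (K._+ᴹ_ k x y) i F.≈ unpack k x i F.+ unpack k y i
  unpack-+ (ℕ.suc k) x y zero    = F.refl
  unpack-+ (ℕ.suc k) x y (suc i) = unpack-+ k (proj₂ x) (proj₂ y) i

  unpack-* : ∀ k a (x : K.Carrierᴹ k) i → unpack k (K._*ₗ_ k a x) i F.≈ a F.* unpack k x i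
  unpack-* (ℕ.suc k) a x zero    = F.refl
  unpack-* (ℕ.suc k) a x (suc i) = unpack-* k a (proj₂ x) i

  unpack-0 : ∀ k i → unpack k (K.0ᴹ k) i F.≈ F.0#
  unpack-0 (ℕ.suc k) zero    = F.refl
  unpack-0 (ℕ.suc k) (suc i) = unpack-0 k i

module _ {F : FiniteField c ℓ} (E : VectorSpace F m ℓm) (B : VectorSpace F n ℓn) (X : Subspaces.Subspace E) where
  private
    module E = VectorSpace E
    module B = VectorSpace B
  open Subspaces E

  -- A split surjection with kernel X: σ identifies B with a complement of X.
  record Retraction : Set (c ⊔ m ⊔ ℓm ⊔ n ⊔ ℓn) where
    field
      h       : E ⟶ B
      σ       : B ⟶ E
      section : ∀ b → h · σ · b B.≈ᴹ b
      ∈⇒h≈0   : ∀ {x} → x ∈ X → h · x B.≈ᴹ B.0ᴹ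
      h≈0⇒∈   : ∀ {x} → h · x B.≈ᴹ B.0ᴹ → x ∈ X

module _ {F : FiniteField c ℓ} (E : VectorSpace F m ℓm) where
  private module F = FiniteField F
  open VectorSpace E
  open Subspaces E
  open SubspaceProperties E
  open Combinations F leftModule
  open Coordinates F

  module _ {X : Subspace} (B : BasisModulo X whole) where
    private
      module B = BasisModulo B
      k = B.size
      module K = VectorSpace (_^ᵛ_ F k)

      coordinates-unique : ∀ {α β y z} → y ∈ X → z ∈ X →
        lincomb α B.vector +ᴹ y ≈ᴹ lincomb β B.vector +ᴹ z → ∀ i → α i F.≈ β i
      coordinates-unique {α} {β} {y} {z} y∈X z∈X e i = AG.x∙y⁻¹≈ε⇒x≈y _ _ (F.trans
          (F.+-congˡ (F.trans (F.-‿cong (F.sym (F.*-identityˡ (β i)))) (Ring.-‿distribˡ-* F.ring F.1# (β i))))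
          (B.independent (λ i → α i F.+ (F.- F.1#) F.* β i)
            (Subspace.resp X (≈ᴹ-sym (≈ᴹ-trans (lincomb-+ α _ B.vector) (+ᴹ-congˡ (lincomb-* _ β B.vector))))
              (+-cancelʳ-∈ X y∈X (Subspace.resp X eq z∈X))) i))
        where
        module AG = AbelianGroup F.+-abelianGroup
        open SetoidReasoning ≈ᴹ-setoid
        a = lincomb α B.vector
        b = lincomb β B.vector
        eq : z ≈ᴹ (a -ᴹ b) +ᴹ y
        eq = begin
          z                                  ≈⟨ x+y-y≈x z b ⟨
          (z +ᴹ b) +ᴹ (F.- F.1#) *ₗ b        ≈⟨ +ᴹ-congʳ (≈ᴹ-trans (+ᴹ-comm z b) (≈ᴹ-sym e)) ⟩
          (a +ᴹ y) +ᴹ (F.- F.1#) *ₗ b        ≈⟨ +ᴹ-assoc _ _ _ ⟩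
          a +ᴹ (y +ᴹ (F.- F.1#) *ₗ b)        ≈⟨ +ᴹ-congˡ (+ᴹ-comm _ _) ⟩
          a +ᴹ ((F.- F.1#) *ₗ b +ᴹ y)        ≈⟨ +ᴹ-assoc _ _ _ ⟨
          (a -ᴹ b) +ᴹ y                      ∎

      coordinates : ∀ x → ∃ λ α → ∃ λ y → y ∈ X × x ≈ᴹ lincomb α B.vector +ᴹ y
      coordinates x =
        let (s , s∈ , y , y∈X , e) = ∈-+⁻ {span B.vector} {X} (B.spanning x ∈-whole)
            (α , e′) = ∈-span⁻ B.vector s∈
        in α , y , y∈X , ≈ᴹ-trans e (+ᴹ-congʳ (≈ᴹ-sym e′))

      coord : ∀ x → Vector F.Carrier k
      coord x = proj₁ (coordinates x)

      coord-≈ : ∀ {x α y} → y ∈ X → x ≈ᴹ lincomb α B.vector +ᴹ y → ∀ i → coord x i F.≈ α i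
      coord-≈ {x} y∈X e = let (_ , _ , z∈X , e′) = coordinates x in
        coordinates-unique z∈X y∈X (≈ᴹ-trans (≈ᴹ-sym e′) e)

    -- `coordinates` picks a decomposition of each vector separately. Linearity of h comes from
    -- uniqueness: the coefficients of a vector modulo X are determined, so any other decomposition
    -- has the same ones.
    retraction : Retraction E (_^ᵛ_ F k) X
    retraction = record
      { h = linear E (_^ᵛ_ F k) (λ x → pack k (coord x))
          (λ {x} {y} x≈y → let (_ , _ , z∈X , e) = coordinates y in
            pack-cong k (coord-≈ z∈X (≈ᴹ-trans x≈y e)))
          (λ x y → let (α , u , u∈X , e) = coordinates x ; (β , v , v∈X , e′) = coordinates y in
            K.≈ᴹ-trans (pack-cong k (coord-≈ (Subspace.+-closed X u∈X v∈X)
              (≈ᴹ-trans (+ᴹ-cong e e′) (≈ᴹ-trans (+ᴹ-medial _ _ _ _) (+ᴹ-congʳ (≈ᴹ-sym (lincomb-+ α β B.vector)))))))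
              (pack-+ k α β))
          (λ a x → let (α , u , u∈X , e) = coordinates x in
            K.≈ᴹ-trans (pack-cong k (coord-≈ (Subspace.*-closed X a u∈X)
              (≈ᴹ-trans (*ₗ-cong F.refl e) (≈ᴹ-trans (*ₗ-distribˡ _ _ _) (+ᴹ-congʳ (≈ᴹ-sym (lincomb-* a α B.vector)))))))
              (pack-* k a α))
      ; σ = linear (_^ᵛ_ F k) E (λ a → lincomb (unpack k a) B.vector)
          (λ e → lincomb-cong B.vector (unpack-cong k e))
          (λ a b → ≈ᴹ-trans (lincomb-cong B.vector (unpack-+ k a b)) (lincomb-+ _ _ B.vector))
          (λ b a → ≈ᴹ-trans (lincomb-cong B.vector (unpack-* k b a)) (lincomb-* b _ B.vector))
      ; section = λ a → K.≈ᴹ-trans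
          (pack-cong k (coord-≈ (Subspace.0-mem X) (≈ᴹ-sym (+ᴹ-identityʳ _)))) (pack-unpack k a)
      ; ∈⇒h≈0 = λ {x} x∈X → K.≈ᴹ-trans
          (pack-cong k (coord-≈ {α = unpack k K.0ᴹ} x∈X (≈ᴹ-sym (≈ᴹ-trans
            (+ᴹ-congʳ (lincomb-zero B.vector (unpack-0 k))) (+ᴹ-identityˡ x)))))
          (pack-unpack k K.0ᴹ)
      ; h≈0⇒∈ = λ {x} e → let (α , y , y∈X , e′) = coordinates x in
          Subspace.resp X (≈ᴹ-sym (≈ᴹ-trans e′ (≈ᴹ-trans (+ᴹ-congʳ (lincomb-zero B.vector λ i →
            F.trans (F.sym (unpack-pack k α i)) (F.trans (unpack-cong k e i) (unpack-0 k i)))) (+ᴹ-identityˡ y)))) y∈X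
      }

  span-∩-≈0 : ∀ {X V} (B : BasisModulo X V) {x} → x ∈ span (BasisModulo.vector B) → x ∈ X → x ≈ᴹ 0ᴹ
  span-∩-≈0 {X} B x∈span x∈X with ∈-span⁻ (BasisModulo.vector B) x∈span
  ... | α , e = ≈ᴹ-trans (≈ᴹ-sym e) (lincomb-zero (BasisModulo.vector B)
    (BasisModulo.independent B α (Subspace.resp X (≈ᴹ-sym e) x∈X)))

  module _ (L : Subspace) where
    private
      module U = Basis (basisOf L)
      Z = basisModulo L whole
      K = span (BasisModulo.vector Z)
      l = dim L

    -- A basis of L is at the same time a basis of E modulo a complement K of L. Choosing these
    -- representatives makes the section of the resulting retraction take its values in L.
    complementaryBasis : BasisModulo K whole
    complementaryBasis = record
      { vector      = U.vector
      ; vector∈     = λ _ → ∈-whole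
      ; independent = λ α e → U.independent α (span-∩-≈0 Z e (lincomb-closed L α U.vector∈))
      ; spanning    = λ x x∈ → +-⊆ K L {span U.vector +ˢ K} (⊆-+ʳ (span U.vector) K)
          (λ y y∈L → ⊆-+ˡ (span U.vector) K y (∈-span⁺ U.vector (U.spanning y y∈L)))
          x (BasisModulo.spanning Z x x∈)
      }

    private module R = Retraction (retraction {K} complementaryBasis)

    complementaryRetraction-∈ : ∀ a → R.σ · a ∈ L
    complementaryRetraction-∈ a = lincomb-closed L (unpack l a) U.vector∈

    complementaryRetraction-fix : ∀ {x} → x ∈ L → R.σ · R.h · x ≈ᴹ x
    complementaryRetraction-fix {x} x∈L = ≈ᴹ-trans (_⟶_.⟦⟧-cong R.σ hx≈a) (≈ᴹ-sym x≈σa)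
      where
      module KV = VectorSpace (_^ᵛ_ F l)
      α = proj₁ (U.spanning x x∈L)
      a = pack l α
      x≈σa : x ≈ᴹ R.σ · a
      x≈σa = ≈ᴹ-trans (≈ᴹ-sym (proj₂ (U.spanning x x∈L)))
        (lincomb-cong U.vector λ i → F.sym (unpack-pack l α i))
      hx≈a : R.h · x KV.≈ᴹ a
      hx≈a = KV.≈ᴹ-trans (_⟶_.⟦⟧-cong R.h x≈σa) (R.section a)

-- E / ker h, represented by the vectors of E with the coarser equality h x = h y.
module Coimage {F : FiniteField c ℓ} {E : VectorSpace F m ℓm} {E′ : VectorSpace F n ℓn} (h : E ⟶ E′) where
  private
    module F  = FiniteField F
    module E  = VectorSpace E
    module E′ = VectorSpace E′
    module S  = Subspaces E
    module P  = SubspaceProperties E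
    module h  = _⟶_ h
    module H  = LinearMapProperties h
    module B  = P.BasisModulo (P.basisModulo H.kernel S.whole)

    raw : RawLeftModule F.Carrier m ℓn
    raw = record
      { Carrierᴹ = E.Carrierᴹ
      ; _≈ᴹ_     = λ x y → h · x E′.≈ᴹ h · y
      ; _+ᴹ_     = E._+ᴹ_
      ; _*ₗ_     = E._*ₗ_
      ; 0ᴹ       = E.0ᴹ
      ; -ᴹ_      = E.-ᴹ_
      }

    open LeftModuleMorphisms raw E′.rawLeftModule

    isMonomorphism : IsLeftModuleMonomorphism (h ·_)
    isMonomorphism = record
      { isLeftModuleHomomorphism = record
        { +ᴹ-isGroupHomomorphism = record
          { isMonoidHomomorphism = record
            { isMagmaHomomorphism = record
              { isRelHomomorphism = record { cong = λ e → e }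
              ; homo = h.+ᴹ-homo }
            ; ε-homo = h.0ᴹ-homo }
          ; ⁻¹-homo = h.-ᴹ-homo }
        ; *ₗ-homo = h.*ₗ-homo
        }
      ; injective = λ e → e
      }

    module Mono = LeftModuleMonomorphism isMonomorphism

    leftModule : LeftModule F.ring m ℓn
    leftModule = record { isLeftModule = Mono.isLeftModule F.isRing E′.isLeftModule }

  coimage : VectorSpace F m ℓn
  coimage = record
    { leftModule  = leftModule
    ; basis       = B.vector
    ; independent = λ α e → B.independent α (H.∈-kernel⁺ (E′.≈ᴹ-trans e h.0ᴹ-homo))
    ; spanning    = λ x →
        let (s , s∈ , z , z∈ker , x≈s+z) = S.∈-+⁻ {P.span B.vector} {H.kernel} (B.spanning x S.∈-whole)
            (α , e) = P.∈-span⁻ B.vector s∈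
        in α , E′.≈ᴹ-trans (h.⟦⟧-cong e) (E′.≈ᴹ-sym (E′.≈ᴹ-trans (h.⟦⟧-cong x≈s+z)
             (E′.≈ᴹ-trans (h.+ᴹ-homo s z) (E′.≈ᴹ-trans (E′.+ᴹ-congˡ (H.∈-kernel⁻ z∈ker)) (E′.+ᴹ-identityʳ _)))))
    }

  quotientMap : E ⟶ coimage
  quotientMap = linear E coimage (λ x → x) h.⟦⟧-cong (λ _ _ → E′.≈ᴹ-refl) (λ _ _ → E′.≈ᴹ-refl)

  inclusion : coimage ⟶ E′
  inclusion = record { to = h ·_ ; isHomomorphism = IsLeftModuleMonomorphism.isLeftModuleHomomorphism isMonomorphism }

module _ {F : FiniteField c ℓ} (M : QMatroid F m ℓm) {G : VectorSpace F n ℓn} (h : G ⟶ QMatroid.space M) where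
  private
    module M = QMatroid M
    module H = LinearMapProperties h

  -- Linear maps do not raise dimension, preserve sums and send intersections into intersections, so
  -- the axioms carry over. Along the inclusion of a coimage this is the restriction of M to the
  -- image.
  pullback : QMatroid F n ℓn
  pullback = record
    { raw = record { space = G ; ρ = λ V → M.ρ H.image[ V ] }
    ; isQMatroid = record
      { bounded    = λ V → ℕ.≤-trans (M.bounded H.image[ V ]) (H.dim-image-≤ V)
      ; monotone   = λ {V} {W} V⊆W → M.monotone {H.image[ V ]} {H.image[ W ]} (H.image-mono {V} {W} V⊆W)
      ; submodular = λ V W → ℕ.≤-trans
          (ℕ.+-mono-≤
            (M.monotone {H.image[ V +ˢ W ]} {H.image[ V ] M.+ˢ H.image[ W ]} (H.image-+ V W))
            (M.monotone {H.image[ V ∩ W ]} {H.image[ V ] M.∩ H.image[ W ]} (H.image-∩ V W)))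
          (M.submodular H.image[ V ] H.image[ W ])
      }
    }
    where open Subspaces G

-- βσD = id with ker β the cyclic core, and αᴸσU = id with σU(A) the loop space.
module Existence {F : FiniteField c ℓ} (M : QMatroid F m ℓm) {A : VectorSpace F n ℓn} {B : VectorSpace F o ℓo}
  (R : Retraction (QMatroid.space M) B (Loops.C M))
  (αᴸ : QMatroid.space M ⟶ A) (σU : A ⟶ QMatroid.space M)
  (αᴸσU : ∀ a → VectorSpace._≈ᴹ_ A (αᴸ · σU · a) a)
  (σU∈L : ∀ a → QMatroid._∈_ M (σU · a) (Loops.L M))
  (σUαᴸ : ∀ {x} → QMatroid._∈_ M x (Loops.L M) → VectorSpace._≈ᴹ_ (QMatroid.space M) (σU · αᴸ · x) x) where

  private
    module F = FiniteField F
    module A = VectorSpace A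
    module B = VectorSpace B
    module SB = Subspaces B
    module R = Retraction R
  open QMatroid M
  open VectorSpace space
  open SubspaceProperties space
  open QMatroidProperties M
  open Loops M
  open Coloops M
  open Combinations F leftModule

  β : space ⟶ B
  β = R.h
  σD : B ⟶ space
  σD = R.σ

  -- The projection onto C along the complement σD(B).
  q : space ⟶ space
  q = identity space -ᴸ (σD ⊚ β)

  α : space ⟶ A
  α = αᴸ ⊚ q

  -- E is the direct sum of pr(E), L and σD(B), where pr(E) = C ∩ ker αᴸ is a complement of L in C,
  -- and `pr` projects onto the first summand.
  pr : space ⟶ space
  pr = q -ᴸ (σU ⊚ α)

  private
    module Iβ = LinearMapProperties β
    module IA = LinearMapProperties αᴸ
    module Ip = LinearMapProperties pr
    module α  = _⟶_ α
    module αᴸ = _⟶_ αᴸ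
    module β  = _⟶_ β
    module σD = _⟶_ σD
    module σU = _⟶_ σU
    module pr = _⟶_ pr
    module CA = Combinations F A.leftModule
    module CB = Combinations F B.leftModule

    x-0≈x : ∀ {x y} → y ≈ᴹ 0ᴹ → x -ᴹ y ≈ᴹ x
    x-0≈x {x} y≈0 = ≈ᴹ-trans (+ᴹ-congˡ (≈ᴹ-trans (*ₗ-cong F.refl y≈0) (*ₗ-zeroʳ _))) (+ᴹ-identityʳ x)

    x-y≈0 : ∀ {x y} → x ≈ᴹ y → x -ᴹ y ≈ᴹ 0ᴹ
    x-y≈0 {x} {y} e = ≈ᴹ-trans (+ᴹ-congʳ e) (x-x≈0 y)

    q∈C : ∀ x → q · x ∈ C
    q∈C x = R.h≈0⇒∈ (B.≈ᴹ-trans (Iβ.homo-- x (σD · β · x))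
      (B.≈ᴹ-trans (B.+ᴹ-congˡ (B.*ₗ-cong F.refl (R.section (β · x)))) (CB.x-x≈0 (β · x))))

    C⇒q≈ : ∀ {x} → x ∈ C → q · x ≈ᴹ x
    C⇒q≈ x∈C = x-0≈x (≈ᴹ-trans (σD.⟦⟧-cong (R.∈⇒h≈0 x∈C)) σD.0ᴹ-homo)

    qσD≈0 : ∀ b → q · σD · b ≈ᴹ 0ᴹ
    qσD≈0 b = x-y≈0 (σD.⟦⟧-cong (B.≈ᴹ-sym (R.section b)))

    pr∈C : ∀ x → pr · x ∈ C
    pr∈C x = -‿closed C (q∈C x) (L⊆C _ (σU∈L (α · x)))

    αᴸpr≈0 : ∀ x → αᴸ · pr · x A.≈ᴹ A.0ᴹ
    αᴸpr≈0 x = A.≈ᴹ-trans (IA.homo-- (q · x) (σU · α · x))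
      (A.≈ᴹ-trans (A.+ᴹ-congˡ (A.*ₗ-cong F.refl (αᴸσU (α · x)))) (CA.x-x≈0 (α · x)))

    αpr≈0 : ∀ x → α · pr · x A.≈ᴹ A.0ᴹ
    αpr≈0 x = A.≈ᴹ-trans (αᴸ.⟦⟧-cong (C⇒q≈ (pr∈C x))) (αᴸpr≈0 x)

    pr-idempotent : ∀ x → pr · pr · x ≈ᴹ pr · x
    pr-idempotent x = ≈ᴹ-trans
      (x-0≈x (≈ᴹ-trans (σU.⟦⟧-cong (αpr≈0 x)) σU.0ᴹ-homo)) (C⇒q≈ (pr∈C x))

    L⇒pr≈0 : ∀ {x} → x ∈ L → pr · x ≈ᴹ 0ᴹ
    L⇒pr≈0 {x} x∈L = x-y≈0 (≈ᴹ-trans qx≈x (≈ᴹ-sym (≈ᴹ-trans (σU.⟦⟧-cong (αᴸ.⟦⟧-cong qx≈x)) (σUαᴸ x∈L))))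
      where
      qx≈x : q · x ≈ᴹ x
      qx≈x = C⇒q≈ (L⊆C x x∈L)

    αpr-decomposition : ∀ x → q · x ≈ᴹ pr · x +ᴹ σU · α · x
    αpr-decomposition x = ≈ᴹ-sym (x-y+y≈x (q · x) (σU · α · x))

    decomposition : ∀ x → x ≈ᴹ (pr · x +ᴹ σU · α · x) +ᴹ σD · β · x
    decomposition x = ≈ᴹ-trans (≈ᴹ-sym (x-y+y≈x x (σD · β · x))) (+ᴹ-congʳ (αpr-decomposition x))

    C∧pr≈0⇒L : ∀ {x} → x ∈ C → pr · x ≈ᴹ 0ᴹ → x ∈ L
    C∧pr≈0⇒L {x} x∈C e = Subspace.resp L (≈ᴹ-sym (begin
      x                       ≈⟨ C⇒q≈ x∈C ⟨
      q · x                   ≈⟨ αpr-decomposition x ⟩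
      pr · x +ᴹ σU · α · x    ≈⟨ +ᴹ-congʳ e ⟩
      0ᴹ +ᴹ σU · α · x        ≈⟨ +ᴹ-identityˡ _ ⟩
      σU · α · x              ∎)) (σU∈L (α · x))
      where open SetoidReasoning ≈ᴹ-setoid

    joint-kernel : ∀ x → α · x A.≈ᴹ A.0ᴹ → β · x B.≈ᴹ B.0ᴹ → pr · x ≈ᴹ pr · 0ᴹ → x ≈ᴹ 0ᴹ
    joint-kernel x αx≈0 βx≈0 prx≈pr0 = begin
      x                                        ≈⟨ decomposition x ⟩
      (pr · x +ᴹ σU · α · x) +ᴹ σD · β · x     ≈⟨ +ᴹ-cong (+ᴹ-cong (≈ᴹ-trans prx≈pr0 pr.0ᴹ-homo)
        (≈ᴹ-trans (σU.⟦⟧-cong αx≈0) σU.0ᴹ-homo)) (≈ᴹ-trans (σD.⟦⟧-cong βx≈0) σD.0ᴹ-homo) ⟩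
      (0ᴹ +ᴹ 0ᴹ) +ᴹ 0ᴹ                         ≈⟨ ≈ᴹ-trans (+ᴹ-identityʳ _) (+ᴹ-identityʳ _) ⟩
      0ᴹ                                       ∎
      where open SetoidReasoning ≈ᴹ-setoid

    ρ-+L : ∀ V → ρ (V +ˢ L) ≤ ρ V
    ρ-+L V = ℕ.≤-trans (subadditive V L) (ℕ.≤-reflexive (≡.trans (≡.cong (ρ V +_) ρ-L) (ℕ.+-identityʳ _)))

    -- x ∈ C and pr x differ by a loop.
    ρ-pr : ∀ V → V ⊆ C → ρ Ip.image[ V ] ≡ ρ V
    ρ-pr V V⊆C = ℕ.≤-antisym
      (ℕ.≤-trans (monotone {Ip.image[ V ]} {V +ˢ L} (Ip.image-⊆ V {V +ˢ L} λ x x∈V →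
        +-cancelʳ-∈ (V +ˢ L) (⊆-+ʳ V L _ (σU∈L (α · x)))
          (Subspace.resp (V +ˢ L) (αpr-decomposition x)
            (Subspace.resp (V +ˢ L) (≈ᴹ-sym (C⇒q≈ (V⊆C x x∈V))) (⊆-+ˡ V L x x∈V))))) (ρ-+L V))
      (ℕ.≤-trans (monotone {V} {Ip.image[ V ] +ˢ L} λ x x∈V →
        Subspace.resp (Ip.image[ V ] +ˢ L) (≈ᴹ-trans (≈ᴹ-sym (αpr-decomposition x)) (C⇒q≈ (V⊆C x x∈V)))
          (+-intro Ip.image[ V ] L (Ip.image⁺ V x∈V) (σU∈L (α · x)))) (ρ-+L Ip.image[ V ]))

    open Coimage pr

  -- The restriction of M to pr(E), with E modulo ker pr as ground space: every vector of E is a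
  -- representative, so no membership proofs are carried along.
  full-summand : QMatroid F m ℓm
  full-summand = pullback M inclusion

  private
    module M′ = QMatroid full-summand
    module L′ = Loops full-summand
    module P′ = SubspaceProperties M′.space
    module Iι = LinearMapProperties inclusion
    module Iκ = LinearMapProperties quotientMap

    kernel-∩C : ∀ V → V ∩ C ≐ V ∩ Iβ.kernel
    kernel-∩C V =
      (λ x x∈ → let (x∈V , x∈C) = ∈-∩⁻ {V} {C} x∈ in
        ∈-∩⁺ {V} {Iβ.kernel} (x∈V , Iβ.∈-kernel⁺ (R.∈⇒h≈0 x∈C))) ,
      (λ x x∈ → let (x∈V , x∈K) = ∈-∩⁻ {V} {Iβ.kernel} x∈ in
        ∈-∩⁺ {V} {C} (x∈V , R.h≈0⇒∈ (Iβ.∈-kernel⁻ x∈K)))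

    -- This is `ρ-∩C` with dim β(V) for dim V - dim(V ∩ C), since C = ker β.
    ρ-β : ∀ V → ρ V ≡ SB.dim Iβ.image[ V ] + ρ (V ∩ C)
    ρ-β V = ℕ.+-cancelʳ-≡ (dim (V ∩ C)) _ _ (≡.trans (≡.sym (ρ-∩C V)) (≡.trans
      (≡.cong (_+ ρ (V ∩ C)) (≡.trans (Iβ.rank-nullity V)
        (≡.cong (SB.dim Iβ.image[ V ] +_) (≡.sym (dim-cong {V ∩ C} {V ∩ Iβ.kernel} (kernel-∩C V))))))
      (≡.trans (ℕ.+-assoc (SB.dim Iβ.image[ V ]) _ _) (≡.trans
        (≡.cong (SB.dim Iβ.image[ V ] +_) (ℕ.+-comm (dim (V ∩ C)) _))
        (≡.sym (ℕ.+-assoc (SB.dim Iβ.image[ V ]) _ _))))))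

    -- A loop x of the summand has pr x ∈ L, and pr kills L, so pr x = pr (pr x) = 0.
    loopless : ∀ {x} → x M′.∈ L′.L → x M′.∈ M′.0ˢ
    loopless {x} x∈ = M′.∈-0⁺ (≈ᴹ-trans (≈ᴹ-trans (≈ᴹ-sym (pr-idempotent x)) (L⇒pr≈0 (∈-L⁺
      (≡.trans (ρ-cong {⟨ pr · x ⟩} {Iι.image[ M′.⟨ x ⟩ ]} (proj₂ (Iι.image-⟨⟩ x) , proj₁ (Iι.image-⟨⟩ x))) (L′.∈-L⁻ x∈)))))
      (≈ᴹ-sym pr.0ᴹ-homo))

    -- W + ⟨x⟩ = E/ker pr lifts to D + ⟨pr x⟩ = E with D = W + ker pr, and pr x ∈ C.
    cyclic : ∀ x → x M′.∈ L′.C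
    cyclic x = L′.∈-C⁺ λ W (_ , whole⊆) → ℕ.≤-antisym
      (M′.monotone {W} {M′.whole} (P′.⊆-whole W))
      (ℕ.≤-trans (monotone {Iι.image[ M′.whole ]} {C} (Iι.image-⊆ M′.whole {C} λ y _ → pr∈C y))
        (ℕ.+-cancelˡ-≤ (SB.dim Iβ.image[ whole ]) _ _ (bound W whole⊆)))
      where
      open ℕ.≤-Reasoning
      K = Ip.kernel

      ρ-K∩C : ρ (K ∩ C) ≡ 0
      ρ-K∩C = ρ-⊆-null {K ∩ C} {L} (λ y y∈ → let (y∈K , y∈C) = ∈-∩⁻ {K} {C} y∈ in
        C∧pr≈0⇒L y∈C (Ip.∈-kernel⁻ y∈K)) ρ-L

      -- K ∩ C consists of loops, so ρ(K) = dim β(K). Comparing ρ(E) = dim β(E) + ρ(C) with ρ(D) ≤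
      -- ρ(pr W) + ρ(K) then gives ρ(C) ≤ ρ(pr W).
      ρ-K : ρ K ≤ SB.dim Iβ.image[ whole ]
      ρ-K = ℕ.≤-trans (ℕ.≤-reflexive (≡.trans (ρ-β K)
        (≡.trans (≡.cong (SB.dim Iβ.image[ K ] +_) ρ-K∩C) (ℕ.+-identityʳ _))))
        (SubspaceProperties.dim-mono B {Iβ.image[ K ]} {Iβ.image[ whole ]} (Iβ.image-mono {K} {whole} (⊆-whole K)))

      module _ (W : M′.Subspace) (whole⊆ : M′.whole M′.⊆ W M′.+ˢ M′.⟨ x ⟩) where
        D : Subspace
        D = Iι.image[ W ] +ˢ K

        D+x : D +ˢ ⟨ pr · x ⟩ ≐ whole
        D+x = ⊆-whole (D +ˢ ⟨ pr · x ⟩) , λ y _ →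
          let (w , w∈W , z , z∈x , e) = M′.∈-+⁻ {W} {M′.⟨ x ⟩} (whole⊆ y M′.∈-whole)
              U = D +ˢ ⟨ pr · x ⟩
              pry∈U : pr · y ∈ U
              pry∈U = Subspace.resp U (≈ᴹ-sym (≈ᴹ-trans e (pr.+ᴹ-homo w z)))
                (+-intro D ⟨ pr · x ⟩ (⊆-+ˡ Iι.image[ W ] K _ (Iι.image⁺ W w∈W))
                  (proj₁ (Iι.image-⟨⟩ x) _ (Iι.image⁺ M′.⟨ x ⟩ z∈x)))
              y-pry∈K : (y -ᴹ pr · y) ∈ K
              y-pry∈K = Ip.kernel-- (≈ᴹ-sym (pr-idempotent y))
          in Subspace.resp U (x-y+y≈x y (pr · y))
               (Subspace.+-closed U (⊆-+ˡ D ⟨ pr · x ⟩ _ (⊆-+ʳ Iι.image[ W ] K _ y-pry∈K)) pry∈U)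

        bound : SB.dim Iβ.image[ whole ] + ρ C ≤ SB.dim Iβ.image[ whole ] + ρ Iι.image[ W ]
        bound = begin
          SB.dim Iβ.image[ whole ] + ρ C             ≤⟨ ℕ.+-monoʳ-≤ (SB.dim Iβ.image[ whole ])
            (monotone {C} {whole ∩ C} λ y y∈C → ∈-∩⁺ {whole} {C} (∈-whole , y∈C)) ⟩
          SB.dim Iβ.image[ whole ] + ρ (whole ∩ C)   ≤⟨ ℕ.≤-reflexive (≡.sym (ρ-β whole)) ⟩
          ρ whole                                    ≤⟨ ℕ.≤-reflexive (≡.sym (∈-C⁻ D (pr∈C x) D+x)) ⟩
          ρ D                                        ≤⟨ subadditive Iι.image[ W ] K ⟩
          ρ Iι.image[ W ] + ρ K                      ≤⟨ ℕ.+-monoʳ-≤ (ρ Iι.image[ W ]) ρ-K ⟩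
          ρ Iι.image[ W ] + SB.dim Iβ.image[ whole ] ≤⟨ ℕ.≤-reflexive (ℕ.+-comm (ρ Iι.image[ W ]) _) ⟩
          SB.dim Iβ.image[ whole ] + ρ Iι.image[ W ] ∎

  full : Full full-summand
  full = ((λ x → loopless) , P′.0ˢ-⊆ L′.L) , (P′.⊆-whole L′.C , λ x _ → cyclic x)

  splitting : Splitting ρ A B M′.ρ
  splitting = record
    { α = α
    ; β = β
    ; γ = quotientMap
    ; injective = joint-kernel
    -- The components are prescribed in pr(E), L and σD(B). Equality in the third target means
    -- equality after `pr`, so w itself may be any vector of E.
    ; surjective = λ u v w → (pr · w +ᴹ σU · u) +ᴹ σD · v , α-≈ u v w , β-≈ u v w , pr-≈ u v w
    ; rank = λ V → ≡.trans (ρ-β V) (≡.cong (SB.dim Iβ.image[ V ] +_) (begin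
        ρ (V ∩ C)                                  ≡⟨ ρ-cong {V ∩ C} {V ∩ Iβ.kernel} (kernel-∩C V) ⟩
        ρ (V ∩ Iβ.kernel)                          ≡⟨ ρ-pr (V ∩ Iβ.kernel) (λ x x∈ →
          R.h≈0⇒∈ (Iβ.∈-kernel⁻ (∩-⊆ʳ V Iβ.kernel x x∈))) ⟨
        ρ Ip.image[ V ∩ Iβ.kernel ]                ≡⟨ ρ-cong {Iι.image[ Iκ.image[ V ∩ Iβ.kernel ] ]} {Ip.image[ V ∩ Iβ.kernel ]}
          (image-image quotientMap inclusion pr (λ _ → ≈ᴹ-refl) (V ∩ Iβ.kernel)) ⟨
        ρ Iι.image[ Iκ.image[ V ∩ Iβ.kernel ] ]    ∎))
    }
    where
    open ≡-Reasoning
    module _ (u : A.Carrierᴹ) (v : B.Carrierᴹ) (w : Carrierᴹ) where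
      x = (pr · w +ᴹ σU · u) +ᴹ σD · v

      β-≈ : β · x B.≈ᴹ v
      β-≈ = B.≈ᴹ-trans (β.+ᴹ-homo _ _) (B.≈ᴹ-trans (B.+ᴹ-cong
        (R.∈⇒h≈0 (Subspace.+-closed C (pr∈C w) (L⊆C _ (σU∈L u)))) (R.section v)) (B.+ᴹ-identityˡ v))

      α-≈ : α · x A.≈ᴹ u
      α-≈ = A.≈ᴹ-trans (α.+ᴹ-homo _ _) (A.≈ᴹ-trans (A.+ᴹ-cong
        (A.≈ᴹ-trans (α.+ᴹ-homo _ _) (A.+ᴹ-cong (αpr≈0 w)
          (A.≈ᴹ-trans (αᴸ.⟦⟧-cong (C⇒q≈ (L⊆C _ (σU∈L u)))) (αᴸσU u))))
        (A.≈ᴹ-trans (αᴸ.⟦⟧-cong (qσD≈0 v)) αᴸ.0ᴹ-homo))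
        (A.≈ᴹ-trans (A.+ᴹ-identityʳ _) (A.+ᴹ-identityˡ u)))

      pr-σD : pr · σD · v ≈ᴹ 0ᴹ
      pr-σD = ≈ᴹ-trans (x-0≈x (≈ᴹ-trans (σU.⟦⟧-cong (A.≈ᴹ-trans (αᴸ.⟦⟧-cong (qσD≈0 v)) αᴸ.0ᴹ-homo)) σU.0ᴹ-homo))
        (qσD≈0 v)

      pr-≈ : pr · x ≈ᴹ pr · w
      pr-≈ = ≈ᴹ-trans (pr.+ᴹ-homo _ _) (≈ᴹ-trans (+ᴹ-cong (≈ᴹ-trans (pr.+ᴹ-homo _ _)
        (+ᴹ-cong (pr-idempotent w) (L⇒pr≈0 (σU∈L u)))) pr-σD) (≈ᴹ-trans (+ᴹ-identityʳ _) (+ᴹ-identityʳ _)))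

-- Decompositions of a q-matroid as splittings

module _ {F : FiniteField c ℓ} where

  -- Comparing the ground spaces of concrete direct sums unfolds the proofs inside _⊕ᵛ_,
  -- so the sums are rewritten while M₁, M₂ and M₃ are still variables.

  ≅-respʳ : (M : RawQMatroid F m ℓm) (N N′ : RawQMatroid F n ℓn) → N ≡ N′ → M ≅ N → M ≅ N′
  ≅-respʳ M N N′ ≡.refl i = i

  ⊕-congʳ : (M : RawQMatroid F m ℓm) (N N′ : RawQMatroid F n ℓn) → N ≡ N′ → M ⊕ N ≡ M ⊕ N′
  ⊕-congʳ M N N′ ≡.refl = ≡.refl

  opaque
    unfolding DirectSum.ρ

    ⊕-≡ : (M : RawQMatroid F m ℓm) (N : RawQMatroid F n ℓn) → M ⊕ N ≡ record
      { space = RawQMatroid.space M ⊕ᵛ RawQMatroid.space N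
      ; ρ = DirectSum.ρ (RawQMatroid.ρ M) (RawQMatroid.ρ N) }
    ⊕-≡ M N = ≡.refl

  module _ (M₁ : RawQMatroid F m ℓm) (M₂ : RawQMatroid F n ℓn) (M₃ : RawQMatroid F o ℓo) where

    ⊕⊕-≡ : M₁ ⊕ M₂ ⊕ M₃ ≡ record
      { space = RawQMatroid.space M₁ ⊕ᵛ (RawQMatroid.space M₂ ⊕ᵛ RawQMatroid.space M₃)
      ; ρ = DirectSum.ρ (RawQMatroid.ρ M₁) (DirectSum.ρ (RawQMatroid.ρ M₂) (RawQMatroid.ρ M₃)) }
    ⊕⊕-≡ = ≡.trans
      (⊕-congʳ M₁ (M₂ ⊕ M₃) (record { space = RawQMatroid.space M₂ ⊕ᵛ RawQMatroid.space M₃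
                                   ; ρ = DirectSum.ρ (RawQMatroid.ρ M₂) (RawQMatroid.ρ M₃) }) (⊕-≡ M₂ M₃))
      (⊕-≡ M₁ (record { space = RawQMatroid.space M₂ ⊕ᵛ RawQMatroid.space M₃
                      ; ρ = DirectSum.ρ (RawQMatroid.ρ M₂) (RawQMatroid.ρ M₃) }))

    module _ {E : VectorSpace F p ℓp} (ρ : Subspaces.Subspace E → ℕ)
             (null : ∀ V → RawQMatroid.ρ M₁ V ≡ 0)
             (free : ∀ V → RawQMatroid.ρ M₂ V ≡ Subspaces.dim (RawQMatroid.space M₂) V)
             (ui : UnitIncreasing (RawQMatroid.space M₃) (RawQMatroid.ρ M₃))
             (mono : ∀ {V W} → RawQMatroid._⊆_ M₃ V W → RawQMatroid.ρ M₃ V ≤ RawQMatroid.ρ M₃ W) where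

      ≅⊕⊕⇒splitting : record { space = E ; ρ = ρ } ≅ M₁ ⊕ M₂ ⊕ M₃ →
        Splitting ρ (RawQMatroid.space M₁) (RawQMatroid.space M₂) (RawQMatroid.ρ M₃)
      ≅⊕⊕⇒splitting iso = ≅⇒splitting ρ (RawQMatroid.space M₁) (RawQMatroid.space M₂) (RawQMatroid.ρ M₃)
        null free ui mono (≅-respʳ (record { space = E ; ρ = ρ }) (M₁ ⊕ M₂ ⊕ M₃)
          (record
            { space = RawQMatroid.space M₁ ⊕ᵛ (RawQMatroid.space M₂ ⊕ᵛ RawQMatroid.space M₃)
            ; ρ = DirectSum.ρ (RawQMatroid.ρ M₁) (DirectSum.ρ (RawQMatroid.ρ M₂) (RawQMatroid.ρ M₃)) })
          ⊕⊕-≡ iso)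

      splitting⇒≅⊕⊕ : Splitting ρ (RawQMatroid.space M₁) (RawQMatroid.space M₂) (RawQMatroid.ρ M₃) →
        record { space = E ; ρ = ρ } ≅ M₁ ⊕ M₂ ⊕ M₃
      splitting⇒≅⊕⊕ S = ≅-respʳ (record { space = E ; ρ = ρ })
          (record
            { space = RawQMatroid.space M₁ ⊕ᵛ (RawQMatroid.space M₂ ⊕ᵛ RawQMatroid.space M₃)
            ; ρ = DirectSum.ρ (RawQMatroid.ρ M₁) (DirectSum.ρ (RawQMatroid.ρ M₂) (RawQMatroid.ρ M₃)) })
          (M₁ ⊕ M₂ ⊕ M₃) (≡.sym ⊕⊕-≡)
          (splitting⇒≅ ρ (RawQMatroid.space M₁) (RawQMatroid.space M₂) (RawQMatroid.ρ M₃)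
            null free ui mono S)

module _ {F : FiniteField c ℓ} (M N : QMatroid F m ℓm) (a b : ℕ) where
  private
    module M = QMatroid M
    module N = QMatroid N

    ui : UnitIncreasing N.space N.ρ
    ui {X} {V} = QMatroidProperties.ρ-unitIncreasing N {X} {V}
    mono : ∀ {V W} → V N.⊆ W → N.ρ V ≤ N.ρ W
    mono {V} {W} = N.monotone {V} {W}

  𝒰⊕𝒰⊕⇒splitting : QMatroid.raw M ≅ 𝒰 F 0 a ⊕ 𝒰 F b b ⊕ QMatroid.raw N →
    Splitting (RawQMatroid.ρ (QMatroid.raw M)) (_^ᵛ_ F a) (_^ᵛ_ F b) (RawQMatroid.ρ (QMatroid.raw N))
  𝒰⊕𝒰⊕⇒splitting = ≅⊕⊕⇒splitting (𝒰 F 0 a) (𝒰 F b b) (QMatroid.raw N) (RawQMatroid.ρ (QMatroid.raw M))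
    (λ _ → ≡.refl) (ρ-𝒰-free F b) ui (λ {V} {W} → mono {V} {W})

  splitting⇒𝒰⊕𝒰⊕ :
    Splitting (RawQMatroid.ρ (QMatroid.raw M)) (_^ᵛ_ F a) (_^ᵛ_ F b) (RawQMatroid.ρ (QMatroid.raw N)) →
    QMatroid.raw M ≅ 𝒰 F 0 a ⊕ 𝒰 F b b ⊕ QMatroid.raw N
  splitting⇒𝒰⊕𝒰⊕ = splitting⇒≅⊕⊕ (𝒰 F 0 a) (𝒰 F b b) (QMatroid.raw N) (RawQMatroid.ρ (QMatroid.raw M))
    (λ _ → ≡.refl) (ρ-𝒰-free F b) ui (λ {V} {W} → mono {V} {W})

module _ {F : FiniteField c ℓ} (M : QMatroid F m ℓm) where
  open QMatroid M
  open Loops M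
  open SubspaceProperties space
  private
    D = basisModulo C whole
    k = BasisModulo.size D
    module U = Retraction (retraction space (complementaryBasis space L))
    module X = Existence M (retraction space D) U.h U.σ U.section
      (complementaryRetraction-∈ space L) (complementaryRetraction-fix space L)

    k≡f : k ≡ dim whole ∸ dim C
    k≡f = ≡.trans (≡.sym (ℕ.m+n∸n≡m k (dim C))) (≡.cong (_∸ dim C) (≡.sym (dim-modulo {C} {whole} (⊆-whole C) D)))

  fullPart : QMatroid F m ℓm
  fullPart = X.full-summand

  fullPart-full : Full fullPart
  fullPart-full = X.full

  -- The construction produces as many coordinates as E has basis vectors modulo C. That number
  -- equals f only by `dim-modulo`, so the splitting is transported along the equation.
  fullPart-splitting : Splitting ρ (_^ᵛ_ F (dim L)) (_^ᵛ_ F (dim whole ∸ dim C)) (QMatroid.ρ fullPart)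
  fullPart-splitting = ≡.subst (λ k → Splitting ρ (_^ᵛ_ F (dim L)) (_^ᵛ_ F k) (QMatroid.ρ fullPart)) k≡f X.splitting

module _ {F : FiniteField c ℓ} (M : QMatroid F m ℓm) where

  fullPart-≅ : ∀ {l f} → QMatroid.dim M (Loops.L M) ≡ l →
    QMatroid.dim M (QMatroid.whole M) ∸ QMatroid.dim M (Loops.C M) ≡ f →
    QMatroid.raw M ≅ 𝒰 F 0 l ⊕ 𝒰 F f f ⊕ QMatroid.raw (fullPart M)
  fullPart-≅ {l} {f} e e′ = splitting⇒𝒰⊕𝒰⊕ M (fullPart M) l f
    (≡.subst₂ (λ l f → Splitting (QMatroid.ρ M) (_^ᵛ_ F l) (_^ᵛ_ F f) (QMatroid.ρ (fullPart M))) e e′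
      (fullPart-splitting M))

  -- The given decomposition and the constructed one induce core maps for the same C and L, whose
  -- targets are therefore equivalent.
  fullPart-unique : (a b : ℕ) (N : QMatroid F m ℓm) → Full N →
    QMatroid.raw M ≅ 𝒰 F 0 a ⊕ 𝒰 F b b ⊕ QMatroid.raw N →
    a ≡ QMatroid.dim M (Loops.L M) ×
    b ≡ QMatroid.dim M (QMatroid.whole M) ∸ QMatroid.dim M (Loops.C M) ×
    QMatroid.raw N ≅ QMatroid.raw (fullPart M)
  fullPart-unique a b N full iso =
    ≡.trans (≡.sym (dim-whole-^ᵛ F a)) S.dim-A ,
    ≡.trans (≡.sym (dim-whole-^ᵛ F b)) S.dim-B ,
    coreMap-unique M (Loops.C M) (Loops.L M) N (fullPart M) S.splitting⇒coreMap
      (SplittingProperties.splitting⇒coreMap M (fullPart M) (fullPart-splitting M) (fullPart-full M))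
    where module S = SplittingProperties M N (𝒰⊕𝒰⊕⇒splitting M N a b iso) full

-- Types of the form M ≅ M₁ ⊕ M₂ ⊕ M₃ are compared quickly only if they agree
-- syntactically; otherwise Agda unfolds the direct sums.  Below, l and f are
-- therefore metavariables, which the uniqueness part unifies with the terms of
-- the statement.  The existence part is stuck on the metavariable b until then.
Deferred : ∀ {a} → Bool → Set a → Set a
Deferred true  X = X
Deferred false X = X

defer : ∀ {a} (b : Bool) {X : Set a} → X → Deferred b X
defer true  x = x
defer false x = x

unify : ∀ {a} {A : Set a} (x y : A) → x ≡ y → A
unify x y _ = y

unify-then : ∀ {a b} {A : Set a} {B : Set b} (x y : A) → x ≡ y → B → B
unify-then x y _ z = z

theorem7p9 :
  ∀ {c ℓ m ℓm} (F : FiniteField c ℓ) (M : QMatroid F m ℓm) →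
  let open QMatroid M
      l = dim (cl M 0ˢ)
      f = dim whole ∸ dim (cyc M whole)
  in
  Σ (QMatroid F m ℓm) λ M′ →
    (Full M′ × raw ≅ 𝒰 F 0 l ⊕ 𝒰 F f f ⊕ QMatroid.raw M′)
    ×
    (∀ (a b : ℕ) (N : QMatroid F m ℓm) → Full N →
      raw ≅ 𝒰 F 0 a ⊕ 𝒰 F b b ⊕ QMatroid.raw N →
      a ≡ l × b ≡ f × QMatroid.raw N ≅ QMatroid.raw M′)
theorem7p9 F M =
  let open QMatroid M
      b : Bool
      b = _
      l : ℕ
      l = _
      f : ℕ
      f = _
      dim-L≡l : dim (Loops.L M) ≡ l
      dim-L≡l = _
      codim-C≡f : dim whole ∸ dim (Loops.C M) ≡ f
      codim-C≡f = _
  in fullPart M , (fullPart-full M , defer b (fullPart-≅ M {l} {f} dim-L≡l codim-C≡f)) ,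
     λ a b′ N full iso → let (a≡ , b≡ , N≅) = fullPart-unique M a b′ N full iso in
       ≡.trans {k = l} a≡ (unify dim-L≡l ≡.refl ≡.refl) ,
       ≡.trans {k = f} b≡ (unify codim-C≡f ≡.refl ≡.refl) ,
       unify-then b true ≡.refl N≅
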